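{- Let $p$ be a prime, $l\ge 0$ an integer, $q=p^l$, and let $k$ be an integer with $0\le k\le q/2$. For $n\ge0$ let $P(n)$ denote the $n\times n$ matrix with entries $\binom{i+j}{i}$, $0\le i,j<n$, and let $\chi_n(t)=\det(tI(n)-P(n))$. Then $$\chi_{q-k}(t)\equiv (t^2+t+1)^{(q-\epsilon(q))/3-k}\,(t-1)^{(q+2\epsilon(q))/3-k}\,\det(t^2I(k)+P(k))\pmod p,$$ where $\epsilon(q)\in\{ -1,0,1\}$ is defined by $\epsilon(q)\equiv q\pmod 3$.
   Context: $I(n)$ is the $n\times n$ identity matrix; the determinant of a $0\times 0$ matrix is $1$. The congruence is coefficientwise in $\mathbf{Z}[t]$. -}

module Defs where

open import Level using (0ℓ)
open import Algebra.Bundles using (RawRing)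
import Algebra.Definitions.RawSemiring as RawSemiringDefs
open import Data.Bool.Base using (if_then_else_)
open import Data.Fin.Base using (Fin; zero; suc; toℕ; punchIn)
open import Data.Fin.Properties using (_≟_)
open import Data.Integer.Base as ℤ using (ℤ; +_; -[1+_]; 0ℤ; 1ℤ; -1ℤ)
open import Data.Integer.Divisibility using (_∣_)
open import Data.List.Base using (List; []; _∷_; map)
open import Data.Nat.Base as ℕ using (ℕ; zero; suc)
open import Data.Nat.Combinatorics using (_C_)
open import Data.Vec.Functional using (Vector)
open import Relation.Binary.PropositionalEquality.Core using (_≡_)
open import Relation.Nullary.Decidable.Core using (does)

module Matrices {c ℓ} (R : RawRing c ℓ) where
  open RawRing R using (Carrier; _+_; _*_; -_; 0#; 1#; rawSemiring)
  open RawSemiringDefs rawSemiring using (_^_; sum)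

  infixl 6 _⊕_ _⊖_
  infixr 7 _⊙_

  Matrix : ℕ → Set c
  Matrix n = Vector (Vector Carrier n) n

  I : (n : ℕ) → Matrix n
  I n i j = if does (i ≟ j) then 1# else 0#

  _⊕_ _⊖_ : ∀ {n} → Matrix n → Matrix n → Matrix n
  (M ⊕ N) i j = M i j + N i j
  (M ⊖ N) i j = M i j + (- N i j)

  _⊙_ : ∀ {n} → Carrier → Matrix n → Matrix n
  (x ⊙ M) i j = x * M i j

  -- Laplace expansion along the first row; punchIn j skips column j.
  det : ∀ {n} → Matrix n → Carrier
  det {zero}  M = 1#
  det {suc n} M = sum λ j →
    (- 1#) ^ toℕ j * (M zero j * det (λ a b → M (suc a) (punchIn j b)))

-- Coefficient lists, constant term first; trailing zeros are allowed, so
-- equality of polynomials is coefficientwise (_≈ᴾ_) and not _≡_ of lists.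
ℤ[t] : Set
ℤ[t] = List ℤ

coeff : ℤ[t] → ℕ → ℤ
coeff []      _       = 0ℤ
coeff (a ∷ _) zero    = a
coeff (_ ∷ f) (suc i) = coeff f i

infix  4 _≈ᴾ_ _≡_[mod_]
infixl 6 _+ᴾ_
infixl 7 _*ᴾ_

_≈ᴾ_ : ℤ[t] → ℤ[t] → Set
f ≈ᴾ g = ∀ i → coeff f i ≡ coeff g i

_≡_[mod_] : ℤ[t] → ℤ[t] → ℕ → Set
f ≡ g [mod p ] = ∀ i → + p ∣ coeff f i ℤ.- coeff g i

_+ᴾ_ : ℤ[t] → ℤ[t] → ℤ[t]
[]      +ᴾ g       = g
(a ∷ f) +ᴾ []      = a ∷ f
(a ∷ f) +ᴾ (b ∷ g) = a ℤ.+ b ∷ f +ᴾ g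

_*ᴾ_ : ℤ[t] → ℤ[t] → ℤ[t]
[]      *ᴾ g = []
(a ∷ f) *ᴾ g = map (a ℤ.*_) g +ᴾ (0ℤ ∷ f *ᴾ g)

ℤ[t]-rawRing : RawRing 0ℓ 0ℓ
ℤ[t]-rawRing = record
  { Carrier = ℤ[t]
  ; _≈_     = _≈ᴾ_
  ; _+_     = _+ᴾ_
  ; _*_     = _*ᴾ_
  ; -_      = map (λ a → ℤ.- a)
  ; 0#      = []
  ; 1#      = 1ℤ ∷ []
  }

open RawRing ℤ[t]-rawRing public using (_+_; _*_; -_; 1#)
open RawSemiringDefs (RawRing.rawSemiring ℤ[t]-rawRing) public using (_^_)
open Matrices ℤ[t]-rawRing public

-- For an integer exponent e, the power f ^ e is the fraction
-- (f ^⁺ e) / (f ^⁻ e): these are f ^ max(e, 0) and f ^ max(-e, 0).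
-- For f monic, f ^⁻ e is monic, hence a non-zero-divisor modulo p, and an
-- equality of such fractions over 𝐅_p[t] is tested by multiplying out.
infixr 8 _^⁺_ _^⁻_

_^⁺_ _^⁻_ : ℤ[t] → ℤ → ℤ[t]
f ^⁺ (+ n)    = f ^ n
f ^⁺ -[1+ n ] = 1#
f ^⁻ (+ n)    = 1#
f ^⁻ -[1+ n ] = f ^ suc n

t : ℤ[t]
t = 0ℤ ∷ 1ℤ ∷ []

P : (n : ℕ) → Matrix n
P n i j = + ((toℕ i ℕ.+ toℕ j) C toℕ i) ∷ []

χ : ℕ → ℤ[t]
χ n = det (t ⊙ I n ⊖ P n)

ε : ℕ → ℤ
ε q with q ℕ.% 3
... | 0 = 0ℤ
... | 1 = 1ℤ
... | _ = -1ℤ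

-- The exponents of t² + t + 1 and t - 1.  The divisions by 3 are exact,
-- since ε q ≡ q (mod 3).  For k > q/3 the results can be negative: q = 2,
-- k = 1 gives e₂ = -1, where χ 1 = t - 1 ≡ (t² + 1) / (t - 1) (mod 2).
e₁ e₂ : (q k : ℕ) → ℤ
e₁ q k = (+ q ℤ.- ε q) ℤ./ + 3 ℤ.- + k
e₂ q k = (+ q ℤ.+ + 2 ℤ.* ε q) ℤ./ + 3 ℤ.- + k

{-# OPTIONS --safe #-}
module Submission where

-- Let q = p^l = m + 1.  Modulo p, the matrix P = P(q) represents a linear substitution of order
-- 3 on binary forms of degree m, since C(q, j) vanishes for 0 < j < q.  Hence P³ = I, so that
-- (t - P)(t² + t P + P²) = t³ - 1, and P² is P rotated by 180°.  As 2k ≤ q, the lower right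
-- k × k block of P vanishes, and that of t² + t P + P² is t² + P(k) rotated by 180°.  Jacobi's
-- identity for complementary minors then gives χ_{q-k}(t) (t³ - 1)^k = χ_q(t) det(t² I + P(k)).
-- Over R[ω] the substitution has an eigenvector x + ω y, which triangularises P and gives
-- χ_q(t) as the product of t - ω^i ω^(2(m-i)) for 0 ≤ i ≤ m; three consecutive factors
-- multiply to t³ - 1 = (t² + t + 1)(t - 1).

open import Defs using (module Matrices)
open import Algebra.Bundles using (CommutativeRing; RawRing)
import Algebra.Definitions.RawSemiring as RawSemiringDefinitions
import Algebra.Morphism.Structures as MorphismStructures
import Algebra.Properties.CommutativeMonoid.Sum as MonoidSummation
import Algebra.Properties.CommutativeSemiring.Exp as CommutativeExponentiation
import Algebra.Properties.Ring as RingProperties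
import Algebra.Properties.Semiring.Exp as Exponentiation
import Algebra.Properties.Semiring.Mult as Multiplication
import Algebra.Properties.Semiring.Mult.TCOptimised as Multiples
import Algebra.Properties.Semiring.Sum as Summation
import Algebra.Solver.Ring as RingSolver
open import Algebra.Solver.Ring.AlmostCommutativeRing
  using (fromCommutativeRing; _-Raw-AlmostCommutative⟶_)
open import Data.Bool.Base using (true; false; if_then_else_)
open import Data.Empty using (⊥-elim)
open import Data.Fin.Base as Fin
  using (Fin; zero; suc; toℕ; punchIn; _↑ˡ_; _↑ʳ_; splitAt; opposite)
open import Data.Fin.Patterns using (0F; 1F; 2F)
import Data.Fin.Properties as Fin
open import Data.Integer.Base as ℤ using (ℤ; +_; -[1+_]; 0ℤ; 1ℤ; -1ℤ)
open import Data.Integer.Divisibility.Signed as Signed using (∣⇒∣ᵤ)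
import Data.Integer.Properties as ℤ
open import Data.Integer.Tactic.RingSolver using (solve-∀)
import Data.Maybe.Base as Maybe
open import Data.Nat.Base as ℕ using (ℕ; zero; suc; _∸_; _≤_; s≤s; z≤n)
open import Data.Nat.Combinatorics using (_C_; nCk+nC[k+1]≡[n+1]C[k+1]; nCn≡1; nC1≡n)
open import Data.Nat.Coprimality using (Coprime; coprime-divisor)
open import Data.Nat.Divisibility using (_∣_; divides; _∣?_; ∣⇒≤; m∣m*n; ∣-trans; ∣1⇒≡1)
open import Data.Nat.DivMod using (_divMod_; result; [m+kn]%n≡m%n; m*n/n≡m)
open import Data.Nat.Primality using (Prime; prime⇒nonZero; prime⇒irreducible)
import Data.Nat.Properties as ℕ
open import Data.Product.Base using (∃; _,_; proj₁)
open import Data.Sum.Base using (_⊎_; inj₁; inj₂; [_,_]′)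
open import Data.Vec.Functional.Properties using (updateAt-updates; updateAt-minimal)
open import Function.Base using (_∘_; const)
open import Level using (0ℓ; _⊔_)
open import Relation.Binary.Consequences using (dec⇒weaklyDec)
open import Relation.Binary.PropositionalEquality.Core as ≡ using (_≡_; _≢_)
open import Relation.Binary.PropositionalEquality using (module ≡-Reasoning)
import Relation.Binary.Reasoning.Setoid as SetoidReasoning
open import Relation.Nullary.Decidable using (dec-true; dec-false)
open import Relation.Nullary.Decidable.Core using (does; yes; no)
open import Relation.Nullary.Negation.Core using (¬_)

-- The substitution comes from generating functions. Row i of P lists the coefficients of 1 / (1 -
-- x)^(i+1) below x^q, and modulo p these are the coefficients of (1 - x)^(q-1-i), because (1 - x)^q
-- ≡ 1 - x^q. Made homogeneous of degree m = q - 1 and multiplied by (-1)^m ≡ 1, row i is (-y)^i (x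
-- - y)^(m-i), the image of x^i y^(m-i) under x ↦ -y, y ↦ x - y. The prime 3 rules out
-- diagonalisation: there ω - ω², of square -3, is nilpotent. A unitriangular change of basis serves
-- all p alike, and ω is adjoined formally, so that equalities in R[ω] descend to R by comparing
-- components. Reduction modulo p keeps the integer coefficient lists and only coarsens their
-- equality; determinants are studied over an arbitrary commutative ring. The exponents of the
-- theorem can be negative, as k may exceed q/3. Hence common powers of t² + t + 1 and t - 1 are
-- cancelled at the very end; this is possible modulo p since their constant coefficients are 1 and
-- -1.

-- With integer coefficients the solver can decide when a coefficient vanishes, and so cancel.
module IntegerSolver {c ℓ} (R : CommutativeRing c ℓ) where
  open CommutativeRing R hiding (zero)
  open RingProperties ring
  open Multiples semiring
  open SetoidReasoning setoid

  -- With these multiples `1 × 1#` computes to `1#`, so that the constants 0 and 1 of the solver are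
  -- the ring's own `0#` and `1#` by computation.
  fromℤ : ℤ → Carrier
  fromℤ (+ n)    = n × 1#
  fromℤ -[1+ n ] = - (suc n × 1#)

  fromℤ-neg : ∀ i → fromℤ (ℤ.- i) ≈ - fromℤ i
  fromℤ-neg (+ zero)  = sym -0#≈0#
  fromℤ-neg (+ suc n) = refl
  fromℤ-neg -[1+ n ]  = sym (-‿involutive _)

  fromℤ-⊖ : ∀ m n → fromℤ (m ℤ.⊖ n) ≈ m × 1# - n × 1#
  fromℤ-⊖ m       zero    = begin
    m × 1#       ≈⟨ +-identityʳ _ ⟨
    m × 1# + 0#  ≈⟨ +-congˡ -0#≈0# ⟨
    m × 1# - 0#  ∎
  fromℤ-⊖ zero    (suc n) = sym (+-identityˡ _)
  fromℤ-⊖ (suc m) (suc n) = begin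
    fromℤ (suc m ℤ.⊖ suc n)               ≡⟨ ≡.cong fromℤ (ℤ.[1+m]⊖[1+n]≡m⊖n m n) ⟩
    fromℤ (m ℤ.⊖ n)                       ≈⟨ fromℤ-⊖ m n ⟩
    m × 1# - n × 1#                     ≈⟨ +-congʳ (+-identityʳ _) ⟨
    m × 1# + 0# - n × 1#                ≈⟨ +-congʳ (+-congˡ (-‿inverseʳ 1#)) ⟨
    m × 1# + (1# - 1#) - n × 1#         ≈⟨ +-congʳ (+-assoc _ _ _) ⟨
    m × 1# + 1# - 1# - n × 1#           ≈⟨ +-assoc _ _ _ ⟩
    m × 1# + 1# + (- 1# - n × 1#)       ≈⟨ +-congˡ (-‿anti-homo-+ _ _) ⟨
    m × 1# + 1# - (n × 1# + 1#)         ≈⟨ +-cong (+-comm _ _) (-‿cong (+-comm _ _)) ⟩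
    1# + m × 1# - (1# + n × 1#)         ≈⟨ +-cong (1+× m 1#) (-‿cong (1+× n 1#)) ⟨
    suc m × 1# - suc n × 1#             ∎

  fromℤ-+ : ∀ i j → fromℤ (i ℤ.+ j) ≈ fromℤ i + fromℤ j
  fromℤ-+ (+ m)    (+ n)    = ×-homo-+ 1# m n
  fromℤ-+ (+ m)    -[1+ n ] = fromℤ-⊖ m (suc n)
  fromℤ-+ -[1+ m ] (+ n)    = trans (fromℤ-⊖ n (suc m)) (+-comm _ _)
  fromℤ-+ -[1+ m ] -[1+ n ] = begin
    - (suc (suc (m ℕ.+ n)) × 1#)           ≡⟨ ≡.cong (λ k → - (suc k × 1#)) (≡.sym (+-suc m n)) ⟩
    - ((suc m ℕ.+ suc n) × 1#)             ≈⟨ -‿cong (×-homo-+ 1# (suc m) (suc n)) ⟩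
    - (suc m × 1# + suc n × 1#)            ≈⟨ -‿+-comm _ _ ⟨
    - (suc m × 1#) - suc n × 1#            ∎
    where open import Data.Nat.Properties using (+-suc)

  fromℤ-*⁺ : ∀ m j → fromℤ (+ m ℤ.* j) ≈ fromℤ (+ m) * fromℤ j
  fromℤ-*⁺ m (+ n)    = begin
    fromℤ (+ m ℤ.* + n)  ≡⟨ ≡.cong fromℤ (ℤ.pos-* m n) ⟨
    (m ℕ.* n) × 1#       ≈⟨ ×1-homo-* m n ⟩
    m × 1# * n × 1#      ∎
  fromℤ-*⁺ m -[1+ n ] = begin
    fromℤ (+ m ℤ.* -[1+ n ])       ≡⟨ ≡.cong fromℤ (ℤ.neg-distribʳ-* (+ m) (+ suc n)) ⟨
    fromℤ (ℤ.- (+ m ℤ.* + suc n))  ≈⟨ fromℤ-neg (+ m ℤ.* + suc n) ⟩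
    - fromℤ (+ m ℤ.* + suc n)      ≈⟨ -‿cong (fromℤ-*⁺ m (+ suc n)) ⟩
    - (m × 1# * suc n × 1#)        ≈⟨ -‿distribʳ-* _ _ ⟩
    m × 1# * - (suc n × 1#)        ∎

  fromℤ-* : ∀ i j → fromℤ (i ℤ.* j) ≈ fromℤ i * fromℤ j
  fromℤ-* (+ m)    j = fromℤ-*⁺ m j
  fromℤ-* -[1+ m ] j = begin
    fromℤ (-[1+ m ] ℤ.* j)       ≡⟨ ≡.cong fromℤ (ℤ.neg-distribˡ-* (+ suc m) j) ⟨
    fromℤ (ℤ.- (+ suc m ℤ.* j))  ≈⟨ fromℤ-neg (+ suc m ℤ.* j) ⟩
    - fromℤ (+ suc m ℤ.* j)      ≈⟨ -‿cong (fromℤ-*⁺ (suc m) j) ⟩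
    - (suc m × 1# * fromℤ j)     ≈⟨ -‿distribˡ-* _ _ ⟩
    - (suc m × 1#) * fromℤ j     ∎

  private
    morphism : ℤ.+-*-rawRing -Raw-AlmostCommutative⟶ fromCommutativeRing R
    morphism = record
      { ⟦_⟧    = fromℤ
      ; +-homo = fromℤ-+
      ; *-homo = fromℤ-*
      ; -‿homo = fromℤ-neg
      ; 0-homo = refl
      ; 1-homo = refl
      }

  open RingSolver ℤ.+-*-rawRing (fromCommutativeRing R) morphism
    (λ i j → Maybe.map (λ i≡j → reflexive (≡.cong fromℤ i≡j)) (dec⇒weaklyDec ℤ._≟_ i j)) public
    using (solve; _:+_; _:*_; _:-_; :-_; _:=_; con)

-- Determinants: linearity and alternation in the rows.

module Determinant {c ℓ} (R : CommutativeRing c ℓ) where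
  open import Data.Vec.Functional using (Vector; _∷_; updateAt; insertAt)
  open CommutativeRing R hiding (zero)
  open RingProperties ring using (+-inverseˡ-unique)
  open Exponentiation semiring
  open Summation semiring
  open MonoidSummation *-commutativeMonoid public using ()
    renaming (sum to product; sum-cong-≋ to product-cong; sum-replicate-zero to product-1)
  open Matrices rawRing public
  open IntegerSolver R
  open SetoidReasoning setoid

  private variable
    n : ℕ

  infix 4 _≈ᵐ_
  _≈ᵐ_ : Matrix n → Matrix n → Set ℓ
  M ≈ᵐ N = ∀ i j → M i j ≈ N i j

  infixr 7 _⊡_
  _⊡_ : Matrix n → Matrix n → Matrix n
  (M ⊡ N) i j = sum λ k → M i k * N k j

  sum-0 : (f : Vector Carrier n) → (∀ i → f i ≈ 0#) → sum f ≈ 0#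
  sum-0 {n} f f≈0 = trans (sum-cong-≋ f≈0) (sum-replicate-zero n)

  sum-linear : ∀ x (f g : Vector Carrier n) →
               sum (λ i → x * f i + g i) ≈ x * sum f + sum g
  sum-linear x f g = trans (∑-distrib-+ (λ i → x * f i) g) (+-congʳ (sym (*-distribˡ-sum x f)))

  I-diagonal : (i : Fin n) → I n i i ≡ 1#
  I-diagonal i = ≡.cong (if_then 1# else 0#) (dec-true (i Fin.≟ i) ≡.refl)

  I-off-diagonal : {i j : Fin n} → i ≢ j → I n i j ≡ 0#
  I-off-diagonal {i = i} {j} i≢j = ≡.cong (if_then 1# else 0#) (dec-false (i Fin.≟ j) i≢j)

  sum-I : (j : Fin n) (f : Vector Carrier n) → sum (λ i → I n j i * f i) ≈ f j
  sum-I zero    f = begin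
    1# * f zero + sum (λ i → 0# * f (suc i))  ≈⟨ +-cong (*-identityˡ _) (sum-0 (λ i → 0# * f (suc i)) λ i → zeroˡ _) ⟩
    f zero + 0#                               ≈⟨ +-identityʳ _ ⟩
    f zero                                    ∎
  sum-I (suc j) f = begin
    0# * f zero + sum (λ i → I _ j i * f (suc i))  ≈⟨ +-cong (zeroˡ _) (sum-I j (f ∘ suc)) ⟩
    0# + f (suc j)                                 ≈⟨ +-identityˡ _ ⟩
    f (suc j)                                      ∎

  I-sym : (i j : Fin n) → I n i j ≡ I n j i
  I-sym zero    zero    = ≡.refl
  I-sym zero    (suc j) = ≡.refl
  I-sym (suc i) zero    = ≡.refl
  I-sym (suc i) (suc j) = I-sym i j

  sum-I′ : (j : Fin n) (f : Vector Carrier n) → sum (λ i → f i * I n i j) ≈ f j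
  sum-I′ j f = trans (sum-cong-≋ λ i → trans (*-comm _ _) (*-congʳ (reflexive (I-sym i j)))) (sum-I j f)

  minor : Matrix (suc n) → Fin (suc n) → Matrix n
  minor M j a b = M (suc a) (punchIn j b)

  sign : Fin n → Carrier
  sign j = (- 1#) ^ toℕ j

  laplace : Matrix (suc n) → Fin (suc n) → Carrier
  laplace M j = sign j * (M zero j * det (minor M j))

  det-cong : {M N : Matrix n} → M ≈ᵐ N → det M ≈ det N
  det-cong {zero}  M≈N = refl
  det-cong {suc n} M≈N = sum-cong-≋ λ j →
    *-congˡ {sign j} (*-cong (M≈N zero j) (det-cong λ a b → M≈N (suc a) (punchIn j b)))

  -- Three matrices are compared entry by entry, instead of one matrix having a row replaced:
  -- minors, bordered matrices and products with a fixed matrix then inherit the relation directly.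
  -- The scalar x makes one condition cover both additivity and homogeneity.
  record RowLinear (x : Carrier) (i : Fin n) (K M N : Matrix n) : Set ℓ where
    constructor rowLinear
    field
      at     : ∀ j → K i j ≈ x * M i j + N i j
      off    : ∀ r → r ≢ i → ∀ j → K r j ≈ M r j
      off′   : ∀ r → r ≢ i → ∀ j → K r j ≈ N r j

  -- Abstracted from `det` so that the uniqueness theorem also applies to functions derived from it,
  -- such as det (M N) for fixed N, and to pullbacks along `border`.
  record Alternating (D : Matrix n → Carrier) : Set (c ⊔ ℓ) where
    field
      cong   : ∀ {M N} → M ≈ᵐ N → D M ≈ D N
      linear : ∀ {x i K M N} → RowLinear x i K M N → D K ≈ x * D M + D N
      equal  : ∀ {i j M} → i ≢ j → (∀ k → M i k ≈ M j k) → D M ≈ 0#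

  det-linear : ∀ {x i} {K M N : Matrix n} → RowLinear x i K M N → det K ≈ x * det M + det N
  det-linear {suc n} {x} {zero} {K} {M} {N} (rowLinear at off off′) =
    trans (sum-cong-≋ term) (sum-linear x (laplace M) (laplace N))
    where
    term : ∀ j → laplace K j ≈ x * laplace M j + laplace N j
    term j = begin
      sign j * (K zero j * det (minor K j))
        ≈⟨ *-congˡ (*-congʳ (at j)) ⟩
      sign j * ((x * M zero j + N zero j) * det (minor K j))
        ≈⟨ solve 5 (λ s x m n d → s :* ((x :* m :+ n) :* d) := x :* (s :* (m :* d)) :+ s :* (n :* d))
             refl (sign j) x (M zero j) (N zero j) (det (minor K j)) ⟩
      x * (sign j * (M zero j * det (minor K j))) + sign j * (N zero j * det (minor K j))
        ≈⟨ +-cong (*-congˡ (*-congˡ (*-congˡ (det-cong λ a b → off (suc a) (λ ()) _))))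
                  (*-congˡ (*-congˡ (det-cong λ a b → off′ (suc a) (λ ()) _))) ⟩
      x * (sign j * (M zero j * det (minor M j))) + sign j * (N zero j * det (minor N j)) ∎
  det-linear {suc n} {x} {suc i} {K} {M} {N} (rowLinear at off off′) =
    trans (sum-cong-≋ term) (sum-linear x (laplace M) (laplace N))
    where
    linear-minor : ∀ j → RowLinear x i (minor K j) (minor M j) (minor N j)
    linear-minor j = rowLinear (λ b → at (punchIn j b))
      (λ r r≢i b → off (suc r) (r≢i ∘ Fin.suc-injective) (punchIn j b))
      (λ r r≢i b → off′ (suc r) (r≢i ∘ Fin.suc-injective) (punchIn j b))
    term : ∀ j → laplace K j ≈ x * laplace M j + laplace N j
    term j = begin
      sign j * (K zero j * det (minor K j))
        ≈⟨ *-congˡ (*-congˡ (det-linear (linear-minor j))) ⟩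
      sign j * (K zero j * (x * det (minor M j) + det (minor N j)))
        ≈⟨ solve 5 (λ s k x d e → s :* (k :* (x :* d :+ e)) := x :* (s :* (k :* d)) :+ s :* (k :* e))
             refl (sign j) (K zero j) x (det (minor M j)) (det (minor N j)) ⟩
      x * (sign j * (K zero j * det (minor M j))) + sign j * (K zero j * det (minor N j))
        ≈⟨ +-cong (*-congˡ (*-congˡ (*-congʳ (off zero (λ ()) j))))
                  (*-congˡ (*-congʳ (off′ zero (λ ()) j))) ⟩
      x * (sign j * (M zero j * det (minor M j))) + sign j * (N zero j * det (minor N j)) ∎

  -- The terms of the expansion along two equal rows r cancel in pairs: deleting
  -- column j and then k, or k and then j, leaves the same columns punchIn j ∘ punchIn k.
  double-expansion : (r : Vector Carrier (suc (suc n))) (h : (Fin n → Fin (suc (suc n))) → Carrier) →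
    (∀ {f g} → (∀ b → f b ≡ g b) → h f ≈ h g) →
    sum (λ j → sum λ k → sign j * (sign k * (r j * (r (punchIn j k) * h (punchIn j ∘ punchIn k))))) ≈ 0#
  double-expansion {n} r h h-cong = begin
    sum (F zero) + sum (λ j → F (suc j) zero + sum (λ k → F (suc j) (suc k)))
      ≈⟨ +-congˡ (∑-distrib-+ (λ j → F (suc j) zero) (λ j → sum (λ k → F (suc j) (suc k)))) ⟩
    sum (F zero) + (sum (λ j → F (suc j) zero) + sum (λ j → sum (λ k → F (suc j) (suc k))))
      ≈⟨ +-assoc _ _ _ ⟨
    sum (F zero) + sum (λ j → F (suc j) zero) + sum (λ j → sum (λ k → F (suc j) (suc k)))
      ≈⟨ +-cong (sym (∑-distrib-+ (F zero) (λ j → F (suc j) zero))) (rest n r h h-cong) ⟩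
    sum (λ k → F zero k + F (suc k) zero) + 0#
      ≈⟨ +-identityʳ _ ⟩
    sum (λ k → F zero k + F (suc k) zero)
      ≈⟨ sum-0 _ cancel ⟩
    0# ∎
    where
    F : Fin (suc (suc n)) → Fin (suc n) → Carrier
    F j k = sign j * (sign k * (r j * (r (punchIn j k) * h (punchIn j ∘ punchIn k))))
    cancel : ∀ k → F zero k + F (suc k) zero ≈ 0#
    cancel k = solve 4 (λ s a b d →
        con (+ 1) :* (s :* (a :* (b :* d))) :+ (:- con (+ 1)) :* s :* (con (+ 1) :* (b :* (a :* d))) := con (+ 0))
      refl (sign k) (r zero) (r (suc k)) (h (suc ∘ punchIn k))
    -- Pairs that avoid column 0. Both signs flip, so their product is unchanged, and column 0
    -- survives every deletion: what remains is the same double sum for the tail of r, with h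
    -- precomposed with `lift`.
    rest : ∀ n (r : Vector Carrier (suc (suc n))) (h : (Fin n → Fin (suc (suc n))) → Carrier) →
      (∀ {f g} → (∀ b → f b ≡ g b) → h f ≈ h g) →
      sum (λ j → sum λ k → sign (suc j) * (sign (suc k) * (r (suc j) * (r (suc (punchIn j k)) *
        h (punchIn (suc j) ∘ punchIn (suc k)))))) ≈ 0#
    rest zero    r h h-cong = +-identityʳ 0#
    rest (suc n) r h h-cong = trans
      (sum-cong-≋ λ j → sum-cong-≋ λ k → trans
        (solve 5 (λ s t a b d → (:- con (+ 1)) :* s :* ((:- con (+ 1)) :* t :* (a :* (b :* d)))
                              := s :* (t :* (a :* (b :* d))))
          refl (sign j) (sign k) (r (suc j)) (r (suc (punchIn j k))) _)
        (*-congˡ (*-congˡ (*-congˡ (*-congˡ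
          (h-cong {punchIn (suc j) ∘ punchIn (suc k)} {lift (punchIn j ∘ punchIn k)}
            λ { zero → ≡.refl ; (suc b) → ≡.refl }))))))
      (double-expansion (r ∘ suc) (λ f → h (lift f)) λ {f} {g} f≗g → h-cong {lift f} {lift g} λ
        { zero → ≡.refl ; (suc b) → ≡.cong suc (f≗g b) })
      where
      lift : (Fin n → Fin (suc (suc n))) → Fin (suc n) → Fin (suc (suc (suc n)))
      lift f zero    = zero
      lift f (suc b) = suc (f b)

  module _ (D : Matrix n → Carrier)
    (cong : ∀ {M N} → M ≈ᵐ N → D M ≈ D N)
    (linear : ∀ {x i K M N} → RowLinear x i K M N → D K ≈ x * D M + D N) where

    -- Put u + v into both rows and expand: the terms with u twice and v twice vanish, so the two
    -- mixed terms are opposite. Vanishing is assumed for this one pair of rows, because the proof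
    -- that `det` is alternating calls the lemma when only some pairs are settled.
    swap-rows : ∀ {a b} → a ≢ b → (∀ {M} → (∀ k → M a k ≈ M b k) → D M ≈ 0#) →
      ∀ {M N} → (∀ k → N a k ≈ M b k) → (∀ k → N b k ≈ M a k) →
      (∀ r → r ≢ a → r ≢ b → ∀ k → N r k ≈ M r k) → D N ≈ - D M
    swap-rows {a} {b} a≢b equal {M} {N} N-a N-b N-off = begin
      D N        ≈⟨ cong N≈W ⟩
      D (W v u)  ≈⟨ +-inverseˡ-unique _ _ sum≈0 ⟩
      - D (W u v) ≈⟨ -‿cong (cong W≈M) ⟩
      - D M      ∎
      where
      u v : Vector Carrier n
      u = M a
      v = M b
      _⊹_ : Vector Carrier n → Vector Carrier n → Vector Carrier n
      (x ⊹ y) k = 1# * x k + y k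
      W : Vector Carrier n → Vector Carrier n → Matrix n
      W x y = updateAt (updateAt M b (const y)) a (const x)
      W-a : ∀ x y → W x y a ≡ x
      W-a x y = updateAt-updates a _
      W-b : ∀ x y → W x y b ≡ y
      W-b x y = ≡.trans (updateAt-minimal b a _ (a≢b ∘ ≡.sym)) (updateAt-updates b _)
      W-off : ∀ x y {r} → r ≢ a → r ≢ b → W x y r ≡ M r
      W-off x y {r} r≢a r≢b = ≡.trans (updateAt-minimal r a _ r≢a) (updateAt-minimal r b _ r≢b)
      at-row : ∀ {x y : Vector Carrier n} → x ≡ y → ∀ k → x k ≈ y k
      at-row ≡.refl k = refl
      W-a′ : ∀ x x′ y r → r ≢ a → W x y r ≡ W x′ y r
      W-a′ x x′ y r r≢a = ≡.trans (updateAt-minimal r a _ r≢a) (≡.sym (updateAt-minimal r a _ r≢a))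
      W-b′ : ∀ x y y′ r → r ≢ b → W x y r ≡ W x y′ r
      W-b′ x y y′ r r≢b with r Fin.≟ a
      ... | yes ≡.refl = ≡.trans (W-a x y) (≡.sym (W-a x y′))
      ... | no r≢a     = ≡.trans (W-off x y r≢a r≢b) (≡.sym (W-off x y′ r≢a r≢b))
      linear-a : ∀ x x′ y → D (W (x ⊹ x′) y) ≈ 1# * D (W x y) + D (W x′ y)
      linear-a x x′ y = linear {i = a} (rowLinear
        (λ k → begin
          W (x ⊹ x′) y a k           ≈⟨ at-row (W-a _ y) k ⟩
          1# * x k + x′ k            ≈⟨ +-cong (*-congˡ (at-row (W-a x y) k)) (at-row (W-a x′ y) k) ⟨
          1# * W x y a k + W x′ y a k ∎)
        (λ r r≢a → at-row (W-a′ _ _ _ r r≢a))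
        (λ r r≢a → at-row (W-a′ _ _ _ r r≢a)))
      linear-b : ∀ x y y′ → D (W x (y ⊹ y′)) ≈ 1# * D (W x y) + D (W x y′)
      linear-b x y y′ = linear {i = b} (rowLinear
        (λ k → begin
          W x (y ⊹ y′) b k           ≈⟨ at-row (W-b x _) k ⟩
          1# * y k + y′ k            ≈⟨ +-cong (*-congˡ (at-row (W-b x y) k)) (at-row (W-b x y′) k) ⟨
          1# * W x y b k + W x y′ b k ∎)
        (λ r r≢b → at-row (W-b′ _ _ _ r r≢b))
        (λ r r≢b → at-row (W-b′ _ _ _ r r≢b)))
      same : ∀ x → D (W x x) ≈ 0#
      same x = equal (at-row (≡.trans (W-a x x) (≡.sym (W-b x x))))
      sum≈0 : D (W v u) + D (W u v) ≈ 0#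
      sum≈0 = begin
        D (W v u) + D (W u v)
          ≈⟨ solve 2 (λ x y → x :+ y := con (+ 1) :* (con (+ 1) :* con (+ 0) :+ y) :+ (con (+ 1) :* x :+ con (+ 0)))
               refl (D (W v u)) (D (W u v)) ⟩
        1# * (1# * 0# + D (W u v)) + (1# * D (W v u) + 0#)
          ≈⟨ +-cong (*-congˡ (+-congʳ (*-congˡ (same u)))) (+-congˡ (same v)) ⟨
        1# * (1# * D (W u u) + D (W u v)) + (1# * D (W v u) + D (W v v))
          ≈⟨ +-cong (*-congˡ (linear-b u u v)) (linear-b v u v) ⟨
        1# * D (W u (u ⊹ v)) + D (W v (u ⊹ v))
          ≈⟨ linear-a u v (u ⊹ v) ⟨
        D (W (u ⊹ v) (u ⊹ v))
          ≈⟨ same (u ⊹ v) ⟩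
        0# ∎
      N≈W : N ≈ᵐ W v u
      N≈W r k with r Fin.≟ a | r Fin.≟ b
      ... | yes ≡.refl | _          = trans (N-a k) (at-row (≡.sym (W-a v u)) k)
      ... | no _       | yes ≡.refl = trans (N-b k) (at-row (≡.sym (W-b v u)) k)
      ... | no r≢a     | no r≢b     = trans (N-off r r≢a r≢b k) (at-row (≡.sym (W-off v u r≢a r≢b)) k)
      W≈M : W u v ≈ᵐ M
      W≈M r k with r Fin.≟ a | r Fin.≟ b
      ... | yes ≡.refl | _          = at-row (W-a u v) k
      ... | no _       | yes ≡.refl = at-row (W-b u v) k
      ... | no r≢a     | no r≢b     = at-row (W-off u v r≢a r≢b) k

  det-equal₀₁ : (M : Matrix (suc (suc n))) → (∀ k → M zero k ≈ M (suc zero) k) → det M ≈ 0#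
  det-equal₀₁ {n} M M₀≈M₁ = begin
    sum (laplace M)
      ≈⟨ sum-cong-≋ (λ j → begin
           sign j * (M zero j * sum (laplace (minor M j)))
             ≈⟨ *-assoc _ _ _ ⟨
           sign j * M zero j * sum (laplace (minor M j))
             ≈⟨ *-distribˡ-sum (sign j * M zero j) (laplace (minor M j)) ⟩
           sum (λ k → sign j * M zero j * laplace (minor M j) k)
             ≈⟨ sum-cong-≋ (λ k → trans
                  (solve 5 (λ s a t b d → s :* a :* (t :* (b :* d)) := s :* (t :* (a :* (b :* d)))) refl
                    (sign j) (M zero j) (sign k) (M (suc zero) (punchIn j k)) (h (punchIn j ∘ punchIn k)))
                  (*-congˡ (*-congˡ (*-congˡ (*-congʳ (sym (M₀≈M₁ (punchIn j k)))))))) ⟩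
           sum (λ k → sign j * (sign k * (M zero j * (M zero (punchIn j k) * h (punchIn j ∘ punchIn k))))) ∎) ⟩
    sum (λ j → sum λ k → sign j * (sign k * (M zero j * (M zero (punchIn j k) * h (punchIn j ∘ punchIn k)))))
      ≈⟨ double-expansion (M zero) h (λ f≗g → det-cong λ a b → reflexive (≡.cong (M (suc (suc a))) (f≗g b))) ⟩
    0# ∎
    where
    h : (Fin n → Fin (suc (suc n))) → Carrier
    h f = det (λ a b → M (suc (suc a)) (f b))

  EqualRows : (n : ℕ) → Set (c ⊔ ℓ)
  EqualRows n = ∀ (M : Matrix n) {i j} → i ≢ j → (∀ k → M i k ≈ M j k) → det M ≈ 0#

  det-equal-tail : EqualRows n → ∀ (M : Matrix (suc n)) {i j} → i ≢ j →
                   (∀ k → M (suc i) k ≈ M (suc j) k) → det M ≈ 0#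
  det-equal-tail equal M i≢j eq = sum-0 (laplace M) λ k → trans
    (*-congˡ (trans (*-congˡ (equal (minor M k) i≢j λ l → eq (punchIn k l))) (zeroʳ _)))
    (zeroʳ (sign k))

  -- Exchanging rows 1 and j + 1 brings the two equal rows to the top, where the double expansion
  -- applies. Both exchanged rows lie below row 0, so the exchange rests on the induction hypothesis
  -- alone.
  det-equal-head : EqualRows (suc n) → (M : Matrix (suc (suc n))) → ∀ j →
                   (∀ k → M zero k ≈ M (suc j) k) → det M ≈ 0#
  det-equal-head         equal M zero    eq = det-equal₀₁ M eq
  det-equal-head {suc n} equal M (suc j) eq = begin
    det M              ≈⟨ swap-rows det det-cong det-linear {a = suc zero} {suc (suc j)} (λ ())
                             (λ {M} → det-equal-tail equal M {zero} {suc j} (λ ())) {N} {M} N-b (λ k → refl) N-off ⟩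
    - det N            ≈⟨ -‿cong (det-equal₀₁ N eq) ⟩
    - 0#               ≈⟨ solve 0 (:- con (+ 0) := con (+ 0)) refl ⟩
    0#                 ∎
    where
    tail : Fin (suc n) → Vector Carrier _
    tail r = M (suc (suc r))
    N : Matrix _
    N zero          = M zero
    N (suc zero)    = M (suc (suc j))
    N (suc (suc r)) = updateAt tail j (const (M (suc zero))) r
    N-b : ∀ k → M (suc zero) k ≈ N (suc (suc j)) k
    N-b k = reflexive (≡.cong (λ f → f k) (≡.sym (updateAt-updates j tail)))
    N-off : ∀ r → r ≢ suc zero → r ≢ suc (suc j) → ∀ k → M r k ≈ N r k
    N-off zero          _   _   k = refl
    N-off (suc zero)    r≢a _   k = ⊥-elim (r≢a ≡.refl)
    N-off (suc (suc r)) _   r≢b k = reflexive (≡.cong (λ f → f k) (≡.sym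
      (updateAt-minimal r j tail λ r≡j → r≢b (≡.cong (λ i → suc (suc i)) r≡j))))

  det-equal : EqualRows n
  det-equal {suc n}       M {zero}  {zero}  i≢j eq = ⊥-elim (i≢j ≡.refl)
  det-equal {suc n}       M {suc i} {suc j} i≢j eq =
    det-equal-tail det-equal M (λ i≡j → i≢j (≡.cong suc i≡j)) eq
  det-equal {suc (suc n)} M {zero}  {suc j} i≢j eq = det-equal-head det-equal M j eq
  det-equal {suc (suc n)} M {suc i} {zero}  i≢j eq = det-equal-head det-equal M i (λ k → sym (eq k))

  -- Uniqueness of the determinant among alternating functions.

  linear-form : (L : Vector Carrier n → Carrier) → (∀ {u v} → (∀ k → u k ≈ v k) → L u ≈ L v) →
    (∀ x u v → L (λ k → x * u k + v k) ≈ x * L u + L v) →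
    ∀ v → L v ≈ sum λ j → v j * L (I n j)
  linear-form {zero} L L-cong L-linear v = begin
    L v                               ≈⟨ solve 1 (λ x → x := (con (+ 1) :* x :+ x) :- x) refl (L v) ⟩
    1# * L v + L v - L v              ≈⟨ +-congʳ (L-linear 1# v v) ⟨
    L (λ k → 1# * v k + v k) - L v    ≈⟨ +-congʳ (L-cong λ ()) ⟩
    L v - L v                         ≈⟨ -‿inverseʳ _ ⟩
    0#                                ∎
  linear-form {suc n} L L-cong L-linear v = begin
    L v
      ≈⟨ L-cong split ⟩
    L (λ k → v zero * I (suc n) zero k + (0# ∷ v ∘ suc) k)
      ≈⟨ L-linear (v zero) (I (suc n) zero) (0# ∷ v ∘ suc) ⟩
    v zero * L (I (suc n) zero) + L (0# ∷ v ∘ suc)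
      ≈⟨ +-congˡ (linear-form (λ u → L (0# ∷ u))
           (λ u≈v → L-cong λ { zero → refl ; (suc k) → u≈v k })
           (λ x u w → trans
             (L-cong λ { zero → sym (trans (+-identityʳ _) (zeroʳ x)) ; (suc k) → refl })
             (L-linear x (0# ∷ u) (0# ∷ w)))
           (v ∘ suc)) ⟩
    v zero * L (I (suc n) zero) + sum (λ j → v (suc j) * L (0# ∷ I n j))
      ≈⟨ +-congˡ (sum-cong-≋ λ j → *-congˡ {v (suc j)} (L-cong λ { zero → refl ; (suc k) → refl })) ⟩
    sum (λ j → v j * L (I (suc n) j)) ∎
    where
    split : ∀ k → v k ≈ v zero * I (suc n) zero k + (0# ∷ v ∘ suc) k
    split zero    = sym (trans (+-identityʳ _) (*-identityʳ _))
    split (suc k) = sym (trans (+-congʳ (zeroʳ _)) (+-identityˡ _))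

  insert-cong : ∀ {u v : Vector Carrier n} j → (∀ k → u k ≈ v k) → ∀ k → insertAt u j 0# k ≈ insertAt v j 0# k
  insert-cong {n}     zero    u≈v zero    = refl
  insert-cong {n}     zero    u≈v (suc k) = u≈v k
  insert-cong {suc n} (suc j) u≈v zero    = u≈v zero
  insert-cong {suc n} (suc j) u≈v (suc k) = insert-cong j (u≈v ∘ suc) k

  insert-linear : ∀ x {w u v : Vector Carrier n} j → (∀ k → w k ≈ x * u k + v k) →
    ∀ k → insertAt w j 0# k ≈ x * insertAt u j 0# k + insertAt v j 0# k
  insert-linear {n}     x zero    eq zero    = sym (trans (+-identityʳ _) (zeroʳ x))
  insert-linear {n}     x zero    eq (suc k) = eq k
  insert-linear {suc n} x (suc j) eq zero    = eq zero
  insert-linear {suc n} x (suc j) eq (suc k) = insert-linear x j (eq ∘ suc) k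

  insert-I : (j : Fin (suc n)) (i : Fin n) → ∀ k → insertAt (I n i) j 0# k ≈ I (suc n) (punchIn j i) k
  insert-I {suc n} zero    i       zero    = refl
  insert-I {suc n} zero    i       (suc k) = refl
  insert-I {suc n} (suc j) zero    zero    = refl
  insert-I {suc n} (suc j) zero    (suc k) = reflexive (insert-0 j k)
    where
    insert-0 : ∀ {n} (j k : Fin (suc n)) → insertAt (λ _ → 0#) j 0# k ≡ 0#
    insert-0 {n}     zero    zero    = ≡.refl
    insert-0 {n}     zero    (suc k) = ≡.refl
    insert-0 {suc n} (suc j) zero    = ≡.refl
    insert-0 {suc n} (suc j) (suc k) = insert-0 j k
  insert-I {suc n} (suc j) (suc i) zero    = refl
  insert-I {suc n} (suc j) (suc i) (suc k) = insert-I j i k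

  insert-remove : (j : Fin (suc n)) (u : Vector Carrier (suc n)) →
    ∀ k → u k ≈ u j * I (suc n) j k + insertAt (u ∘ punchIn j) j 0# k
  insert-remove {n}     zero    u zero    = sym (trans (+-identityʳ _) (*-identityʳ _))
  insert-remove {n}     zero    u (suc k) = sym (trans (+-congʳ (zeroʳ _)) (+-identityˡ _))
  insert-remove {suc n} (suc j) u zero    = sym (trans (+-congʳ (zeroʳ _)) (+-identityˡ _))
  insert-remove {suc n} (suc j) u (suc k) = insert-remove j (u ∘ suc) k

  -- Enlarges M by the unit vector e_j as row 0 and by zeros in the rest of column j, so that M is
  -- its minor at (0, j). Pulling an alternating function back along this map lowers the size, which
  -- drives the induction.
  border : Fin (suc n) → Matrix n → Matrix (suc n)
  border {n} j M = I (suc n) j ∷ λ i → insertAt (M i) j 0#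

  border-alternating : ∀ {D : Matrix (suc n) → Carrier} → Alternating D →
                       ∀ j → Alternating (λ M → D (border j M))
  border-alternating {n} {D} alt j = record
    { cong   = λ M≈N → cong λ { zero k → refl ; (suc i) → insert-cong j (M≈N i) }
    ; linear = λ {x} {i} → λ (rowLinear at off off′) → linear (rowLinear {i = suc i}
        (insert-linear x j at)
        (λ { zero _ k → refl ; (suc r) r≢i → insert-cong j (off  r (r≢i ∘ ≡.cong suc)) })
        (λ { zero _ k → refl ; (suc r) r≢i → insert-cong j (off′ r (r≢i ∘ ≡.cong suc)) }))
    ; equal  = λ i≢j eq → equal (i≢j ∘ Fin.suc-injective) (insert-cong j eq)
    }
    where open Alternating alt

  -- The permutation matrix of the cycle that moves j to the front.
  cycle : Fin (suc n) → Matrix (suc n)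
  cycle {n} j = I (suc n) j ∷ λ i → I (suc n) (punchIn j i)

  border-I : (j : Fin (suc n)) → border j (I n) ≈ᵐ cycle j
  border-I j zero    k = refl
  border-I j (suc i) k = insert-I j i k

  cycle-zero : cycle zero ≈ᵐ I (suc n)
  cycle-zero zero    k = refl
  cycle-zero (suc i) k = refl

  -- The cycle is a product of j transpositions: exchanging the first two rows of `cycle (suc j)`
  -- gives `cycle j` bordered by e_0, and induction applies to the pulled back function.
  alternating-cycle : ∀ {D : Matrix (suc n) → Carrier} → Alternating D → ∀ j → D (cycle j) ≈ sign j * D (I (suc n))
  alternating-cycle {n}     {D} alt zero    = trans (Alternating.cong alt cycle-zero) (sym (*-identityˡ _))
  alternating-cycle {suc n} {D} alt (suc j) = begin
    D (cycle (suc j))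
      ≈⟨ swap-rows D cong linear {a = zero} {suc zero} (λ ()) (equal (λ ()))
           {border zero (cycle j)} {cycle (suc j)}
           (λ { zero → refl ; (suc k) → refl }) (λ k → refl)
           (λ { zero r≢0 _ → ⊥-elim (r≢0 ≡.refl)
              ; (suc zero) _ r≢1 → ⊥-elim (r≢1 ≡.refl)
              ; (suc (suc r)) _ _ → λ { zero → refl ; (suc k) → refl } }) ⟩
    - D (border zero (cycle j))
      ≈⟨ -‿cong (alternating-cycle (border-alternating alt zero) j) ⟩
    - (sign j * D (border zero (I (suc n))))
      ≈⟨ -‿cong (*-congˡ (cong λ i k → trans (border-I zero i k) (cycle-zero i k))) ⟩
    - (sign j * D (I (suc (suc n))))
      ≈⟨ solve 2 (λ s d → :- (s :* d) := (:- con (+ 1)) :* s :* d) refl (sign j) _ ⟩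
    - 1# * sign j * D (I (suc (suc n))) ∎
    where open Alternating alt

  -- Rows are replaced one after the other. `ρ` relates an old row to its new value, which makes
  -- this a general form of simultaneous row operations.
  rowwise : ∀ {m} (G : (Fin m → Vector Carrier n) → Carrier) (ρ : Vector Carrier n → Vector Carrier n → Set (c ⊔ ℓ)) →
    (∀ {M N} → (∀ i k → M i k ≈ N i k) → G M ≈ G N) →
    (∀ i {M N} → ρ (M i) (N i) → (∀ r → r ≢ i → ∀ k → M r k ≈ N r k) → G M ≈ G N) →
    ∀ {M N} → (∀ i → ρ (M i) (N i)) → G M ≈ G N
  rowwise {m = zero}  G ρ G-cong step ρs = G-cong λ ()
  rowwise {m = suc m} G ρ G-cong step {M} {N} ρs = begin
    G M                 ≈⟨ step zero {M} {N zero ∷ M ∘ suc} (ρs zero)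
                             (λ { zero r≢0 → ⊥-elim (r≢0 ≡.refl) ; (suc r) _ k → refl }) ⟩
    G (N zero ∷ M ∘ suc) ≈⟨ rowwise (λ X → G (N zero ∷ X)) ρ
                             (λ eq → G-cong λ { zero k → refl ; (suc i) → eq i })
                             (λ i {X} {Y} ρi eq → step (suc i) {N zero ∷ X} {N zero ∷ Y} ρi
                               λ { zero _ k → refl ; (suc r) r≢i → eq r (r≢i ∘ ≡.cong suc) })
                             (ρs ∘ suc) ⟩
    G (N zero ∷ N ∘ suc) ≈⟨ G-cong (λ { zero k → refl ; (suc i) k → refl }) ⟩
    G N                 ∎

  -- Expand row 0 in unit vectors. Once row 0 is e_j, its multiples can be subtracted from the other
  -- rows until column j is clear, and what is left is a bordered minor of M; the induction then
  -- reproduces the Laplace expansion.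
  alternating-unique : ∀ {D : Matrix n → Carrier} → Alternating D → ∀ M → D M ≈ det M * D (I n)
  alternating-unique {zero}  {D} alt M = trans (Alternating.cong alt λ ()) (sym (*-identityˡ _))
  alternating-unique {suc n} {D} alt M = begin
    D M
      ≈⟨ cong (λ { zero k → refl ; (suc i) k → refl }) ⟩
    D (M zero ∷ M ∘ suc)
      ≈⟨ linear-form (λ v → D (v ∷ M ∘ suc))
           (λ u≈v → cong λ { zero → u≈v ; (suc i) k → refl })
           (λ x u v → linear (rowLinear {i = zero} (λ k → refl)
             (λ { zero 0≢0 → ⊥-elim (0≢0 ≡.refl) ; (suc r) _ k → refl })
             (λ { zero 0≢0 → ⊥-elim (0≢0 ≡.refl) ; (suc r) _ k → refl })))
           (M zero) ⟩
    sum (λ j → M zero j * D (I (suc n) j ∷ M ∘ suc))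
      ≈⟨ sum-cong-≋ (λ j → begin
           M zero j * D (I (suc n) j ∷ M ∘ suc)
             ≈⟨ *-congˡ (clear j) ⟩
           M zero j * D (border j (minor M j))
             ≈⟨ *-congˡ (alternating-unique (border-alternating alt j) (minor M j)) ⟩
           M zero j * (det (minor M j) * D (border j (I n)))
             ≈⟨ *-congˡ (*-congˡ (trans (cong (border-I j)) (alternating-cycle alt j))) ⟩
           M zero j * (det (minor M j) * (sign j * D (I (suc n))))
             ≈⟨ solve 4 (λ m d s x → m :* (d :* (s :* x)) := s :* (m :* d) :* x) refl
                  (M zero j) (det (minor M j)) (sign j) (D (I (suc n))) ⟩
           laplace M j * D (I (suc n)) ∎) ⟩
    sum (λ j → laplace M j * D (I (suc n)))
      ≈⟨ *-distribʳ-sum (D (I (suc n))) (laplace M) ⟨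
    det M * D (I (suc n)) ∎
    where
    open Alternating alt
    -- Each row is its entry in column j times e_j plus the cleared row; the multiple of e_j repeats
    -- row 0 and contributes nothing.
    clear : ∀ j → D (I (suc n) j ∷ M ∘ suc) ≈ D (border j (minor M j))
    clear j = rowwise (λ X → D (I (suc n) j ∷ X))
      (λ u v → ∃ λ x → ∀ k → u k ≈ x * I (suc n) j k + v k)
      (λ eq → cong λ { zero k → refl ; (suc i) → eq i })
      (λ i {X} {Y} (x , eq) off → begin
        D (I (suc n) j ∷ X)
          ≈⟨ linear (rowLinear {x = x} {suc i} {I (suc n) j ∷ X} {I (suc n) j ∷ updateAt Y i (const (I (suc n) j))} {I (suc n) j ∷ Y}
               (λ k → trans (eq k) (+-congʳ (*-congˡ (reflexive (≡.cong (λ f → f k) (≡.sym (updateAt-updates i Y)))))))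
               (λ { zero _ k → refl
                  ; (suc r) r≢i k → trans (off r (r≢i ∘ ≡.cong suc) k)
                      (reflexive (≡.cong (λ f → f k) (≡.sym (updateAt-minimal r i Y (r≢i ∘ ≡.cong suc))))) })
               (λ { zero _ k → refl ; (suc r) r≢i → off r (r≢i ∘ ≡.cong suc) })) ⟩
        x * D (I (suc n) j ∷ updateAt Y i (const (I (suc n) j))) + D (I (suc n) j ∷ Y)
          ≈⟨ +-congʳ (*-congˡ (equal {zero} {suc i} (λ ())
               λ k → reflexive (≡.cong (λ f → f k) (≡.sym (updateAt-updates i Y))))) ⟩
        x * 0# + D (I (suc n) j ∷ Y)
          ≈⟨ trans (+-congʳ (zeroʳ x)) (+-identityˡ _) ⟩
        D (I (suc n) j ∷ Y) ∎)
      (λ i → M (suc i) j , insert-remove j (M (suc i)))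

  ⊡-cong : {M M′ N N′ : Matrix n} → M ≈ᵐ M′ → N ≈ᵐ N′ → M ⊡ N ≈ᵐ M′ ⊡ N′
  ⊡-cong M≈M′ N≈N′ i j = sum-cong-≋ λ k → *-cong (M≈M′ i k) (N≈N′ k j)

  -- As a function of M, det (M N) is alternating, with value det N at the identity.
  det-⊡ : (M N : Matrix n) → det (M ⊡ N) ≈ det M * det N
  det-⊡ {n} M N = begin
    det (M ⊡ N)            ≈⟨ alternating-unique alternating M ⟩
    det M * det (I n ⊡ N)  ≈⟨ *-congˡ (det-cong λ i j → sum-I i (λ k → N k j)) ⟩
    det M * det N          ∎
    where
    alternating : Alternating (λ M → det (M ⊡ N))
    alternating = record
      { cong   = λ M≈M′ → det-cong (⊡-cong {N = N} M≈M′ λ i j → refl)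
      ; linear = λ {x} {i} {K} {L} {L′} → λ (rowLinear at off off′) → det-linear (rowLinear {i = i}
          (λ j → trans
            (sum-cong-≋ λ k → trans (*-congʳ (at k))
              (solve 4 (λ x l l′ m → (x :* l :+ l′) :* m := x :* (l :* m) :+ l′ :* m) refl x (L i k) (L′ i k) (N k j)))
            (sum-linear x (λ k → L i k * N k j) (λ k → L′ i k * N k j)))
          (λ r r≢i j → sum-cong-≋ λ k → *-congʳ (off r r≢i k))
          (λ r r≢i j → sum-cong-≋ λ k → *-congʳ (off′ r r≢i k)))
      ; equal  = λ {i} {j} {M} i≢j eq → det-equal (M ⊡ N) i≢j (λ l → sum-cong-≋ λ k → *-congʳ (eq k))
      }

  -- Determinants of triangular, block and rotated matrices.

  det-first-row : (M : Matrix (suc n)) → (∀ j → M zero (suc j) ≈ 0#) → det M ≈ M zero zero * det (minor M zero)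
  det-first-row M M₀≈0 = begin
    laplace M zero + sum (λ j → laplace M (suc j))
      ≈⟨ +-cong (*-identityˡ _) (sum-0 (λ j → laplace M (suc j)) λ j →
           trans (*-congˡ (trans (*-congʳ (M₀≈0 j)) (zeroˡ _))) (zeroʳ (sign (suc j)))) ⟩
    M zero zero * det (minor M zero) + 0#
      ≈⟨ +-identityʳ _ ⟩
    M zero zero * det (minor M zero) ∎

  -- In the expansion along row 0, every minor that skips a later column keeps the column of zeros.
  det-first-column-0 : (M : Matrix (suc n)) → (∀ i → M i zero ≈ 0#) → det M ≈ 0#
  det-first-column-0 {n} M M₀≈0 = sum-0 (laplace M) λ
    { zero    → trans (*-congˡ {sign {suc n} zero} (trans (*-congʳ (M₀≈0 zero)) (zeroˡ _))) (zeroʳ _)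
    ; (suc j) → trans (*-congˡ {sign (suc j)} (trans (*-congˡ (minor-0 j)) (zeroʳ (M zero (suc j))))) (zeroʳ _)
    }
    where
    minor-0 : ∀ j → det (minor M (suc j)) ≈ 0#
    minor-0 zero    = det-first-column-0 (minor M (suc zero)) λ i → M₀≈0 (suc i)
    minor-0 (suc j) = det-first-column-0 (minor M (suc (suc j))) λ i → M₀≈0 (suc i)

  det-first-column : (M : Matrix (suc n)) → (∀ i → M (suc i) zero ≈ 0#) → det M ≈ M zero zero * det (minor M zero)
  det-first-column M M₀≈0 = begin
    laplace M zero + sum (λ j → laplace M (suc j))
      ≈⟨ +-cong (*-identityˡ _) (sum-0 (λ j → laplace M (suc j)) λ j →
           trans (*-congˡ {sign (suc j)} (trans (*-congˡ (minor-0 j)) (zeroʳ (M zero (suc j))))) (zeroʳ _)) ⟩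
    M zero zero * det (minor M zero) + 0#
      ≈⟨ +-identityʳ _ ⟩
    M zero zero * det (minor M zero) ∎
    where
    minor-0 : ∀ j → det (minor M (suc j)) ≈ 0#
    minor-0 zero    = det-first-column-0 (minor M (suc zero)) M₀≈0
    minor-0 (suc j) = det-first-column-0 (minor M (suc (suc j))) M₀≈0

  det-lower-triangular : (M : Matrix n) → (∀ i j → i Fin.< j → M i j ≈ 0#) → det M ≈ product (λ i → M i i)
  det-lower-triangular {zero}  M above = refl
  det-lower-triangular {suc n} M above = trans
    (det-first-row M (λ j → above zero (suc j) (ℕ.s≤s ℕ.z≤n)))
    (*-congˡ (det-lower-triangular (minor M zero) λ i j i<j → above (suc i) (suc j) (ℕ.s≤s i<j)))

  det-upper-triangular : (M : Matrix n) → (∀ i j → j Fin.< i → M i j ≈ 0#) → det M ≈ product (λ i → M i i)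
  det-upper-triangular {zero}  M below = refl
  det-upper-triangular {suc n} M below = trans
    (det-first-column M (λ i → below (suc i) zero (ℕ.s≤s ℕ.z≤n)))
    (*-congˡ (det-upper-triangular (minor M zero) λ i j j<i → below (suc i) (suc j) (ℕ.s≤s j<i)))

  det-lower-unitriangular : (M : Matrix n) → (∀ i j → i Fin.< j → M i j ≈ 0#) → (∀ i → M i i ≈ 1#) → det M ≈ 1#
  det-lower-unitriangular {n} M above diagonal = begin
    det M                  ≈⟨ det-lower-triangular M above ⟩
    product (λ i → M i i)  ≈⟨ product-cong diagonal ⟩
    product {n} (λ _ → 1#) ≈⟨ product-1 n ⟩
    1#                     ∎

  det-I : ∀ n → det (I n) ≈ 1#
  det-I n = det-lower-unitriangular (I n)
    (λ i j i<j → reflexive (I-off-diagonal {i = i} {j} (λ { ≡.refl → Fin.<-irrefl ≡.refl i<j })))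
    (λ i → reflexive (I-diagonal i))

  -- The shape of M Y in the proof of Jacobi's identity. Expansion along row 0 preserves the shape
  -- until m = 0, where the matrix is lower triangular with x on the diagonal.
  det-lower-block : ∀ {m k} (M : Matrix (m ℕ.+ k)) x → (∀ i j → M (i ↑ˡ k) (m ↑ʳ j) ≈ 0#) →
    (∀ i j → M (m ↑ʳ i) (m ↑ʳ j) ≈ x * I k i j) →
    det M ≈ det (λ i j → M (i ↑ˡ k) (j ↑ˡ k)) * x ^ k
  det-lower-block {zero}  {zero}  M x _     scalar = sym (*-identityʳ 1#)
  det-lower-block {zero}  {suc k} M x _     scalar = begin
    det M
      ≈⟨ det-first-row M (λ j → trans (scalar zero (suc j)) (zeroʳ x)) ⟩
    M zero zero * det (minor M zero)
      ≈⟨ *-cong (trans (scalar zero zero) (*-identityʳ x))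
           (trans (det-lower-block {zero} {k} (minor M zero) x (λ ()) (λ i j → scalar (suc i) (suc j))) (*-identityˡ _)) ⟩
    x * x ^ k
      ≈⟨ *-identityˡ _ ⟨
    1# * (x * x ^ k) ∎
  det-lower-block {suc m} {k} M x above scalar = begin
    sum (laplace M)
      ≈⟨ sum-block m k (laplace M) (λ j → trans (*-congˡ (trans (*-congʳ (above zero j)) (zeroˡ _))) (zeroʳ (sign (suc m ↑ʳ j)))) ⟩
    sum (λ j → laplace M (j ↑ˡ k))
      ≈⟨ sum-cong-≋ (λ j → begin
           sign (j ↑ˡ k) * (M zero (j ↑ˡ k) * det (minor M (j ↑ˡ k)))
             ≈⟨ *-cong (reflexive (≡.cong ((- 1#) ^_) (Fin.toℕ-↑ˡ j k))) (*-congˡ (step j)) ⟩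
           sign j * (A zero j * (det (minor A j) * x ^ k))
             ≈⟨ solve 4 (λ s a d y → s :* (a :* (d :* y)) := s :* (a :* d) :* y) refl (sign j) (A zero j) (det (minor A j)) (x ^ k) ⟩
           laplace A j * x ^ k ∎) ⟩
    sum (λ j → laplace A j * x ^ k)
      ≈⟨ *-distribʳ-sum (x ^ k) (laplace A) ⟨
    det A * x ^ k ∎
    where
    A : Matrix (suc m)
    A i j = M (i ↑ˡ k) (j ↑ˡ k)
    sum-block : ∀ m k (f : Vector Carrier (suc m ℕ.+ k)) → (∀ j → f (suc m ↑ʳ j) ≈ 0#) →
                sum f ≈ sum (λ (j : Fin (suc m)) → f (j ↑ˡ k))
    sum-block zero    k f f≈0 = +-congˡ (sum-0 (f ∘ suc) f≈0)
    sum-block (suc m) k f f≈0 = +-congˡ (sum-block m k (f ∘ suc) f≈0)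
    punchIn-↑ˡ : ∀ {m} (j : Fin (suc m)) (b : Fin m) → punchIn (j ↑ˡ k) (b ↑ˡ k) ≡ punchIn j b ↑ˡ k
    punchIn-↑ˡ zero    b       = ≡.refl
    punchIn-↑ˡ (suc j) zero    = ≡.refl
    punchIn-↑ˡ (suc j) (suc b) = ≡.cong suc (punchIn-↑ˡ j b)
    punchIn-↑ʳ : ∀ {m} (j : Fin (suc m)) (b : Fin k) → punchIn (j ↑ˡ k) (m ↑ʳ b) ≡ suc m ↑ʳ b
    punchIn-↑ʳ         zero    b = ≡.refl
    punchIn-↑ʳ {suc m} (suc j) b = ≡.cong suc (punchIn-↑ʳ j b)
    step : ∀ j → det (minor M (j ↑ˡ k)) ≈ det (minor A j) * x ^ k
    step j = begin
      det (minor M (j ↑ˡ k))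
        ≈⟨ det-lower-block {m} {k} (minor M (j ↑ˡ k)) x
             (λ a b → trans (reflexive (≡.cong (M _) (punchIn-↑ʳ j b))) (above (suc a) b))
             (λ a b → trans (reflexive (≡.cong (M _) (punchIn-↑ʳ j b))) (scalar a b)) ⟩
      det (λ a b → M (suc (a ↑ˡ k)) (punchIn (j ↑ˡ k) (b ↑ˡ k))) * x ^ k
        ≈⟨ *-congʳ (det-cong λ a b → reflexive (≡.cong (M _) (punchIn-↑ˡ j b))) ⟩
      det (minor A j) * x ^ k ∎

  -- The shape of Y in the proof of Jacobi's identity: its first m columns are those of the identity
  -- matrix.
  det-upper-block : ∀ m {k} (M : Matrix (m ℕ.+ k)) → (∀ i j → M (m ↑ʳ i) (j ↑ˡ k) ≈ 0#) →
    (∀ i j → M (i ↑ˡ k) (j ↑ˡ k) ≈ I m i j) →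
    det M ≈ det (λ i j → M (m ↑ʳ i) (m ↑ʳ j))
  det-upper-block zero    M _     _        = refl
  det-upper-block (suc m) {k} M below identity = begin
    det M
      ≈⟨ det-first-column M first-column ⟩
    M zero zero * det (minor M zero)
      ≈⟨ *-cong (identity zero zero) (det-upper-block m (minor M zero) (λ i j → below i (suc j)) (λ i j → identity (suc i) (suc j))) ⟩
    1# * det (λ i j → M (suc m ↑ʳ i) (suc m ↑ʳ j))
      ≈⟨ *-identityˡ _ ⟩
    det (λ i j → M (suc m ↑ʳ i) (suc m ↑ʳ j)) ∎
    where
    first-column : ∀ i → M (suc i) zero ≈ 0#
    first-column i with splitAt m i in eq
    ... | inj₁ a = trans (reflexive (≡.cong (λ r → M (suc r) zero) (≡.sym (Fin.splitAt⁻¹-↑ˡ eq)))) (identity (suc a) zero)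
    ... | inj₂ b = trans (reflexive (≡.cong (λ r → M (suc r) zero) (≡.sym (Fin.splitAt⁻¹-↑ʳ eq)))) (below b zero)

  reversal : ∀ n → Matrix n
  reversal n i j = I n (opposite i) j

  -- The rotated matrix is J M J for the reversal J. As J² = I, only the square of det J enters and
  -- its sign never has to be computed.
  det-opposite : (M : Matrix n) → det (λ i j → M (opposite i) (opposite j)) ≈ det M
  det-opposite {n} M = begin
    det (λ i j → M (opposite i) (opposite j))
      ≈⟨ det-cong (λ i j → trans
           (sum-cong-≋ λ k → *-cong (sum-I (opposite i) (λ l → M l k)) (I-opposite k j))
           (sum-I′ (opposite j) (M (opposite i)))) ⟨
    det ((J ⊡ M) ⊡ J)
      ≈⟨ trans (det-⊡ (J ⊡ M) J) (*-congʳ (det-⊡ J M)) ⟩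
    det J * det M * det J
      ≈⟨ solve 2 (λ j m → j :* m :* j := j :* j :* m) refl (det J) (det M) ⟩
    det J * det J * det M
      ≈⟨ *-congʳ (trans (sym (det-⊡ J J)) (trans (det-cong J²) (det-I n))) ⟩
    1# * det M
      ≈⟨ *-identityˡ _ ⟩
    det M ∎
    where
    J = reversal n
    I-opposite : ∀ (i j : Fin n) → I n (opposite i) j ≈ I n i (opposite j)
    I-opposite i j with i Fin.≟ opposite j
    ... | yes ≡.refl = reflexive (≡.trans (≡.cong (λ l → I n l j) (Fin.opposite-involutive j)) (I-diagonal j))
    ... | no i≢      = reflexive (I-off-diagonal {i = opposite i} λ eq →
      i≢ (≡.trans (≡.sym (Fin.opposite-involutive i)) (≡.cong opposite eq)))
    J² : J ⊡ J ≈ᵐ I n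
    J² i j = begin
      sum (λ k → I n (opposite i) k * I n (opposite k) j)  ≈⟨ sum-I (opposite i) (λ k → I n (opposite k) j) ⟩
      I n (opposite (opposite i)) j                        ≡⟨ ≡.cong (λ l → I n l j) (Fin.opposite-involutive i) ⟩
      I n i j                                              ∎

-- Determinants under ring homomorphisms.

module RingHomomorphism {a ℓ₁ b ℓ₂} (A : RawRing a ℓ₁) (B : CommutativeRing b ℓ₂)
  {⟦_⟧ : RawRing.Carrier A → CommutativeRing.Carrier B}
  (isHomomorphism : MorphismStructures.RingMorphisms.IsRingHomomorphism A (CommutativeRing.rawRing B) ⟦_⟧)
  where
  open import Data.Vec.Functional using (Vector)
  open CommutativeRing B hiding (zero)
  open Summation semiring using (sum-cong-≋)
  open SetoidReasoning setoid
  open MorphismStructures.RingMorphisms A rawRing using (module IsRingHomomorphism)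
  open IsRingHomomorphism isHomomorphism using (+-homo; *-homo; -‿homo; 0#-homo; 1#-homo)
  private
    module A where
      open RawRing A public
      open RawSemiringDefinitions rawSemiring public
      open Matrices A public
    module B where
      open Determinant B public
      open RawSemiringDefinitions (RawRing.rawSemiring rawRing) public using (_^_; _×_; sum)

  ^-homo : ∀ x n → ⟦ x A.^ n ⟧ ≈ ⟦ x ⟧ B.^ n
  ^-homo x zero    = 1#-homo
  ^-homo x (suc n) = trans (*-homo x (x A.^ n)) (*-congˡ (^-homo x n))

  ×-homo : ∀ n x → ⟦ n A.× x ⟧ ≈ n B.× ⟦ x ⟧
  ×-homo zero    x = 0#-homo
  ×-homo (suc n) x = trans (+-homo x (n A.× x)) (+-congˡ (×-homo n x))

  sum-homo : ∀ {n} (f : Vector A.Carrier n) → ⟦ A.sum f ⟧ ≈ B.sum (λ i → ⟦ f i ⟧)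
  sum-homo {zero}  f = 0#-homo
  sum-homo {suc n} f = trans (+-homo _ _) (+-congˡ (sum-homo (f ∘ suc)))

  I-homo : ∀ {n} (i j : Fin n) → ⟦ A.I n i j ⟧ ≈ B.I n i j
  I-homo i j with does (i Fin.≟ j)
  ... | true  = 1#-homo
  ... | false = 0#-homo

  -- Used twice: for the map from R to R[ω], and to pass from integer polynomials, given only as a
  -- raw ring, to the commutative ring of polynomials modulo p.
  det-homo : ∀ {n} (M : A.Matrix n) → ⟦ A.det M ⟧ ≈ B.det (λ i j → ⟦ M i j ⟧)
  det-homo {zero}  M = 1#-homo
  det-homo {suc n} M = trans (sum-homo A-laplace) (sum-cong-≋ λ j → begin
    ⟦ (A.- A.1#) A.^ toℕ j A.* (M zero j A.* A.det (A-minor j)) ⟧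
      ≈⟨ trans (*-homo _ _) (*-congˡ (*-homo _ _)) ⟩
    ⟦ (A.- A.1#) A.^ toℕ j ⟧ * (⟦ M zero j ⟧ * ⟦ A.det (A-minor j) ⟧)
      ≈⟨ *-cong (trans (^-homo _ (toℕ j)) (^-cong-base (toℕ j))) (*-congˡ (det-homo (A-minor j))) ⟩
    B.laplace (λ i j → ⟦ M i j ⟧) j ∎)
    where
    A-minor : Fin (suc n) → A.Matrix n
    A-minor j a b = M (suc a) (punchIn j b)
    A-laplace : Fin (suc n) → A.Carrier
    A-laplace j = (A.- A.1#) A.^ toℕ j A.* (M zero j A.* A.det (A-minor j))
    ^-cong-base : ∀ n → ⟦ A.- A.1# ⟧ B.^ n ≈ (- 1#) B.^ n
    ^-cong-base zero    = refl
    ^-cong-base (suc n) = *-cong (trans (-‿homo A.1#) (-‿cong 1#-homo)) (^-cong-base n)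

-- Substitutions of linear forms in x and y, acting on binary forms of degree m.  A form is
-- the sequence of its coefficients: entry j is the coefficient of x^j y^(m-j).
module BinaryForms {r ℓ} (R : CommutativeRing r ℓ) where
  open CommutativeRing R hiding (zero)
  open Exponentiation semiring
  open Summation semiring
  open Determinant R
  open IntegerSolver R
  open SetoidReasoning setoid

  Form : Set r
  Form = ℕ → Carrier

  infix 4 _≈ᶠ_ _≈ˢ_

  _≈ᶠ_ : Form → Form → Set ℓ
  p ≈ᶠ q = ∀ j → p j ≈ q j

  -- x ↦ a x + b y and y ↦ c x + d y.
  record Substitution : Set r where
    constructor ⟨_,_⨾_,_⟩
    field
      a b c d : Carrier
  open Substitution

  record _≈ˢ_ (g h : Substitution) : Set ℓ where
    constructor ⟨_,_⨾_,_⟩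
    field
      a≈ : a g ≈ a h
      b≈ : b g ≈ b h
      c≈ : c g ≈ c h
      d≈ : d g ≈ d h

  infixr 7 _∙_
  -- h is substituted into the linear forms of g. This is the product of the 2 × 2 coefficient
  -- matrices in the same order, so that `Sym` preserves products without reversing them.
  _∙_ : Substitution → Substitution → Substitution
  g ∙ h = ⟨ a g * a h + b g * c h , a g * b h + b g * d h ⨾
            c g * a h + d g * c h , c g * b h + d g * d h ⟩

  1ᶠ : Form
  1ᶠ zero    = 1#
  1ᶠ (suc _) = 0#

  -- The product of u x + v y with p.
  mul : Carrier → Carrier → Form → Form
  mul u v p zero    = v * p zero
  mul u v p (suc j) = u * p j + v * p (suc j)

  -- (a x + b y)^i (c x + d y)^k
  form : Substitution → ℕ → ℕ → Form
  form g zero    zero    = 1ᶠ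
  form g zero    (suc k) = mul (c g) (d g) (form g zero k)
  form g (suc i) k       = mul (a g) (b g) (form g i k)

  -- The m-th symmetric power: row i expands the image of x^i y^(m-i).
  Sym : Substitution → ∀ m → Matrix (suc m)
  Sym g m i j = form g (toℕ i) (m ∸ toℕ i) (toℕ j)

  mul-cong : ∀ {u u′ v v′ p q} → u ≈ u′ → v ≈ v′ → p ≈ᶠ q → mul u v p ≈ᶠ mul u′ v′ q
  mul-cong u≈ v≈ p≈q zero    = *-cong v≈ (p≈q zero)
  mul-cong u≈ v≈ p≈q (suc j) = +-cong (*-cong u≈ (p≈q j)) (*-cong v≈ (p≈q (suc j)))

  mul-congʳ : ∀ {u v p q} → p ≈ᶠ q → mul u v p ≈ᶠ mul u v q
  mul-congʳ = mul-cong refl refl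

  mul-comm : ∀ u v u′ v′ p → mul u v (mul u′ v′ p) ≈ᶠ mul u′ v′ (mul u v p)
  mul-comm u v u′ v′ p zero          = solve 3 (λ v v′ p → v :* (v′ :* p) := v′ :* (v :* p)) refl v v′ (p 0)
  mul-comm u v u′ v′ p (suc zero)    = solve 6 (λ u v u′ v′ p q →
    u :* (v′ :* p) :+ v :* (u′ :* p :+ v′ :* q) := u′ :* (v :* p) :+ v′ :* (u :* p :+ v :* q))
    refl u v u′ v′ (p 0) (p 1)
  mul-comm u v u′ v′ p (suc (suc j)) = solve 7 (λ u v u′ v′ p q r →
    u :* (u′ :* p :+ v′ :* q) :+ v :* (u′ :* q :+ v′ :* r) := u′ :* (u :* p :+ v :* q) :+ v′ :* (u :* q :+ v :* r))
    refl u v u′ v′ (p j) (p (suc j)) (p (suc (suc j)))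

  mul-linear : ∀ u v x p q → mul u v (λ j → x * p j + q j) ≈ᶠ λ j → x * mul u v p j + mul u v q j
  mul-linear u v x p q zero    = solve 4 (λ v x p q → v :* (x :* p :+ q) := x :* (v :* p) :+ v :* q) refl v x (p 0) (q 0)
  mul-linear u v x p q (suc j) = solve 7 (λ u v x p q p′ q′ →
    u :* (x :* p :+ q) :+ v :* (x :* p′ :+ q′) := x :* (u :* p :+ v :* p′) :+ (u :* q :+ v :* q′))
    refl u v x (p j) (q j) (p (suc j)) (q (suc j))

  mul-sum : ∀ u v {n} (x : Fin n → Carrier) (p : Fin n → Form) →
            mul u v (λ j → sum λ i → x i * p i j) ≈ᶠ λ j → sum λ i → x i * mul u v (p i) j
  mul-sum u v {zero}  x p zero    = zeroʳ v
  mul-sum u v {zero}  x p (suc j) = trans (+-cong (zeroʳ u) (zeroʳ v)) (+-identityʳ 0#)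
  mul-sum u v {suc n} x p j = trans
    (mul-linear u v (x zero) (p zero) (λ j → sum λ i → x (suc i) * p (suc i) j) j)
    (+-congˡ (mul-sum u v (x ∘ suc) (p ∘ suc) j))

  form-cong : ∀ {g h} → g ≈ˢ h → ∀ i k → form g i k ≈ᶠ form h i k
  form-cong g≈h zero    zero    j = refl
  form-cong g≈h zero    (suc k) = mul-cong (_≈ˢ_.c≈ g≈h) (_≈ˢ_.d≈ g≈h) (form-cong g≈h zero k)
  form-cong g≈h (suc i) k       = mul-cong (_≈ˢ_.a≈ g≈h) (_≈ˢ_.b≈ g≈h) (form-cong g≈h i k)

  -- `form` takes off factors from x first; as linear factors commute, one from y can be taken off
  -- instead.
  form-suc : ∀ g i k → form g i (suc k) ≈ᶠ mul (c g) (d g) (form g i k)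
  form-suc g zero    k j = refl
  form-suc g (suc i) k j = trans (mul-congʳ (form-suc g i k) j) (mul-comm (a g) (b g) (c g) (d g) (form g i k) j)

  mul-0 : ∀ u v {x y} → x ≈ 0# → y ≈ 0# → u * x + v * y ≈ 0#
  mul-0 u v x≈0 y≈0 = trans (+-cong (trans (*-congˡ x≈0) (zeroʳ u)) (trans (*-congˡ y≈0) (zeroʳ v))) (+-identityʳ 0#)

  form-degree : ∀ g i k j → i ℕ.+ k ℕ.< j → form g i k j ≈ 0#
  form-degree g zero    zero    (suc j) _         = refl
  form-degree g zero    (suc k) (suc j) (s≤s k<j) =
    mul-0 _ _ (form-degree g zero k j k<j) (form-degree g zero k (suc j) (ℕ.m<n⇒m<1+n k<j))
  form-degree g (suc i) k       (suc j) (s≤s i<j) =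
    mul-0 _ _ (form-degree g i k j i<j) (form-degree g i k (suc j) (ℕ.m<n⇒m<1+n i<j))

  -- Substitution of h into a form of degree m, that is, a row vector times `Sym h m`. Entries of p
  -- beyond m do not enter.
  act : Substitution → ∀ m → Form → Form
  act h m p l = sum λ (j : Fin (suc m)) → p (toℕ j) * form h (toℕ j) (m ∸ toℕ j) l

  act-suc : ∀ h m p l → act h (suc m) p l ≈ p 0 * form h 0 (suc m) l + mul (a h) (b h) (act h m (p ∘ suc)) l
  act-suc h m p l = +-congˡ (sym (mul-sum (a h) (b h) (λ (j : Fin (suc m)) → p (suc (toℕ j)))
                                  (λ j → form h (toℕ j) (m ∸ toℕ j)) l))

  -- Here p is x times `p ∘ suc`, and x is sent to a x + b y.
  act-shift : ∀ h m p → p 0 ≈ 0# → act h (suc m) p ≈ᶠ mul (a h) (b h) (act h m (p ∘ suc))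
  act-shift h m p p₀≈0 l = begin
    act h (suc m) p l
      ≈⟨ act-suc h m p l ⟩
    p 0 * form h 0 (suc m) l + mul (a h) (b h) (act h m (p ∘ suc)) l
      ≈⟨ +-congʳ (trans (*-congʳ p₀≈0) (zeroˡ _)) ⟩
    0# + mul (a h) (b h) (act h m (p ∘ suc)) l
      ≈⟨ +-identityˡ _ ⟩
    mul (a h) (b h) (act h m (p ∘ suc)) l ∎

  -- The same sequence read in degree m + 1 instead of m is y times the form, and y is sent to c x +
  -- d y.
  act-raise : ∀ h m p → p (suc m) ≈ 0# → act h (suc m) p ≈ᶠ mul (c h) (d h) (act h m p)
  act-raise h m p p≈0 l = begin
    act h (suc m) p l
      ≈⟨ act-suc h m p l ⟩
    p 0 * mul (c h) (d h) (form h 0 m) l + mul (a h) (b h) (act h m (p ∘ suc)) l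
      ≈⟨ +-congˡ (rest m p≈0) ⟩
    p 0 * mul (c h) (d h) (form h 0 m) l + mul (c h) (d h) (tail m) l
      ≈⟨ mul-linear (c h) (d h) (p 0) (form h 0 m) (tail m) l ⟨
    mul (c h) (d h) (λ l → p 0 * form h 0 m l + tail m l) l
      ≈⟨ mul-congʳ (head m) l ⟩
    mul (c h) (d h) (act h m p) l ∎
    where
    -- `act h m p` without its term at j = 0, which is an empty sum for m = 0.
    tail : ℕ → Form
    tail zero    _ = 0#
    tail (suc m) = mul (a h) (b h) (act h m (p ∘ suc))
    mul-0ᶠ : ∀ u v q → (∀ l → q l ≈ 0#) → ∀ l → mul u v q l ≈ 0#
    mul-0ᶠ u v q q≈0 zero    = trans (*-congˡ (q≈0 zero)) (zeroʳ v)
    mul-0ᶠ u v q q≈0 (suc l) = mul-0 u v (q≈0 l) (q≈0 (suc l))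
    rest : ∀ m → p (suc m) ≈ 0# → mul (a h) (b h) (act h m (p ∘ suc)) l ≈ mul (c h) (d h) (tail m) l
    rest zero    p≈0 = trans
      (mul-0ᶠ _ _ (act h 0 (p ∘ suc)) (λ l → trans (+-identityʳ _) (trans (*-congʳ p≈0) (zeroˡ _))) l)
      (sym (mul-0ᶠ _ _ (tail 0) (λ _ → refl) l))
    rest (suc m) p≈0 = trans
      (mul-congʳ (act-raise h m (p ∘ suc) p≈0) l)
      (mul-comm (a h) (b h) (c h) (d h) (act h m (p ∘ suc)) l)
    head : ∀ m → (λ l → p 0 * form h 0 m l + tail m l) ≈ᶠ act h m p
    head zero    l = refl
    head (suc m) l = sym (act-suc h m p l)

  -- Splitting (u x + v y) p into u times a shift of p and v times p raised in degree shows that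
  -- substitution respects a linear factor.
  act-mul : ∀ h m u v p → p (suc m) ≈ 0# →
            act h (suc m) (mul u v p) ≈ᶠ mul (u * a h + v * c h) (u * b h + v * d h) (act h m p)
  act-mul h m u v p p≈0 l = begin
    act h (suc m) (mul u v p) l
      ≈⟨ sum-cong-≋ term ⟩
    sum (λ j → u * (shift (toℕ j) * F j) + v * (p (toℕ j) * F j))
      ≈⟨ sum-linear u (λ j → shift (toℕ j) * F j) (λ j → v * (p (toℕ j) * F j)) ⟩
    u * act h (suc m) shift l + sum (λ j → v * (p (toℕ j) * F j))
      ≈⟨ +-congˡ (*-distribˡ-sum v (λ j → p (toℕ j) * F j)) ⟨
    u * act h (suc m) shift l + v * act h (suc m) p l
      ≈⟨ +-cong (*-congˡ (act-shift h m shift refl l)) (*-congˡ (act-raise h m p p≈0 l)) ⟩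
    u * mul (a h) (b h) (act h m p) l + v * mul (c h) (d h) (act h m p) l
      ≈⟨ combine (act h m p) l ⟩
    mul (u * a h + v * c h) (u * b h + v * d h) (act h m p) l ∎
    where
    F : Fin (suc (suc m)) → Carrier
    F j = form h (toℕ j) (suc m ∸ toℕ j) l
    shift : Form
    shift zero    = 0#
    shift (suc j) = p j
    split : ∀ j → mul u v p j ≈ u * shift j + v * p j
    split zero    = sym (trans (+-congʳ (zeroʳ u)) (+-identityˡ _))
    split (suc j) = refl
    term : ∀ j → mul u v p (toℕ j) * F j ≈ u * (shift (toℕ j) * F j) + v * (p (toℕ j) * F j)
    term j = trans (*-congʳ (split (toℕ j)))
      (solve 5 (λ u x v y f → (u :* x :+ v :* y) :* f := u :* (x :* f) :+ v :* (y :* f)) refl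
        u (shift (toℕ j)) v (p (toℕ j)) (F j))
    combine : ∀ q l → u * mul (a h) (b h) q l + v * mul (c h) (d h) q l ≈
                      mul (u * a h + v * c h) (u * b h + v * d h) q l
    combine q zero    = solve 5 (λ u b v d q → u :* (b :* q) :+ v :* (d :* q) := (u :* b :+ v :* d) :* q)
                          refl u (b h) v (d h) (q 0)
    combine q (suc l) = solve 8 (λ u a b v c d q r →
      u :* (a :* q :+ b :* r) :+ v :* (c :* q :+ d :* r) := (u :* a :+ v :* c) :* q :+ (u :* b :+ v :* d) :* r)
      refl u (a h) (b h) v (c h) (d h) (q l) (q (suc l))

  act-form : ∀ g h i k → act h (i ℕ.+ k) (form g i k) ≈ᶠ form (g ∙ h) i k
  act-form g h zero    zero    l = trans (+-identityʳ _) (*-identityˡ _)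
  act-form g h zero    (suc k) l = trans
    (act-mul h k (c g) (d g) (form g 0 k) (form-degree g 0 k (suc k) ℕ.≤-refl) l)
    (mul-congʳ (act-form g h zero k) l)
  act-form g h (suc i) k       l = trans
    (act-mul h (i ℕ.+ k) (a g) (b g) (form g i k) (form-degree g i k _ ℕ.≤-refl) l)
    (mul-congʳ (act-form g h i k) l)

  toℕ+∸ : ∀ {m} (i : Fin (suc m)) → toℕ i ℕ.+ (m ∸ toℕ i) ≡ m
  toℕ+∸ i = ℕ.m+[n∸m]≡n (Fin.toℕ≤pred[n] i)

  -- Row i of the product is h substituted into (image of x)^i (image of y)^(m-i), where the images
  -- are those under g; `act-form` carries this out factor by factor.
  Sym-∙ : ∀ g h m → Sym g m ⊡ Sym h m ≈ᵐ Sym (g ∙ h) m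
  Sym-∙ g h m i l = trans
    (reflexive (≡.cong (λ n → act h n (form g (toℕ i) (m ∸ toℕ i)) (toℕ l)) (≡.sym (toℕ+∸ i))) )
    (act-form g h (toℕ i) (m ∸ toℕ i) (toℕ l))

  Sym-cong : ∀ {g h} → g ≈ˢ h → ∀ m → Sym g m ≈ᵐ Sym h m
  Sym-cong g≈h m i j = form-cong g≈h (toℕ i) (m ∸ toℕ i) (toℕ j)

  identity : Substitution
  identity = ⟨ 1# , 0# ⨾ 0# , 1# ⟩

  form-identity₀ : ∀ k → form identity 0 k ≈ᶠ 1ᶠ
  form-identity₀ zero    j       = refl
  form-identity₀ (suc k) zero    = trans (*-identityˡ _) (form-identity₀ k zero)
  form-identity₀ (suc k) (suc j) = trans (+-cong (zeroˡ _) (trans (*-identityˡ _) (form-identity₀ k (suc j)))) (+-identityʳ 0#)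

  form-identity : ∀ {n} (i j : Fin n) k → form identity (toℕ i) k (toℕ j) ≈ I n i j
  form-identity zero    zero    k = form-identity₀ k 0
  form-identity zero    (suc j) k = form-identity₀ k (suc (toℕ j))
  form-identity (suc i) zero    k = zeroˡ _
  form-identity (suc i) (suc j) k = trans (+-cong (*-identityˡ _) (zeroˡ _)) (trans (+-identityʳ _) (form-identity i j k))

  Sym-identity : ∀ m → Sym identity m ≈ᵐ I (suc m)
  Sym-identity m i j = form-identity i j (m ∸ toℕ i)

  -- The conjugate of g by the exchange of x and y.
  flip : Substitution → Substitution
  flip g = ⟨ d g , c g ⨾ b g , a g ⟩

  mul-flip : ∀ u v p q n → p (suc n) ≈ 0# → q (suc n) ≈ 0# → (∀ j j′ → j ℕ.+ j′ ≡ n → p j ≈ q j′) →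
             ∀ j j′ → j ℕ.+ j′ ≡ suc n → mul u v p j ≈ mul v u q j′
  mul-flip u v p q n p≈0 q≈0 p≈q zero (suc j′) ≡.refl = begin
    v * p 0                ≈⟨ *-congˡ (p≈q 0 n ≡.refl) ⟩
    v * q n                ≈⟨ +-identityʳ _ ⟨
    v * q n + 0#           ≈⟨ +-congˡ (trans (*-congˡ q≈0) (zeroʳ u)) ⟨
    v * q n + u * q (suc n) ∎
  mul-flip u v p q n p≈0 q≈0 p≈q (suc j) zero eq with ≡.trans (≡.sym (ℕ.+-identityʳ j)) (ℕ.suc-injective eq)
  ... | ≡.refl = begin
    u * p j + v * p (suc j)  ≈⟨ +-cong (*-congˡ (p≈q j 0 (ℕ.+-identityʳ j))) (trans (*-congˡ p≈0) (zeroʳ v)) ⟩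
    u * q 0 + 0#             ≈⟨ +-identityʳ _ ⟩
    u * q 0                  ∎
  mul-flip u v p q n p≈0 q≈0 p≈q (suc j) (suc j′) eq = begin
    u * p j + v * p (suc j)    ≈⟨ +-cong (*-congˡ (p≈q j (suc j′) (ℕ.suc-injective eq)))
                                         (*-congˡ (p≈q (suc j) j′ (≡.trans (≡.sym (ℕ.+-suc j j′)) (ℕ.suc-injective eq)))) ⟩
    u * q (suc j′) + v * q j′  ≈⟨ +-comm _ _ ⟩
    v * q j′ + u * q (suc j′)  ∎

  -- Exchanging x and y everywhere turns x^i y^k into x^k y^i and reads coefficients backwards, so
  -- `flip` rotates the matrix `Sym` by 180°.
  form-flip : ∀ g i k j j′ → j ℕ.+ j′ ≡ i ℕ.+ k → form g i k j ≈ form (flip g) k i j′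
  form-flip g zero    zero    zero    zero eq = refl
  form-flip g zero    (suc k) j j′ eq = mul-flip (c g) (d g) (form g 0 k) (form (flip g) k 0) k
    (form-degree g 0 k (suc k) ℕ.≤-refl)
    (form-degree (flip g) k 0 (suc k) (s≤s (ℕ.≤-reflexive (ℕ.+-identityʳ k))))
    (form-flip g zero k) j j′ eq
  form-flip g (suc i) k       j j′ eq = trans
    (mul-flip (a g) (b g) (form g i k) (form (flip g) k i) (i ℕ.+ k)
      (form-degree g i k _ ℕ.≤-refl)
      (form-degree (flip g) k i _ (s≤s (ℕ.≤-reflexive (ℕ.+-comm k i))))
      (form-flip g i k) j j′ eq)
    (sym (form-suc (flip g) k i j′))

  -- With a = 0 the image of x is a multiple of y, so that only the k factors from y contribute
  -- powers of x.
  form-high-0 : ∀ g → a g ≈ 0# → ∀ i k j → k ℕ.< j → form g i k j ≈ 0#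
  form-high-0 g a≈0 zero    k j       k<j = form-degree g 0 k j k<j
  form-high-0 g a≈0 (suc i) k (suc j) k<j = trans
    (+-cong (trans (*-congʳ a≈0) (zeroˡ _)) (trans (*-congˡ (form-high-0 g a≈0 i k (suc j) k<j)) (zeroʳ _)))
    (+-identityʳ 0#)

  -- With b = 0 the image of x is a multiple of x, so that x^i divides the form.
  form-upper : ∀ g → b g ≈ 0# → ∀ i k j → j ℕ.< i → form g i k j ≈ 0#
  form-upper g b≈0 (suc i) k zero    _         = trans (*-congʳ b≈0) (zeroˡ _)
  form-upper g b≈0 (suc i) k (suc j) (s≤s j<i) = trans
    (+-cong (trans (*-congˡ (form-upper g b≈0 i k j j<i)) (zeroʳ _)) (trans (*-congʳ b≈0) (zeroˡ _)))
    (+-identityʳ 0#)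

  form-constant : ∀ g k → form g 0 k 0 ≈ d g ^ k
  form-constant g zero    = refl
  form-constant g (suc k) = *-congˡ (form-constant g k)

  form-upper-diagonal : ∀ g → b g ≈ 0# → ∀ i k → form g i k i ≈ a g ^ i * d g ^ k
  form-upper-diagonal g b≈0 zero    k = trans (form-constant g k) (sym (*-identityˡ _))
  form-upper-diagonal g b≈0 (suc i) k = begin
    a g * form g i k i + b g * form g i k (suc i)
      ≈⟨ +-cong (*-congˡ (form-upper-diagonal g b≈0 i k)) (trans (*-congʳ b≈0) (zeroˡ _)) ⟩
    a g * (a g ^ i * d g ^ k) + 0#
      ≈⟨ trans (+-identityʳ _) (sym (*-assoc _ _ _)) ⟩
    a g ^ suc i * d g ^ k ∎

  -- With c = 0 the image of y is a multiple of y, so that only i factors contribute powers of x.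
  form-lower : ∀ g → c g ≈ 0# → ∀ i k j → i ℕ.< j → form g i k j ≈ 0#
  form-lower g c≈0 zero    zero    (suc j) _         = refl
  form-lower g c≈0 zero    (suc k) (suc j) 0<j       = trans
    (+-cong (trans (*-congʳ c≈0) (zeroˡ _)) (trans (*-congˡ (form-lower g c≈0 zero k (suc j) 0<j)) (zeroʳ _)))
    (+-identityʳ 0#)
  form-lower g c≈0 (suc i) k       (suc j) (s≤s i<j) =
    mul-0 _ _ (form-lower g c≈0 i k j i<j) (form-lower g c≈0 i k (suc j) (ℕ.m<n⇒m<1+n i<j))

  form-lower-diagonal : ∀ g → c g ≈ 0# → ∀ i k → form g i k i ≈ a g ^ i * d g ^ k
  form-lower-diagonal g c≈0 zero    k = trans (form-constant g k) (sym (*-identityˡ _))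
  form-lower-diagonal g c≈0 (suc i) k = begin
    a g * form g i k i + b g * form g i k (suc i)
      ≈⟨ +-cong (*-congˡ (form-lower-diagonal g c≈0 i k)) (trans (*-congˡ (form-lower g c≈0 i k (suc i) ℕ.≤-refl)) (zeroʳ _)) ⟩
    a g * (a g ^ i * d g ^ k) + 0#
      ≈⟨ trans (+-identityʳ _) (sym (*-assoc _ _ _)) ⟩
    a g ^ suc i * d g ^ k ∎

-- Binomial coefficients of prime powers.

C-absorption : ∀ n k → suc k ℕ.* (suc n C suc k) ≡ suc n ℕ.* (n C k)
C-absorption n zero = begin
  1 ℕ.* (suc n C 1)      ≡⟨ ℕ.*-identityˡ _ ⟩
  suc n C 1              ≡⟨ nC1≡n (suc n) ⟩
  suc n                  ≡⟨ ℕ.*-identityʳ (suc n) ⟨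
  suc n ℕ.* (n C 0)      ∎
  where
  open ≡-Reasoning
C-absorption zero    (suc k) = ℕ.*-zeroʳ k
C-absorption (suc n) (suc k) = begin
  suc (suc k) ℕ.* (suc (suc n) C suc (suc k))
    ≡⟨ ≡.cong (suc (suc k) ℕ.*_) (nCk+nC[k+1]≡[n+1]C[k+1] (suc n) (suc k)) ⟨
  suc (suc k) ℕ.* (x ℕ.+ suc n C suc (suc k))
    ≡⟨ ℕ.*-distribˡ-+ (suc (suc k)) x _ ⟩
  x ℕ.+ suc k ℕ.* x ℕ.+ suc (suc k) ℕ.* (suc n C suc (suc k))
    ≡⟨ ≡.cong₂ (λ u v → x ℕ.+ u ℕ.+ v) (C-absorption n k) (C-absorption n (suc k)) ⟩
  x ℕ.+ suc n ℕ.* (n C k) ℕ.+ suc n ℕ.* (n C suc k)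
    ≡⟨ ℕ.+-assoc x _ _ ⟩
  x ℕ.+ (suc n ℕ.* (n C k) ℕ.+ suc n ℕ.* (n C suc k))
    ≡⟨ ≡.cong (x ℕ.+_) (ℕ.*-distribˡ-+ (suc n) (n C k) _) ⟨
  x ℕ.+ suc n ℕ.* (n C k ℕ.+ n C suc k)
    ≡⟨ ≡.cong (λ u → x ℕ.+ suc n ℕ.* u) (nCk+nC[k+1]≡[n+1]C[k+1] n k) ⟩
  suc (suc n) ℕ.* x ∎
  where
  open ≡-Reasoning
  x = suc n C suc k

prime-∤⇒coprime : ∀ {p n} → Prime p → ¬ (p ∣ n) → Coprime p n
prime-∤⇒coprime {p} {n} p-prime p∤n {d} (d∣p , d∣n) with prime⇒irreducible p-prime d∣p
... | inj₁ d≡1    = d≡1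
... | inj₂ ≡.refl = ⊥-elim (p∤n d∣n)

-- A common divisor of p^l and n is coprime to p, as p does not divide n. Going down through the
-- powers of p, it is 1, and Euclid's lemma removes n.
prime-power-divisor : ∀ {p} → Prime p → ∀ l {m n} → p ℕ.^ l ∣ m ℕ.* n → ¬ (p ∣ n) → p ℕ.^ l ∣ m
prime-power-divisor {p} p-prime l {m} {n} pˡ∣mn p∤n = coprime-divisor (coprime-^ l)
  (≡.subst (p ℕ.^ l ∣_) (ℕ.*-comm m n) pˡ∣mn)
  where
  coprime-^ : ∀ l → Coprime (p ℕ.^ l) n
  coprime-^ zero    (d∣1 , _) = ∣1⇒≡1 d∣1
  coprime-^ (suc l) {d} (d∣pˡ⁺¹ , d∣n) = coprime-^ l (coprime-divisor d⊥p d∣pˡ⁺¹ , d∣n)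
    where
    d⊥p : Coprime d p
    d⊥p (e∣d , e∣p) = prime-∤⇒coprime p-prime p∤n (e∣p , ∣-trans e∣d d∣n)

-- By absorption q = p^l divides (k + 1) C(q, k + 1). If p did not divide the binomial coefficient,
-- q would divide k + 1, which is smaller than q.
prime-∣-C : ∀ {p} → Prime p → ∀ l {k} → suc k ℕ.< p ℕ.^ l → p ∣ p ℕ.^ l C suc k
prime-∣-C {p} p-prime l {k} k<q with p ∣? p ℕ.^ l C suc k
... | yes p∣C = p∣C
... | no  p∤C with p ℕ.^ l in q≡
...   | suc n = ⊥-elim (ℕ.<⇒≱ k<q (≡.subst (ℕ._≤ suc k) q≡
        (∣⇒≤ (prime-power-divisor p-prime l
          (≡.subst₂ _∣_ (≡.sym q≡) (≡.sym (C-absorption n k)) (m∣m*n (n C k))) p∤C))))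

-- Pascal matrices as symmetric powers in characteristic p.

module PascalMatrices {r ℓ} (R : CommutativeRing r ℓ) where
  open CommutativeRing R hiding (zero)
  open Exponentiation semiring
  open Multiplication semiring
  open Determinant R
  open BinaryForms R
  open IntegerSolver R using (solve; _:+_; _:*_; _:-_; :-_; _:=_; con)
  open SetoidReasoning setoid

  -- x ↦ - y and y ↦ x - y, of order 3; the row (x - y)^m of Sym ρ m is 1 + x + ⋯ + x^m in
  -- characteristic p when m + 1 is a power of p.
  ρ ρ² : Substitution
  ρ  = ⟨ 0# , - 1# ⨾ 1# , - 1# ⟩
  ρ² = ⟨ - 1# , 1# ⨾ - 1# , 0# ⟩

  ρ∙ρ : ρ ∙ ρ ≈ˢ ρ²
  ρ∙ρ = ⟨ solve 0 (con (+ 0) :* con (+ 0) :+ (:- con (+ 1)) :* con (+ 1) := :- con (+ 1)) refl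
        , solve 0 (con (+ 0) :* (:- con (+ 1)) :+ (:- con (+ 1)) :* (:- con (+ 1)) := con (+ 1)) refl
        ⨾ solve 0 (con (+ 1) :* con (+ 0) :+ (:- con (+ 1)) :* con (+ 1) := :- con (+ 1)) refl
        , solve 0 (con (+ 1) :* (:- con (+ 1)) :+ (:- con (+ 1)) :* (:- con (+ 1)) := con (+ 0)) refl ⟩

  ρ∙ρ² : ρ ∙ ρ² ≈ˢ identity
  ρ∙ρ² = ⟨ solve 0 (con (+ 0) :* (:- con (+ 1)) :+ (:- con (+ 1)) :* (:- con (+ 1)) := con (+ 1)) refl
         , solve 0 (con (+ 0) :* con (+ 1) :+ (:- con (+ 1)) :* con (+ 0) := con (+ 0)) refl
         ⨾ solve 0 (con (+ 1) :* (:- con (+ 1)) :+ (:- con (+ 1)) :* (:- con (+ 1)) := con (+ 0)) refl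
         , solve 0 (con (+ 1) :* con (+ 1) :+ (:- con (+ 1)) :* con (+ 0) := con (+ 1)) refl ⟩

  -- The binomial theorem for (x - y)^n. The sign (-1)^(n-j) is written (-1)^n (-1)^j, which avoids
  -- a truncated subtraction.
  form-C : ∀ n j → form ρ 0 n j ≈ (- 1#) ^ n * (- 1#) ^ j * (n C j) × 1#
  form-C zero    zero    = solve 0 (con (+ 1) := con (+ 1) :* con (+ 1) :* (con (+ 1) :+ con (+ 0))) refl
  form-C zero    (suc j) = sym (zeroʳ _)
  form-C (suc n) zero    = trans (*-congˡ (form-C n zero)) (solve 2 (λ s x →
    (:- con (+ 1)) :* (s :* con (+ 1) :* x) := (:- con (+ 1)) :* s :* con (+ 1) :* x) refl ((- 1#) ^ n) ((n C 0) × 1#))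
  form-C (suc n) (suc j) = begin
    1# * form ρ 0 n j + - 1# * form ρ 0 n (suc j)
      ≈⟨ +-cong (*-congˡ (form-C n j)) (*-congˡ (form-C n (suc j))) ⟩
    1# * (s * s′ * (n C j) × 1#) + - 1# * (s * (- 1# * s′) * (n C suc j) × 1#)
      ≈⟨ solve 4 (λ s s′ x y → con (+ 1) :* (s :* s′ :* x) :+ (:- con (+ 1)) :* (s :* ((:- con (+ 1)) :* s′) :* y)
           := (:- con (+ 1)) :* s :* ((:- con (+ 1)) :* s′) :* (x :+ y)) refl s s′ ((n C j) × 1#) ((n C suc j) × 1#) ⟩
    - 1# * s * (- 1# * s′) * ((n C j) × 1# + (n C suc j) × 1#)
      ≈⟨ *-congˡ (×-homo-+ 1# (n C j) (n C suc j)) ⟨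
    - 1# * s * (- 1# * s′) * (n C j ℕ.+ n C suc j) × 1#
      ≡⟨ ≡.cong (λ k → - 1# * s * (- 1# * s′) * k × 1#) (nCk+nC[k+1]≡[n+1]C[k+1] n j) ⟩
    - 1# * s * (- 1# * s′) * (suc n C suc j) × 1# ∎
    where
    s  = (- 1#) ^ n
    s′ = (- 1#) ^ j

  sign² : ∀ n → (- 1#) ^ n * (- 1#) ^ n ≈ 1#
  sign² zero    = *-identityˡ 1#
  sign² (suc n) = trans (solve 1 (λ s → (:- con (+ 1)) :* s :* ((:- con (+ 1)) :* s) := s :* s) refl ((- 1#) ^ n)) (sign² n)

  form-leading : ∀ n → form ρ 0 n n ≈ 1#
  form-leading n = begin
    form ρ 0 n n                               ≈⟨ form-C n n ⟩
    (- 1#) ^ n * (- 1#) ^ n * (n C n) × 1#     ≈⟨ *-cong (sign² n) (×-congˡ (nCn≡1 n)) ⟩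
    1# * (1# + 0#)                             ≈⟨ trans (*-identityˡ _) (+-identityʳ 1#) ⟩
    1#                                         ∎

  form-ρ-suc : ∀ i k j → form ρ (suc i) k j ≈ - form ρ i k j
  form-ρ-suc i k zero    = solve 1 (λ x → (:- con (+ 1)) :* x := :- x) refl (form ρ i k 0)
  form-ρ-suc i k (suc j) = solve 2 (λ x y → con (+ 0) :* x :+ (:- con (+ 1)) :* y := :- y) refl
    (form ρ i k j) (form ρ i k (suc j))

  pascal : ∀ n → Matrix n
  pascal n i j = ((toℕ i ℕ.+ toℕ j) C toℕ i) × 1#

  module PrimePower {p} (p-prime : Prime p) (p×1≈0 : p × 1# ≈ 0#) l {m} (1+m≡q : suc m ≡ p ℕ.^ l) where

    ∣⇒×1≈0 : ∀ {n} → p ∣ n → n × 1# ≈ 0#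
    ∣⇒×1≈0 (divides d ≡.refl) = begin
      (d ℕ.* p) × 1#         ≈⟨ ×1-homo-* d p ⟩
      (d × 1#) * (p × 1#)    ≈⟨ trans (*-congˡ p×1≈0) (zeroʳ _) ⟩
      0#                     ∎

    -- Coefficients j and j + 1 of (x - y)^m differ by the coefficient of x^(j+1) in (x - y)^q,
    -- which p divides. All coefficients thus equal the leading one; d counts the distance to it.
    form-top-row : ∀ d j → d ℕ.+ j ≡ m → form ρ 0 m j ≈ 1#
    form-top-row zero    j ≡.refl = form-leading j
    form-top-row (suc d) j eq = begin
      form ρ 0 m j
        ≈⟨ solve 2 (λ x y → x := con (+ 1) :* x :+ (:- con (+ 1)) :* y :+ y) refl (form ρ 0 m j) (form ρ 0 m (suc j)) ⟩
      form ρ 0 (suc m) (suc j) + form ρ 0 m (suc j)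
        ≈⟨ +-cong vanish (form-top-row d (suc j) (≡.trans (ℕ.+-suc d j) eq)) ⟩
      0# + 1#
        ≈⟨ +-identityˡ 1# ⟩
      1# ∎
      where
      j<m : j ℕ.< m
      j<m = ≡.subst (j ℕ.<_) eq (s≤s (ℕ.m≤n+m j d))
      vanish : form ρ 0 (suc m) (suc j) ≈ 0#
      vanish = begin
        form ρ 0 (suc m) (suc j)
          ≈⟨ form-C (suc m) (suc j) ⟩
        (- 1#) ^ suc m * (- 1#) ^ suc j * (suc m C suc j) × 1#
          ≈⟨ *-congˡ (∣⇒×1≈0 (≡.subst (λ q → p ∣ q C suc j) (≡.sym 1+m≡q)
               (prime-∣-C p-prime l (≡.subst (suc j ℕ.<_) 1+m≡q (s≤s j<m))))) ⟩
        (- 1#) ^ suc m * (- 1#) ^ suc j * 0#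
          ≈⟨ zeroʳ _ ⟩
        0# ∎

    -- Let F = (-y)^i (x - y)^k with i + k + 1 = m. Then (x - y) F is row i and -y F is row i + 1;
    -- comparing coefficients of x^(j+1), entry (i + 1, j + 1) is the sum of entries (i, j + 1) and
    -- (i + 1, j). This is Pascal's rule, started by a row and a column of ones.
    form-pascal : ∀ i k j → i ℕ.+ k ≡ m → j ℕ.≤ m → form ρ i k j ≈ ((i ℕ.+ j) C i) × 1#
    form-pascal zero    k j       ≡.refl j≤m = trans (form-top-row (m ∸ j) j (ℕ.m∸n+n≡m j≤m)) (sym (+-identityʳ 1#))
    form-pascal (suc i) k zero    eq     j≤m = begin
      form ρ (suc i) k 0
        ≈⟨ form-suc ρ i k 0 ⟨
      form ρ i (suc k) 0
        ≈⟨ form-pascal i (suc k) 0 (≡.trans (ℕ.+-suc i k) eq) j≤m ⟩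
      ((i ℕ.+ 0) C i) × 1#
        ≡⟨ ≡.cong (_× 1#) (≡.trans (C₀ i) (≡.sym (C₀ (suc i)))) ⟩
      ((suc i ℕ.+ 0) C suc i) × 1# ∎
      where
      C₀ : ∀ i → (i ℕ.+ 0) C i ≡ 1
      C₀ i = ≡.trans (≡.cong (_C i) (ℕ.+-identityʳ i)) (nCn≡1 i)
    form-pascal (suc i) k (suc j) eq     j<m = begin
      form ρ (suc i) k (suc j)
        ≈⟨ form-ρ-suc i k (suc j) ⟩
      - form ρ i k (suc j)
        ≈⟨ solve 2 (λ x y → :- y := con (+ 1) :* x :+ (:- con (+ 1)) :* y :- x) refl (form ρ i k j) (form ρ i k (suc j)) ⟩
      1# * form ρ i k j + - 1# * form ρ i k (suc j) - form ρ i k j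
        ≈⟨ +-cong (form-suc ρ i k (suc j)) (form-ρ-suc i k j) ⟨
      form ρ i (suc k) (suc j) + form ρ (suc i) k j
        ≈⟨ +-cong (form-pascal i (suc k) (suc j) (≡.trans (ℕ.+-suc i k) eq) j<m)
                  (form-pascal (suc i) k j eq (ℕ.<⇒≤ j<m)) ⟩
      ((i ℕ.+ suc j) C i) × 1# + ((suc i ℕ.+ j) C suc i) × 1#
        ≈⟨ ×-homo-+ 1# ((i ℕ.+ suc j) C i) _ ⟨
      ((i ℕ.+ suc j) C i ℕ.+ (suc i ℕ.+ j) C suc i) × 1#
        ≡⟨ ≡.cong (λ n → ((i ℕ.+ suc j) C i ℕ.+ n C suc i) × 1#) (≡.sym (ℕ.+-suc i j)) ⟩
      ((i ℕ.+ suc j) C i ℕ.+ (i ℕ.+ suc j) C suc i) × 1#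
        ≡⟨ ≡.cong (_× 1#) (nCk+nC[k+1]≡[n+1]C[k+1] (i ℕ.+ suc j) i) ⟩
      ((suc i ℕ.+ suc j) C suc i) × 1# ∎

    Sym-ρ : Sym ρ m ≈ᵐ pascal (suc m)
    Sym-ρ i j = form-pascal (toℕ i) (m ∸ toℕ i) (toℕ j) (toℕ+∸ i) (Fin.toℕ≤pred[n] j)

    -- The cube of pascal (suc m) is I, and its square, hence its inverse, is its rotation by 180°.
    rotated : ∀ n → Matrix n
    rotated n i j = ((m ∸ toℕ i ℕ.+ (m ∸ toℕ j)) C (m ∸ toℕ i)) × 1#

    -- `flip ρ²` is `ρ` by computation, so the rotated `Sym ρ² m` is `Sym ρ m`.
    Sym-ρ² : Sym ρ² m ≈ᵐ rotated (suc m)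
    Sym-ρ² i j = begin
      form ρ² (toℕ i) (m ∸ toℕ i) (toℕ j)
        ≈⟨ form-flip ρ² (toℕ i) (m ∸ toℕ i) (toℕ j) (m ∸ toℕ j) (≡.trans (toℕ+∸ j) (≡.sym (toℕ+∸ i))) ⟩
      form ρ (m ∸ toℕ i) (toℕ i) (m ∸ toℕ j)
        ≈⟨ form-pascal (m ∸ toℕ i) (toℕ i) (m ∸ toℕ j) (ℕ.m∸n+n≡m (Fin.toℕ≤pred[n] i)) (ℕ.m∸n≤m m (toℕ j)) ⟩
      rotated (suc m) i j ∎

    pascal² : pascal (suc m) ⊡ pascal (suc m) ≈ᵐ rotated (suc m)
    pascal² i j = begin
      (pascal (suc m) ⊡ pascal (suc m)) i j  ≈⟨ ⊡-cong Sym-ρ Sym-ρ i j ⟨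
      (Sym ρ m ⊡ Sym ρ m) i j                ≈⟨ Sym-∙ ρ ρ m i j ⟩
      Sym (ρ ∙ ρ) m i j                      ≈⟨ Sym-cong ρ∙ρ m i j ⟩
      Sym ρ² m i j                           ≈⟨ Sym-ρ² i j ⟩
      rotated (suc m) i j                    ∎

    pascal³ : pascal (suc m) ⊡ rotated (suc m) ≈ᵐ I (suc m)
    pascal³ i j = begin
      (pascal (suc m) ⊡ rotated (suc m)) i j ≈⟨ ⊡-cong Sym-ρ Sym-ρ² i j ⟨
      (Sym ρ m ⊡ Sym ρ² m) i j               ≈⟨ Sym-∙ ρ ρ² m i j ⟩
      Sym (ρ ∙ ρ²) m i j                     ≈⟨ Sym-cong ρ∙ρ² m i j ⟩
      Sym identity m i j                     ≈⟨ Sym-identity m i j ⟩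
      I (suc m) i j                          ∎

    -- Row i is (-y)^i (x - y)^(m-i), whose degree in x is m - i < j.
    pascal-0 : ∀ i j → i ℕ.≤ m → j ℕ.≤ m → m ℕ.< i ℕ.+ j → ((i ℕ.+ j) C i) × 1# ≈ 0#
    pascal-0 i j i≤m j≤m m<i+j = trans
      (sym (form-pascal i (m ∸ i) j (ℕ.m+[n∸m]≡n i≤m) j≤m))
      (form-high-0 ρ refl i (m ∸ i) j (ℕ.m<n+o⇒m∸n<o m i {{ℕ.>-nonZero (ℕ.+-cancelˡ-< i 0 j i+0<i+j)}} m<i+j))
      where
      i+0<i+j : i ℕ.+ 0 ℕ.< i ℕ.+ j
      i+0<i+j = ≡.subst (ℕ._< i ℕ.+ j) (≡.sym (ℕ.+-identityʳ i)) (ℕ.≤-<-trans i≤m m<i+j)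

-- Jacobi's complementary minors, applied to t - P.

module ComplementaryMinors {r ℓ} (R : CommutativeRing r ℓ) where
  open CommutativeRing R hiding (zero)
  open Exponentiation semiring
  open Multiplication semiring
  open Summation semiring
  open Determinant R
  open PascalMatrices R
  open IntegerSolver R using (solve; _:+_; _:*_; _:-_; :-_; _:=_; con)
  open SetoidReasoning setoid

  I-↑ˡ : ∀ {m} k (i j : Fin m) → I (m ℕ.+ k) (i ↑ˡ k) (j ↑ˡ k) ≡ I m i j
  I-↑ˡ k zero    zero    = ≡.refl
  I-↑ˡ k zero    (suc j) = ≡.refl
  I-↑ˡ k (suc i) zero    = ≡.refl
  I-↑ˡ k (suc i) (suc j) = I-↑ˡ k i j

  I-↑ʳ : ∀ m {k} (i j : Fin k) → I (m ℕ.+ k) (m ↑ʳ i) (m ↑ʳ j) ≡ I k i j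
  I-↑ʳ zero    i j = ≡.refl
  I-↑ʳ (suc m) i j = I-↑ʳ m i j

  I-↑ʳ-↑ˡ : ∀ {m k} (i : Fin k) (j : Fin m) → I (m ℕ.+ k) (m ↑ʳ i) (j ↑ˡ k) ≡ 0#
  I-↑ʳ-↑ˡ i zero    = ≡.refl
  I-↑ʳ-↑ˡ i (suc j) = I-↑ʳ-↑ˡ i j

  I-↑ˡ-↑ʳ : ∀ {m k} (i : Fin m) (j : Fin k) → I (m ℕ.+ k) (i ↑ˡ k) (m ↑ʳ j) ≡ 0#
  I-↑ˡ-↑ʳ zero    j = ≡.refl
  I-↑ˡ-↑ʳ (suc i) j = I-↑ˡ-↑ʳ i j

  I-opposite : ∀ {n} (i j : Fin n) → I n (opposite i) (opposite j) ≡ I n i j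
  I-opposite i j with i Fin.≟ j
  ... | yes ≡.refl = I-diagonal (opposite i)
  ... | no  i≢j    = I-off-diagonal {i = opposite i} λ eq → i≢j
    (≡.trans (≡.sym (Fin.opposite-involutive i)) (≡.trans (≡.cong opposite eq) (Fin.opposite-involutive j)))

  -- Jacobi's identity between complementary minors of a matrix M and of its inverse X / x.
  complementary-minors : ∀ m {k} (M X : Matrix (m ℕ.+ k)) x → (∀ i j → (M ⊡ X) i j ≈ x * I (m ℕ.+ k) i j) →
    det M * det (λ i j → X (m ↑ʳ i) (m ↑ʳ j)) ≈ det (λ i j → M (i ↑ˡ k) (j ↑ˡ k)) * x ^ k
  complementary-minors m {k} M X x MX≈x = begin
    det M * det (λ i j → X (m ↑ʳ i) (m ↑ʳ j))
      ≈⟨ *-congˡ (trans (det-upper-block m Y Y₂₁ Y₁₁) (det-cong Y₂₂)) ⟨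
    det M * det Y
      ≈⟨ det-⊡ M Y ⟨
    det (M ⊡ Y)
      ≈⟨ det-lower-block {m} (M ⊡ Y) x Z₁₂ Z₂₂ ⟩
    det (λ i j → (M ⊡ Y) (i ↑ˡ k) (j ↑ˡ k)) * x ^ k
      ≈⟨ *-congʳ (det-cong λ i j → Z₁ (i ↑ˡ k) j) ⟩
    det (λ i j → M (i ↑ˡ k) (j ↑ˡ k)) * x ^ k ∎
    where
    -- Y takes its first m columns from the identity and its last k from X. Then det Y is the corner
    -- minor of X, while M Y has the first m columns of M followed by the last k columns of x I;
    -- comparing det (M Y) with det M det Y divides by nothing.
    column : Fin (m ℕ.+ k) → Fin (m ℕ.+ k) → Fin m ⊎ Fin k → Carrier
    column i j = [ (λ _ → I (m ℕ.+ k) i j) , (λ _ → X i j) ]′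
    Y : Matrix (m ℕ.+ k)
    Y i j = column i j (splitAt m j)
    Y-↑ˡ : ∀ i j → Y i (j ↑ˡ k) ≡ I (m ℕ.+ k) i (j ↑ˡ k)
    Y-↑ˡ i j = ≡.cong (column i (j ↑ˡ k)) (Fin.splitAt-↑ˡ m j k)
    Y-↑ʳ : ∀ i j → Y i (m ↑ʳ j) ≡ X i (m ↑ʳ j)
    Y-↑ʳ i j = ≡.cong (column i (m ↑ʳ j)) (Fin.splitAt-↑ʳ m k j)
    Y₂₁ : ∀ i j → Y (m ↑ʳ i) (j ↑ˡ k) ≈ 0#
    Y₂₁ i j = reflexive (≡.trans (Y-↑ˡ (m ↑ʳ i) j) (I-↑ʳ-↑ˡ i j))
    Y₁₁ : ∀ i j → Y (i ↑ˡ k) (j ↑ˡ k) ≈ I m i j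
    Y₁₁ i j = reflexive (≡.trans (Y-↑ˡ (i ↑ˡ k) j) (I-↑ˡ k i j))
    Y₂₂ : ∀ i j → Y (m ↑ʳ i) (m ↑ʳ j) ≈ X (m ↑ʳ i) (m ↑ʳ j)
    Y₂₂ i j = reflexive (Y-↑ʳ (m ↑ʳ i) j)
    Z₁ : ∀ i j → (M ⊡ Y) i (j ↑ˡ k) ≈ M i (j ↑ˡ k)
    Z₁ i j = trans (sum-cong-≋ λ l → *-congˡ {M i l} (reflexive (Y-↑ˡ l j))) (sum-I′ (j ↑ˡ k) (M i))
    Z₂ : ∀ i j → (M ⊡ Y) i (m ↑ʳ j) ≈ x * I (m ℕ.+ k) i (m ↑ʳ j)
    Z₂ i j = trans (sum-cong-≋ λ l → *-congˡ {M i l} (reflexive (Y-↑ʳ l j))) (MX≈x i (m ↑ʳ j))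
    Z₁₂ : ∀ i j → (M ⊡ Y) (i ↑ˡ k) (m ↑ʳ j) ≈ 0#
    Z₁₂ i j = trans (Z₂ (i ↑ˡ k) j) (trans (*-congˡ (reflexive (I-↑ˡ-↑ʳ i j))) (zeroʳ x))
    Z₂₂ : ∀ i j → (M ⊡ Y) (m ↑ʳ i) (m ↑ʳ j) ≈ x * I k i j
    Z₂₂ i j = trans (Z₂ (m ↑ʳ i) j) (*-congˡ (reflexive (I-↑ʳ m i j)))

  module Complement (t : Carrier) {p} (p-prime : Prime p) (p×1≈0 : p × 1# ≈ 0#) l {m} (1+m≡q : suc m ≡ p ℕ.^ l) where
    open PrimePower p-prime p×1≈0 l 1+m≡q

    characteristic : ∀ n → Matrix n
    characteristic n = t ⊙ I n ⊖ pascal n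

    -- t² + t P + P², with P² = rotated n: it is (t³ - 1) (t - P)⁻¹, as P³ = 1.
    adjugate : ∀ n → Matrix n
    adjugate n i j = t * t * I n i j + (t * pascal n i j + rotated n i j)

    -- (t - P)(t² + t P + P²) = t³ - P³, with P² and P³ as computed above. The size is a variable n
    -- because it is used at a + k, which equals `suc m` only propositionally.
    characteristic-adjugate : ∀ {n} → n ≡ suc m → ∀ i j →
      (characteristic n ⊡ adjugate n) i j ≈ (t * t * t - 1#) * I n i j
    characteristic-adjugate {n} ≡.refl i j = begin
      sum (λ k → (t * I n i k - pascal n i k) * adjugate n k j)
        ≈⟨ sum-cong-≋ (λ k → solve 4 (λ t e a x → (t :* e :- a) :* x := t :* (e :* x) :+ (:- con (+ 1)) :* (a :* x))
             refl t (I n i k) (pascal n i k) (adjugate n k j)) ⟩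
      sum (λ k → t * (I n i k * adjugate n k j) + - 1# * (pascal n i k * adjugate n k j))
        ≈⟨ sum-linear t (λ k → I n i k * adjugate n k j) (λ k → - 1# * (pascal n i k * adjugate n k j)) ⟩
      t * sum (λ k → I n i k * adjugate n k j) + sum (λ k → - 1# * (pascal n i k * adjugate n k j))
        ≈⟨ +-cong (*-congˡ (sum-I i λ k → adjugate n k j))
             (sym (*-distribˡ-sum (- 1#) (λ k → pascal n i k * adjugate n k j))) ⟩
      t * adjugate n i j + - 1# * (pascal n ⊡ adjugate n) i j
        ≈⟨ +-congˡ (*-congˡ pascal-adjugate) ⟩
      t * adjugate n i j + - 1# * (t * t * pascal n i j + (t * rotated n i j + I n i j))
        ≈⟨ solve 4 (λ t e a b → t :* (t :* t :* e :+ (t :* a :+ b)) :+ (:- con (+ 1)) :* (t :* t :* a :+ (t :* b :+ e))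
             := (t :* t :* t :- con (+ 1)) :* e) refl t (I n i j) (pascal n i j) (rotated n i j) ⟩
      (t * t * t - 1#) * I n i j ∎
      where
      pascal-adjugate : (pascal n ⊡ adjugate n) i j ≈ t * t * pascal n i j + (t * rotated n i j + I n i j)
      pascal-adjugate = begin
        sum (λ k → pascal n i k * adjugate n k j)
          ≈⟨ sum-cong-≋ (λ k → solve 5 (λ t a e b c → a :* (t :* t :* e :+ (t :* b :+ c)) :=
               t :* t :* (a :* e) :+ (t :* (a :* b) :+ a :* c))
               refl t (pascal n i k) (I n k j) (pascal n k j) (rotated n k j)) ⟩
        sum (λ k → t * t * (pascal n i k * I n k j) +
                   (t * (pascal n i k * pascal n k j) + pascal n i k * rotated n k j))
          ≈⟨ trans (sum-linear (t * t) (λ k → pascal n i k * I n k j)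
                     (λ k → t * (pascal n i k * pascal n k j) + pascal n i k * rotated n k j))
               (+-congˡ (sum-linear t (λ k → pascal n i k * pascal n k j) (λ k → pascal n i k * rotated n k j))) ⟩
        t * t * sum (λ k → pascal n i k * I n k j) + (t * (pascal n ⊡ pascal n) i j + (pascal n ⊡ rotated n) i j)
          ≈⟨ +-cong (*-congˡ (sum-I′ j (pascal n i))) (+-cong (*-congˡ (pascal² i j)) (pascal³ i j)) ⟩
        t * t * pascal n i j + (t * rotated n i j + I n i j) ∎

    complement : ∀ a k → a ℕ.+ k ≡ suc m → k ℕ.≤ a →
      det (characteristic (suc m)) * det (t ^ 2 ⊙ I k ⊕ pascal k) ≈
      det (characteristic a) * (t * t * t - 1#) ^ k
    complement a k eq k≤a = begin
      det (characteristic (suc m)) * det (t ^ 2 ⊙ I k ⊕ pascal k)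
        ≡⟨ ≡.cong (λ n → det (characteristic n) * det (t ^ 2 ⊙ I k ⊕ pascal k)) (≡.sym eq) ⟩
      det (characteristic (a ℕ.+ k)) * det (t ^ 2 ⊙ I k ⊕ pascal k)
        ≈⟨ *-congˡ (trans (det-cong corner) (det-opposite (t ^ 2 ⊙ I k ⊕ pascal k))) ⟨
      det (characteristic (a ℕ.+ k)) * det (λ i j → adjugate (a ℕ.+ k) (a ↑ʳ i) (a ↑ʳ j))
        ≈⟨ complementary-minors a (characteristic (a ℕ.+ k)) (adjugate (a ℕ.+ k)) (t * t * t - 1#)
             (characteristic-adjugate eq) ⟩
      det (λ i j → characteristic (a ℕ.+ k) (i ↑ˡ k) (j ↑ˡ k)) * (t * t * t - 1#) ^ k
        ≈⟨ *-congʳ (det-cong {a} λ i j → reflexive (≡.cong₂ (λ e s → t * e - s)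
             (I-↑ˡ k i j) (≡.cong₂ (λ u v → ((u ℕ.+ v) C u) × 1#) (Fin.toℕ-↑ˡ i k) (Fin.toℕ-↑ˡ j k)))) ⟩
      det (characteristic a) * (t * t * t - 1#) ^ k ∎
      where
      a+i≤m : ∀ (i : Fin k) → a ℕ.+ toℕ i ℕ.≤ m
      a+i≤m i = ℕ.≤-pred (≡.subst (suc (a ℕ.+ toℕ i) ℕ.≤_) eq
        (≡.subst (ℕ._≤ a ℕ.+ k) (ℕ.+-suc a (toℕ i)) (ℕ.+-monoʳ-≤ a (Fin.toℕ<n i))))
      -- This is where k ≤ a enters: indices of the corner sum to at least 2 a ≥ a + k = m + 1,
      -- beyond the antidiagonal.
      m<a+a : ∀ (i j : Fin k) → m ℕ.< a ℕ.+ toℕ i ℕ.+ (a ℕ.+ toℕ j)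
      m<a+a i j = ℕ.≤-trans (≡.subst (ℕ._≤ a ℕ.+ a) eq (ℕ.+-monoʳ-≤ a k≤a))
        (ℕ.+-mono-≤ (ℕ.m≤m+n a (toℕ i)) (ℕ.m≤m+n a (toℕ j)))
      -- As m = a + k - 1, the rotation takes a + i to k - 1 - i.
      m∸ : ∀ (i : Fin k) → m ∸ toℕ (a ↑ʳ i) ≡ toℕ (opposite i)
      m∸ i = ≡.trans (≡.cong (m ∸_) (Fin.toℕ-↑ʳ a i)) (≡.trans (≡.cong (_∸ suc (a ℕ.+ toℕ i)) (≡.sym eq))
        (≡.trans (≡.cong (a ℕ.+ k ∸_) (≡.sym (ℕ.+-suc a (toℕ i)))) (≡.trans (ℕ.[m+n]∸[m+o]≡n∸o a k (suc (toℕ i)))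
          (≡.sym (Fin.opposite-prop i)))))
      corner : ∀ i j → adjugate (a ℕ.+ k) (a ↑ʳ i) (a ↑ʳ j) ≈ (t ^ 2 ⊙ I k ⊕ pascal k) (opposite i) (opposite j)
      corner i j = begin
        t * t * I (a ℕ.+ k) (a ↑ʳ i) (a ↑ʳ j) + (t * pascal (a ℕ.+ k) (a ↑ʳ i) (a ↑ʳ j) + rotated (a ℕ.+ k) (a ↑ʳ i) (a ↑ʳ j))
          ≈⟨ +-cong (*-cong (*-congˡ (*-identityʳ t)) (reflexive (≡.trans (I-opposite i j) (≡.sym (I-↑ʳ a i j)))))
               (trans (sym (+-identityˡ _)) (+-cong (sym (trans (*-congˡ vanish) (zeroʳ t))) (reflexive (≡.sym rotate)))) ⟨
        t ^ 2 * I k (opposite i) (opposite j) + pascal k (opposite i) (opposite j) ∎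
        where
        vanish : pascal (a ℕ.+ k) (a ↑ʳ i) (a ↑ʳ j) ≈ 0#
        vanish = ≡.subst₂ (λ u v → ((u ℕ.+ v) C u) × 1# ≈ 0#) (≡.sym (Fin.toℕ-↑ʳ a i)) (≡.sym (Fin.toℕ-↑ʳ a j))
          (pascal-0 (a ℕ.+ toℕ i) (a ℕ.+ toℕ j) (a+i≤m i) (a+i≤m j) (m<a+a i j))
        rotate : rotated (a ℕ.+ k) (a ↑ʳ i) (a ↑ʳ j) ≡ pascal k (opposite i) (opposite j)
        rotate = ≡.cong₂ (λ u v → ((u ℕ.+ v) C u) × 1#) (m∸ i) (m∸ j)

-- The characteristic polynomial of P(q) as a product.

module CoreFactor {r ℓ} (R : CommutativeRing r ℓ) where
  open CommutativeRing R hiding (zero)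

  -- The product of t - ω^i ω^(2 (m - i)) for 0 ≤ i ≤ m.
  core : Carrier → ℕ → Carrier
  core t 0                   = t - 1#
  core t 1                   = t * t + t + 1#
  core t 2                   = t * t * t - 1#
  core t (suc (suc (suc m))) = (t * t * t - 1#) * core t m

module CubeRootOfUnity {r ℓ} (R : CommutativeRing r ℓ) where
  open CommutativeRing R hiding (zero)
  open Exponentiation semiring
  open Summation semiring
  open Determinant R
  open BinaryForms R
  open PascalMatrices R
  open CoreFactor R
  open IntegerSolver R using (solve; _:+_; _:*_; _:-_; :-_; _:=_; con)
  open SetoidReasoning setoid

  module _ {ω : Carrier} (ω²+ω+1≈0 : ω * ω + ω + 1# ≈ 0#) where

    ω² : Carrier
    ω² = - 1# - ω

    ω*ω : ω * ω ≈ ω²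
    ω*ω = begin
      ω * ω                      ≈⟨ solve 1 (λ w → w :* w := w :* w :+ w :+ con (+ 1) :+ (:- con (+ 1) :- w)) refl ω ⟩
      ω * ω + ω + 1# + ω²        ≈⟨ trans (+-congʳ ω²+ω+1≈0) (+-identityˡ ω²) ⟩
      ω²                         ∎

    ω*ω² : ω * ω² ≈ 1#
    ω*ω² = begin
      ω * ω²                     ≈⟨ solve 1 (λ w → w :* (:- con (+ 1) :- w) := con (+ 1) :- (w :* w :+ w :+ con (+ 1))) refl ω ⟩
      1# - (ω * ω + ω + 1#)      ≈⟨ +-congˡ (-‿cong ω²+ω+1≈0) ⟩
      1# - 0#                    ≈⟨ solve 0 (con (+ 1) :- con (+ 0) := con (+ 1)) refl ⟩
      1#                         ∎

    ω²*ω² : ω² * ω² ≈ ω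
    ω²*ω² = begin
      ω² * ω²                    ≈⟨ *-congʳ ω*ω ⟨
      ω * ω * ω²                 ≈⟨ *-assoc _ _ _ ⟩
      ω * (ω * ω²)               ≈⟨ trans (*-congˡ ω*ω²) (*-identityʳ ω) ⟩
      ω                          ∎

    -- x + ω y is an eigenvector of ρ.
    eigenbasis triangle : Substitution
    eigenbasis = ⟨ 1# , ω ⨾ 0# , 1# ⟩
    triangle   = ⟨ ω , 0# ⨾ 1# , ω² ⟩

    -- ρ sends x + ω y to -y + ω (x - y) = ω (x + ω y), since -1 - ω = ω², and y to x - y = (x + ω
    -- y) + ω² y. Completing the basis by y and not by the eigenvector x + ω² y keeps its
    -- determinant 1 for p = 3 too.
    eigenbasis-ρ : eigenbasis ∙ ρ ≈ˢ triangle ∙ eigenbasis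
    eigenbasis-ρ = ⟨ solve 1 (λ w → con (+ 1) :* con (+ 0) :+ w :* con (+ 1) := w :* con (+ 1) :+ con (+ 0) :* con (+ 0)) refl ω
                   , trans (solve 1 (λ w → con (+ 1) :* (:- con (+ 1)) :+ w :* (:- con (+ 1)) := :- con (+ 1) :- w) refl ω)
                      (trans (sym ω*ω) (solve 1 (λ w → w :* w := w :* w :+ con (+ 0) :* con (+ 1)) refl ω))
                   ⨾ solve 1 (λ w → con (+ 0) :* con (+ 0) :+ con (+ 1) :* con (+ 1) :=
                        con (+ 1) :* con (+ 1) :+ (:- con (+ 1) :- w) :* con (+ 0)) refl ω
                   , solve 1 (λ w → con (+ 0) :* (:- con (+ 1)) :+ con (+ 1) :* (:- con (+ 1)) :=
                        con (+ 1) :* w :+ (:- con (+ 1) :- w) :* con (+ 1)) refl ω ⟩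

    1^n≈1 : ∀ n → 1# ^ n ≈ 1#
    1^n≈1 zero    = refl
    1^n≈1 (suc n) = trans (*-identityˡ _) (1^n≈1 n)

    det-eigenbasis : ∀ m → det (Sym eigenbasis m) ≈ 1#
    det-eigenbasis m = det-lower-unitriangular (Sym eigenbasis m)
      (λ i j → form-lower eigenbasis refl (toℕ i) (m ∸ toℕ i) (toℕ j))
      (λ i → trans (form-lower-diagonal eigenbasis refl (toℕ i) (m ∸ toℕ i))
               (trans (*-cong (1^n≈1 (toℕ i)) (1^n≈1 (m ∸ toℕ i))) (*-identityˡ 1#)))

    module _ (t : Carrier) where

      -- The factor c makes the family closed under recursion: dropping the first member lowers m by
      -- 1 and replaces c by c ω.
      eigenvalues : Carrier → ∀ m → Fin (suc m) → Carrier
      eigenvalues c m i = t - c * (ω ^ toℕ i * ω² ^ (m ∸ toℕ i))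

      -- From U A = B U and det U = 1, without forming an inverse of U.
      det-similar : ∀ m → det (t ⊙ I (suc m) ⊖ Sym ρ m) ≈ det (t ⊙ I (suc m) ⊖ Sym triangle m)
      det-similar m = begin
        det A              ≈⟨ *-identityˡ _ ⟨
        1# * det A         ≈⟨ *-congʳ (det-eigenbasis m) ⟨
        det U * det A      ≈⟨ det-⊡ U A ⟨
        det (U ⊡ A)        ≈⟨ det-cong conjugate ⟩
        det (B ⊡ U)        ≈⟨ det-⊡ B U ⟩
        det B * det U      ≈⟨ *-congˡ (det-eigenbasis m) ⟩
        det B * 1#         ≈⟨ *-identityʳ _ ⟩
        det B              ∎
        where
        A B U : Matrix (suc m)
        A = t ⊙ I (suc m) ⊖ Sym ρ m
        B = t ⊙ I (suc m) ⊖ Sym triangle m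
        U = Sym eigenbasis m
        conjugate : U ⊡ A ≈ᵐ B ⊡ U
        conjugate i j = begin
          sum (λ k → U i k * (t * I (suc m) k j - Sym ρ m k j))
            ≈⟨ sum-cong-≋ (λ k → solve 4 (λ u t e s → u :* (t :* e :- s) := t :* (u :* e) :+ (:- con (+ 1)) :* (u :* s))
                 refl (U i k) t (I (suc m) k j) (Sym ρ m k j)) ⟩
          sum (λ k → t * (U i k * I (suc m) k j) + - 1# * (U i k * Sym ρ m k j))
            ≈⟨ sum-linear t (λ k → U i k * I (suc m) k j) (λ k → - 1# * (U i k * Sym ρ m k j)) ⟩
          t * sum (λ k → U i k * I (suc m) k j) + sum (λ k → - 1# * (U i k * Sym ρ m k j))
            ≈⟨ +-cong (*-congˡ (sum-I′ j (U i))) (sym (*-distribˡ-sum (- 1#) (λ k → U i k * Sym ρ m k j))) ⟩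
          t * U i j + - 1# * (U ⊡ Sym ρ m) i j
            ≈⟨ +-congˡ (*-congˡ (begin
                 (U ⊡ Sym ρ m) i j                  ≈⟨ Sym-∙ eigenbasis ρ m i j ⟩
                 Sym (eigenbasis ∙ ρ) m i j         ≈⟨ Sym-cong eigenbasis-ρ m i j ⟩
                 Sym (triangle ∙ eigenbasis) m i j  ≈⟨ Sym-∙ triangle eigenbasis m i j ⟨
                 (Sym triangle m ⊡ U) i j           ∎)) ⟩
          t * U i j + - 1# * (Sym triangle m ⊡ U) i j
            ≈⟨ +-cong (*-congˡ (sum-I i λ k → U k j)) (sym (*-distribˡ-sum (- 1#) (λ k → Sym triangle m i k * U k j))) ⟨
          t * sum (λ k → I (suc m) i k * U k j) + sum (λ k → - 1# * (Sym triangle m i k * U k j))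
            ≈⟨ sum-linear t (λ k → I (suc m) i k * U k j) (λ k → - 1# * (Sym triangle m i k * U k j)) ⟨
          sum (λ k → t * (I (suc m) i k * U k j) + - 1# * (Sym triangle m i k * U k j))
            ≈⟨ sum-cong-≋ (λ k → solve 4 (λ u t e s → t :* (e :* u) :+ (:- con (+ 1)) :* (s :* u) := (t :* e :- s) :* u)
                 refl (U k j) t (I (suc m) i k) (Sym triangle m i k)) ⟩
          sum (λ k → (t * I (suc m) i k - Sym triangle m i k) * U k j) ∎

      det-triangle : ∀ m → det (t ⊙ I (suc m) ⊖ Sym triangle m) ≈ product (eigenvalues 1# m)
      det-triangle m = trans
        (det-upper-triangular (t ⊙ I (suc m) ⊖ Sym triangle m) λ i j j<i → begin
          t * I (suc m) i j - form triangle (toℕ i) (m ∸ toℕ i) (toℕ j)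
            ≈⟨ +-cong (*-congˡ (reflexive (I-off-diagonal {i = i} λ { ≡.refl → ℕ.<-irrefl ≡.refl j<i })))
                 (-‿cong (form-upper triangle refl (toℕ i) (m ∸ toℕ i) (toℕ j) j<i)) ⟩
          t * 0# - 0#
            ≈⟨ solve 1 (λ t → t :* con (+ 0) :- con (+ 0) := con (+ 0)) refl t ⟩
          0# ∎)
        (product-cong diagonal)
        where
        diagonal : ∀ i → (t ⊙ I (suc m) ⊖ Sym triangle m) i i ≈ eigenvalues 1# m i
        diagonal i = +-cong
          (trans (*-congˡ (reflexive (I-diagonal i))) (*-identityʳ t))
          (-‿cong (trans (form-upper-diagonal triangle refl (toℕ i) (m ∸ toℕ i)) (sym (*-identityˡ _))))

      ω²^³≈1 : ∀ n → ω² ^ n * ω² ^ n * ω² ^ n ≈ 1#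
      ω²^³≈1 zero    = solve 0 (con (+ 1) :* con (+ 1) :* con (+ 1) := con (+ 1)) refl
      ω²^³≈1 (suc n) = begin
        ω² * x * (ω² * x) * (ω² * x)  ≈⟨ solve 2 (λ w x → w :* x :* (w :* x) :* (w :* x) := w :* w :* w :* (x :* x :* x)) refl ω² x ⟩
        ω² * ω² * ω² * (x * x * x)    ≈⟨ *-cong (trans (*-congʳ ω²*ω²) ω*ω²) (ω²^³≈1 n) ⟩
        1# * 1#                       ≈⟨ *-identityˡ 1# ⟩
        1#                            ∎
        where x = ω² ^ n

      product-eigenvalues-suc : ∀ c m → product (eigenvalues c (suc m)) ≈
        (t - c * ω² ^ suc m) * product (eigenvalues (c * ω) m)
      product-eigenvalues-suc c m = *-cong (+-congˡ (-‿cong (*-congˡ (*-identityˡ _)))) (product-cong shift)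
        where
        shift : ∀ i → eigenvalues c (suc m) (suc i) ≈ eigenvalues (c * ω) m i
        shift i = +-congˡ (-‿cong (solve 4 (λ c w x y → c :* (w :* x :* y) := c :* w :* (x :* y))
          refl c ω (ω ^ toℕ i) (ω² ^ (m ∸ toℕ i))))

      cubes : ∀ e → e * e * e ≈ 1# → (t - e * ω) * ((t - e) * (t - e * ω²)) ≈ t * t * t - 1#
      cubes e e³≈1 = begin
        (t - e * ω) * ((t - e) * (t - e * ω²))
          -- The deviation from t³ - e³ ω ω² is displayed as multiples of 1 + ω + ω² and ω ω² - 1,
          -- both of which vanish.
          ≈⟨ solve 3 (λ t e w → let w² = :- con (+ 1) :- w in
               (t :- e :* w) :* ((t :- e) :* (t :- e :* w²)) :=
               t :* t :* t :- e :* e :* e :* (w :* w²) :+ (t :* e :* e :- t :* t :* e) :* (con (+ 1) :+ w :+ w²)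
                 :+ (t :* e :* e) :* (w :* w² :- con (+ 1)))
               refl t e ω ⟩
        t * t * t - e * e * e * (ω * ω²) + (t * e * e - t * t * e) * (1# + ω + ω²) + t * e * e * (ω * ω² - 1#)
          ≈⟨ +-cong (+-cong (+-congˡ (-‿cong (*-cong e³≈1 ω*ω²)))
               (*-congˡ (solve 1 (λ w → con (+ 1) :+ w :+ (:- con (+ 1) :- w) := con (+ 0)) refl ω)))
               (*-congˡ (+-congʳ ω*ω²)) ⟩
        t * t * t - 1# * 1# + (t * e * e - t * t * e) * 0# + t * e * e * (1# - 1#)
          ≈⟨ solve 2 (λ t e → t :* t :* t :- con (+ 1) :* con (+ 1) :+ (t :* e :* e :- t :* t :* e) :* con (+ 0)
                 :+ t :* e :* e :* (con (+ 1) :- con (+ 1)) := t :* t :* t :- con (+ 1)) refl t e ⟩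
        t * t * t - 1# ∎

      -- With e = c ω²^(m+1) the first three factors are t - e ω, t - e and t - e ω². The others
      -- carry c ω³ = c, so they form the product for m.
      product-eigenvalues : ∀ c m → c * c * c ≈ 1# → product (eigenvalues c (3 ℕ.+ m)) ≈
        (t * t * t - 1#) * product (eigenvalues c m)
      product-eigenvalues c m c³≈1 = begin
        product (eigenvalues c (3 ℕ.+ m))
          ≈⟨ trans (product-eigenvalues-suc c (2 ℕ.+ m)) (*-congˡ (trans
               (product-eigenvalues-suc (c * ω) (1 ℕ.+ m)) (*-congˡ (product-eigenvalues-suc (c * ω * ω) m)))) ⟩
        (t - c * (ω² * (ω² * x))) * ((t - c * ω * (ω² * x)) * ((t - c * ω * ω * x) * product (eigenvalues (c * ω * ω * ω) m)))
          ≈⟨ *-cong (+-congˡ (-‿cong first)) (*-cong (+-congˡ (-‿cong second)) (*-cong (+-congˡ (-‿cong third))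
               (product-cong fourth))) ⟩
        (t - e * ω) * ((t - e) * ((t - e * ω²) * product (eigenvalues c m)))
          ≈⟨ solve 4 (λ a b c d → a :* (b :* (c :* d)) := a :* (b :* c) :* d) refl (t - e * ω) (t - e) (t - e * ω²) _ ⟩
        (t - e * ω) * ((t - e) * (t - e * ω²)) * product (eigenvalues c m)
          ≈⟨ *-congʳ (cubes e e³≈1) ⟩
        (t * t * t - 1#) * product (eigenvalues c m) ∎
        where
        x e : Carrier
        x = ω² ^ suc m
        e = c * x
        first : c * (ω² * (ω² * x)) ≈ e * ω
        first = trans (solve 3 (λ c w x → c :* (w :* (w :* x)) := c :* x :* (w :* w)) refl c ω² x) (*-congˡ ω²*ω²)
        second : c * ω * (ω² * x) ≈ e
        second = trans (solve 4 (λ c w w² x → c :* w :* (w² :* x) := c :* x :* (w :* w²)) refl c ω ω² x)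
                   (trans (*-congˡ ω*ω²) (*-identityʳ e))
        third : c * ω * ω * x ≈ e * ω²
        third = trans (solve 3 (λ c w x → c :* w :* w :* x := c :* x :* (w :* w)) refl c ω x) (*-congˡ ω*ω)
        cω³≈c : c * ω * ω * ω ≈ c
        cω³≈c = trans (solve 2 (λ c w → c :* w :* w :* w := c :* (w :* (w :* w))) refl c ω)
                   (trans (*-congˡ (trans (*-congˡ ω*ω) ω*ω²)) (*-identityʳ c))
        fourth : ∀ i → eigenvalues (c * ω * ω * ω) m i ≈ eigenvalues c m i
        fourth i = +-congˡ (-‿cong (*-congʳ cω³≈c))
        e³≈1 : e * e * e ≈ 1#
        e³≈1 = trans (solve 2 (λ c x → c :* x :* (c :* x) :* (c :* x) := c :* c :* c :* (x :* x :* x)) refl c x)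
                 (trans (*-cong c³≈1 (ω²^³≈1 (suc m))) (*-identityˡ 1#))

      product-core : ∀ m → product (eigenvalues 1# m) ≈ core t m
      product-core 0 = solve 1 (λ t → (t :- con (+ 1) :* (con (+ 1) :* con (+ 1))) :* con (+ 1) := t :- con (+ 1)) refl t
      product-core 1 = begin
        product (eigenvalues 1# 1)
          ≈⟨ solve 2 (λ t w → let w² = :- con (+ 1) :- w ; o = con (+ 1) in
               (t :- o :* (o :* (w² :* o))) :* ((t :- o :* (w :* o :* o)) :* o)
                 := t :* t :+ t :+ w :* w²) refl t ω ⟩
        t * t + t + ω * ω²
          ≈⟨ +-congˡ ω*ω² ⟩
        t * t + t + 1# ∎
      product-core 2 = begin
        product (eigenvalues 1# 2)
          ≈⟨ solve 2 (λ t w → let w² = :- con (+ 1) :- w ; o = con (+ 1) in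
               (t :- o :* (o :* (w² :* (w² :* o)))) :* ((t :- o :* (w :* o :* (w² :* o))) :* ((t :- o :* (w :* (w :* o) :* o)) :* o))
                 := (t :- w² :* w²) :* ((t :- w :* w²) :* (t :- w :* w))) refl t ω ⟩
        (t - ω² * ω²) * ((t - ω * ω²) * (t - ω * ω))
          ≈⟨ *-cong (+-congˡ (-‿cong (trans ω²*ω² (sym (*-identityˡ ω)))))
               (*-cong (+-congˡ (-‿cong ω*ω²)) (+-congˡ (-‿cong (trans ω*ω (sym (*-identityˡ ω²)))))) ⟩
        (t - 1# * ω) * ((t - 1#) * (t - 1# * ω²))
          ≈⟨ cubes 1# (trans (*-congʳ (*-identityˡ 1#)) (*-identityˡ 1#)) ⟩
        t * t * t - 1# ∎
      product-core (suc (suc (suc m))) = trans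
        (product-eigenvalues 1# m (trans (*-congʳ (*-identityˡ 1#)) (*-identityˡ 1#)))
        (*-congˡ (product-core m))

      det-core : ∀ m → det (t ⊙ I (suc m) ⊖ Sym ρ m) ≈ core t m
      det-core m = trans (det-similar m) (trans (det-triangle m) (product-core m))

-- R[ω] / (ω² + ω + 1), with (a , b) for a + b ω.
module Eisenstein {r ℓ} (R : CommutativeRing r ℓ) where
  open import Data.Product.Base using (_×_)
  open CommutativeRing R hiding (zero)
  open IntegerSolver R using (solve; _:+_; _:*_; _:-_; :-_; _:=_; con)

  R[ω] : CommutativeRing r ℓ
  R[ω] = record
    { Carrier = Carrier × Carrier
    ; _≈_     = λ (a , b) (c , d) → (a ≈ c) × (b ≈ d)
    ; _+_     = λ (a , b) (c , d) → a + c , b + d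
    -- The term b d ω² is b d (-1 - ω).
    ; _*_     = λ (a , b) (c , d) → a * c - b * d , a * d + b * c - b * d
    ; -_      = λ (a , b) → - a , - b
    ; 0#      = 0# , 0#
    ; 1#      = 1# , 0#
    ; isCommutativeRing = record
      { isRing = record
        { +-isAbelianGroup = record
          { isGroup = record
            { isMonoid = record
              { isSemigroup = record
                { isMagma = record
                  { isEquivalence = record
                    { refl  = refl , refl
                    ; sym   = λ (p , q) → sym p , sym q
                    ; trans = λ (p , q) (p′ , q′) → trans p p′ , trans q q′
                    }
                  ; ∙-cong = λ (p , q) (p′ , q′) → +-cong p p′ , +-cong q q′
                  }
                ; assoc = λ (a , b) (c , d) (e , f) → +-assoc a c e , +-assoc b d f
                }
              ; identity = (λ (a , b) → +-identityˡ a , +-identityˡ b) , (λ (a , b) → +-identityʳ a , +-identityʳ b)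
              }
            ; inverse = (λ (a , b) → -‿inverseˡ a , -‿inverseˡ b) , (λ (a , b) → -‿inverseʳ a , -‿inverseʳ b)
            ; ⁻¹-cong = λ (p , q) → -‿cong p , -‿cong q
            }
          ; comm = λ (a , b) (c , d) → +-comm a c , +-comm b d
          }
        ; *-cong = λ (p , q) (p′ , q′) →
            +-cong (*-cong p p′) (-‿cong (*-cong q q′)) ,
            +-cong (+-cong (*-cong p q′) (*-cong q p′)) (-‿cong (*-cong q q′))
        ; *-assoc = λ (a , b) (c , d) (e , f) →
            solve 6 (λ a b c d e f →
              (a :* c :- b :* d) :* e :- (a :* d :+ b :* c :- b :* d) :* f :=
              a :* (c :* e :- d :* f) :- b :* (c :* f :+ d :* e :- d :* f)) refl a b c d e f ,
            solve 6 (λ a b c d e f →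
              (a :* c :- b :* d) :* f :+ (a :* d :+ b :* c :- b :* d) :* e :- (a :* d :+ b :* c :- b :* d) :* f :=
              a :* (c :* f :+ d :* e :- d :* f) :+ b :* (c :* e :- d :* f) :- b :* (c :* f :+ d :* e :- d :* f))
              refl a b c d e f
        ; *-identity =
            (λ (a , b) → solve 2 (λ a b → con (+ 1) :* a :- con (+ 0) :* b := a) refl a b ,
                         solve 2 (λ a b → con (+ 1) :* b :+ con (+ 0) :* a :- con (+ 0) :* b := b) refl a b) ,
            (λ (a , b) → solve 2 (λ a b → a :* con (+ 1) :- b :* con (+ 0) := a) refl a b ,
                         solve 2 (λ a b → a :* con (+ 0) :+ b :* con (+ 1) :- b :* con (+ 0) := b) refl a b)
        ; distrib =
            (λ (a , b) (c , d) (e , f) →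
              solve 6 (λ a b c d e f → a :* (c :+ e) :- b :* (d :+ f) :=
                a :* c :- b :* d :+ (a :* e :- b :* f)) refl a b c d e f ,
              solve 6 (λ a b c d e f → a :* (d :+ f) :+ b :* (c :+ e) :- b :* (d :+ f) :=
                a :* d :+ b :* c :- b :* d :+ (a :* f :+ b :* e :- b :* f)) refl a b c d e f) ,
            (λ (a , b) (c , d) (e , f) →
              solve 6 (λ a b c d e f → (c :+ e) :* a :- (d :+ f) :* b :=
                c :* a :- d :* b :+ (e :* a :- f :* b)) refl a b c d e f ,
              solve 6 (λ a b c d e f → (c :+ e) :* b :+ (d :+ f) :* a :- (d :+ f) :* b :=
                c :* b :+ d :* a :- d :* b :+ (e :* b :+ f :* a :- f :* b)) refl a b c d e f)
        }
      ; *-comm = λ (a , b) (c , d) →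
          solve 4 (λ a b c d → a :* c :- b :* d := c :* a :- d :* b) refl a b c d ,
          solve 4 (λ a b c d → a :* d :+ b :* c :- b :* d := c :* b :+ d :* a :- d :* b) refl a b c d
      }
    }

  private module R[ω] = CommutativeRing R[ω]

  embed : Carrier → R[ω].Carrier
  embed a = a , 0#

  open MorphismStructures.RingMorphisms rawRing R[ω].rawRing using (IsRingHomomorphism)

  embed-isHomomorphism : IsRingHomomorphism embed
  embed-isHomomorphism = record
    { isSemiringHomomorphism = record
      { isNearSemiringHomomorphism = record
        { +-isMonoidHomomorphism = record
          { isMagmaHomomorphism = record
            { isRelHomomorphism = record { cong = λ a≈b → a≈b , refl }
            ; homo              = λ a b → refl , sym (+-identityʳ 0#)
            }
          ; ε-homo = refl , refl
          }
        ; *-homo = λ a b →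
            solve 2 (λ a b → a :* b := a :* b :- con (+ 0) :* con (+ 0)) refl a b ,
            solve 2 (λ a b → con (+ 0) := a :* con (+ 0) :+ con (+ 0) :* b :- con (+ 0) :* con (+ 0)) refl a b
        }
      ; 1#-homo = refl , refl
      }
    ; -‿homo = λ a → refl , solve 0 (con (+ 0) := :- con (+ 0)) refl
    }

  ω : R[ω].Carrier
  ω = 0# , 1#

  ω²+ω+1≈0 : ω R[ω].* ω R[ω].+ ω R[ω].+ R[ω].1# R[ω].≈ R[ω].0#
  ω²+ω+1≈0 =
    solve 0 (con (+ 0) :* con (+ 0) :- con (+ 1) :* con (+ 1) :+ con (+ 0) :+ con (+ 1) := con (+ 0)) refl ,
    solve 0 (con (+ 0) :* con (+ 1) :+ con (+ 1) :* con (+ 0) :- con (+ 1) :* con (+ 1) :+ con (+ 1) :+ con (+ 0)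
      := con (+ 0)) refl

-- Descent of the characteristic polynomial from R[ω] to R.

module CharacteristicPolynomial {r ℓ} (R : CommutativeRing r ℓ) where
  open Eisenstein R
  private
    module R where
      open CommutativeRing R public
      open Determinant R public
      open PascalMatrices R public
      open CoreFactor R public
      open Multiplication semiring public
    module S where
      open CommutativeRing R[ω] public
      open Determinant R[ω] public
      open BinaryForms R[ω] public
      open PascalMatrices R[ω] public
      open CoreFactor R[ω] public
      open Multiplication semiring public
  open RingHomomorphism R.rawRing R[ω] embed-isHomomorphism
  open MorphismStructures.RingMorphisms R.rawRing S.rawRing using (module IsRingHomomorphism)
  open IsRingHomomorphism embed-isHomomorphism using (+-homo; *-homo; -‿homo; 1#-homo)
  open SetoidReasoning S.setoid

  core-homo : ∀ t m → embed (R.core t m) S.≈ S.core (embed t) m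
  core-homo t 0 = S.trans (+-homo t _) (S.+-congˡ (-‿homo R.1#))
  core-homo t 1 = S.trans (+-homo _ _) (S.+-congʳ (S.trans (+-homo _ _) (S.+-congʳ (*-homo t t))))
  core-homo t 2 = S.trans (+-homo _ _) (S.+-cong (S.trans (*-homo _ _) (S.*-congʳ (*-homo t t))) (-‿homo R.1#))
  core-homo t (suc (suc (suc m))) = S.trans (*-homo _ _) (S.*-cong (core-homo t 2) (core-homo t m))

  module _ {p} (p-prime : Prime p) (p×1≈0 : p R.× R.1# R.≈ R.0#) l {m} (1+m≡q : suc m ≡ p ℕ.^ l) where

    -- Both sides are carried into R[ω], where P is triangularised. Equality there is componentwise,
    -- and its first component is the equality over R.
    det-characteristic : ∀ t → R.det (t R.⊙ R.I (suc m) R.⊖ R.pascal (suc m)) R.≈ R.core t m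
    det-characteristic t = proj₁ (begin
      embed (R.det (t R.⊙ R.I (suc m) R.⊖ R.pascal (suc m)))
        ≈⟨ det-homo (t R.⊙ R.I (suc m) R.⊖ R.pascal (suc m)) ⟩
      S.det (λ i j → embed (t R.* R.I (suc m) i j R.- R.pascal (suc m) i j))
        ≈⟨ S.det-cong entries ⟩
      S.det (embed t S.⊙ S.I (suc m) S.⊖ S.Sym S.ρ m)
        ≈⟨ CubeRootOfUnity.det-core R[ω] ω²+ω+1≈0 (embed t) m ⟩
      S.core (embed t) m
        ≈⟨ core-homo t m ⟨
      embed (R.core t m) ∎)
      where
      open PascalMatrices.PrimePower R[ω] p-prime (S.trans (S.sym (×-homo p R.1#)) (p×1≈0 , R.refl)) l 1+m≡q
      entries : ∀ i j → embed (t R.* R.I (suc m) i j R.- R.pascal (suc m) i j) S.≈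
                (embed t S.⊙ S.I (suc m) S.⊖ S.Sym S.ρ m) i j
      entries i j = S.trans (+-homo _ _) (S.+-cong
        (S.trans (*-homo _ _) (S.*-congˡ (I-homo i j)))
        (S.trans (-‿homo _) (S.-‿cong (S.trans (×-homo ((toℕ i ℕ.+ toℕ j) C toℕ i) R.1#) (S.sym (Sym-ρ i j))))))

-- Integers and integer polynomials modulo p.

module IntegersModulo (p : ℕ) where
  open import Data.Integer.Divisibility.Signed
    using (∣m∣n⇒∣m+n; ∣m⇒∣-m; ∣m⇒∣m*n; ∣n⇒∣m*n; ∣-refl)

  infix 4 _≈_
  -- A record and not the bare divisibility, so that unification recovers a and b, which the
  -- difference `a ℤ.- b` would not determine.
  record _≈_ (a b : ℤ) : Set where
    constructor congruent
    field
      p∣a-b : + p Signed.∣ a ℤ.- b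
  open _≈_ public

  reflexive : ∀ {a b} → a ≡ b → a ≈ b
  reflexive {a} ≡.refl = congruent (Signed.divides 0ℤ (ℤ.+-inverseʳ a))

  sym : ∀ {a b} → a ≈ b → b ≈ a
  sym {a} {b} a≈b = congruent (≡.subst (+ p Signed.∣_) (eq a b) (∣m⇒∣-m (p∣a-b a≈b)))
    where
    eq : ∀ a b → ℤ.- (a ℤ.- b) ≡ b ℤ.- a
    eq = solve-∀

  trans : ∀ {a b c} → a ≈ b → b ≈ c → a ≈ c
  trans {a} {b} {c} a≈b b≈c = congruent (≡.subst (+ p Signed.∣_) (eq a b c) (∣m∣n⇒∣m+n (p∣a-b a≈b) (p∣a-b b≈c)))
    where
    eq : ∀ a b c → a ℤ.- b ℤ.+ (b ℤ.- c) ≡ a ℤ.- c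
    eq = solve-∀

  +-cong : ∀ {a b c d} → a ≈ b → c ≈ d → a ℤ.+ c ≈ b ℤ.+ d
  +-cong {a} {b} {c} {d} a≈b c≈d = congruent (≡.subst (+ p Signed.∣_) (eq a b c d) (∣m∣n⇒∣m+n (p∣a-b a≈b) (p∣a-b c≈d)))
    where
    eq : ∀ a b c d → a ℤ.- b ℤ.+ (c ℤ.- d) ≡ a ℤ.+ c ℤ.- (b ℤ.+ d)
    eq = solve-∀

  *-cong : ∀ {a b c d} → a ≈ b → c ≈ d → a ℤ.* c ≈ b ℤ.* d
  *-cong {a} {b} {c} {d} a≈b c≈d = congruent (≡.subst (+ p Signed.∣_) (eq a b c d)
    (∣m∣n⇒∣m+n (∣m⇒∣m*n c (p∣a-b a≈b)) (∣n⇒∣m*n b (p∣a-b c≈d))))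
    where
    eq : ∀ a b c d → (a ℤ.- b) ℤ.* c ℤ.+ b ℤ.* (c ℤ.- d) ≡ a ℤ.* c ℤ.- b ℤ.* d
    eq = solve-∀

  neg-cong : ∀ {a b} → a ≈ b → ℤ.- a ≈ ℤ.- b
  neg-cong {a} {b} a≈b = congruent (≡.subst (+ p Signed.∣_) (eq a b) (∣m⇒∣-m (p∣a-b a≈b)))
    where
    eq : ∀ a b → ℤ.- (a ℤ.- b) ≡ ℤ.- a ℤ.- ℤ.- b
    eq = solve-∀

  p≈0 : + p ≈ 0ℤ
  p≈0 = congruent (≡.subst (+ p Signed.∣_) (≡.sym (ℤ.+-identityʳ (+ p))) ∣-refl)

module PolynomialsModulo (p : ℕ) where
  open import Defs using (ℤ[t]; coeff; _≈ᴾ_; _+ᴾ_; _*ᴾ_; ℤ[t]-rawRing)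
  open import Data.List.Base using ([]; _∷_; map)
  open ≡-Reasoning
  private module C = IntegersModulo p

  infix 4 _≈_
  record _≈_ (f g : ℤ[t]) : Set where
    constructor coefficientwise
    field
      at : ∀ i → coeff f i C.≈ coeff g i
  open _≈_ public

  coeff-+ : ∀ f g i → coeff (f +ᴾ g) i ≡ coeff f i ℤ.+ coeff g i
  coeff-+ []      g       i       = ≡.sym (ℤ.+-identityˡ _)
  coeff-+ (a ∷ f) []      i       = ≡.sym (ℤ.+-identityʳ _)
  coeff-+ (a ∷ f) (b ∷ g) zero    = ≡.refl
  coeff-+ (a ∷ f) (b ∷ g) (suc i) = coeff-+ f g i

  coeff-neg : ∀ f i → coeff (map (λ a → ℤ.- a) f) i ≡ ℤ.- coeff f i
  coeff-neg []      i       = ≡.refl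
  coeff-neg (a ∷ f) zero    = ≡.refl
  coeff-neg (a ∷ f) (suc i) = coeff-neg f i

  scale : ℤ → ℤ[t] → ℤ[t]
  scale a = map (a ℤ.*_)

  coeff-scale : ∀ a f i → coeff (scale a f) i ≡ a ℤ.* coeff f i
  coeff-scale a []      i       = ≡.sym (ℤ.*-zeroʳ a)
  coeff-scale a (b ∷ f) zero    = ≡.refl
  coeff-scale a (b ∷ f) (suc i) = coeff-scale a f i

  coeff-*-zero : ∀ a f g → coeff ((a ∷ f) *ᴾ g) 0 ≡ a ℤ.* coeff g 0
  coeff-*-zero a f g = ≡.trans (coeff-+ (scale a g) _ 0) (≡.trans (ℤ.+-identityʳ _) (coeff-scale a g 0))

  coeff-*-suc : ∀ a f g i → coeff ((a ∷ f) *ᴾ g) (suc i) ≡ a ℤ.* coeff g (suc i) ℤ.+ coeff (f *ᴾ g) i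
  coeff-*-suc a f g i = ≡.trans (coeff-+ (scale a g) _ (suc i)) (≡.cong (ℤ._+ coeff (f *ᴾ g) i) (coeff-scale a g (suc i)))

  lift : ∀ {f g} → f ≈ᴾ g → f ≈ g
  lift f≈g = coefficientwise λ i → C.reflexive (f≈g i)

  *-zeroʳ : ∀ f → f *ᴾ [] ≈ᴾ []
  *-zeroʳ []      i       = ≡.refl
  *-zeroʳ (a ∷ f) zero    = ≡.refl
  *-zeroʳ (a ∷ f) (suc i) = *-zeroʳ f i

  *-∷ʳ-zero : ∀ f b g → coeff (f *ᴾ (b ∷ g)) 0 ≡ b ℤ.* coeff f 0
  *-∷ʳ-zero []      b g = ≡.sym (ℤ.*-zeroʳ b)
  *-∷ʳ-zero (a ∷ f) b g = ≡.trans (coeff-*-zero a f (b ∷ g)) (ℤ.*-comm a b)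

  -- Multiplication recurses on its left factor; this is the same recursion on the right factor, and
  -- commutativity is the agreement of the two.
  *-∷ʳ-suc : ∀ f b g i → coeff (f *ᴾ (b ∷ g)) (suc i) ≡ b ℤ.* coeff f (suc i) ℤ.+ coeff (f *ᴾ g) i
  *-∷ʳ-suc []      b g i    = ≡.sym (≡.trans (ℤ.+-identityʳ _) (ℤ.*-zeroʳ b))
  *-∷ʳ-suc (a ∷ f) b g zero = begin
    coeff ((a ∷ f) *ᴾ (b ∷ g)) 1                   ≡⟨ coeff-*-suc a f (b ∷ g) 0 ⟩
    a ℤ.* coeff g 0 ℤ.+ coeff (f *ᴾ (b ∷ g)) 0     ≡⟨ ≡.cong (λ z → a ℤ.* coeff g 0 ℤ.+ z) (*-∷ʳ-zero f b g) ⟩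
    a ℤ.* coeff g 0 ℤ.+ b ℤ.* coeff f 0            ≡⟨ ℤ.+-comm (a ℤ.* coeff g 0) _ ⟩
    b ℤ.* coeff f 0 ℤ.+ a ℤ.* coeff g 0            ≡⟨ ≡.cong (λ z → b ℤ.* coeff f 0 ℤ.+ z) (coeff-*-zero a f g) ⟨
    b ℤ.* coeff f 0 ℤ.+ coeff ((a ∷ f) *ᴾ g) 0     ∎
  *-∷ʳ-suc (a ∷ f) b g (suc i) = begin
    coeff ((a ∷ f) *ᴾ (b ∷ g)) (suc (suc i))
      ≡⟨ coeff-*-suc a f (b ∷ g) (suc i) ⟩
    a ℤ.* coeff g (suc i) ℤ.+ coeff (f *ᴾ (b ∷ g)) (suc i)
      ≡⟨ ≡.cong (λ z → a ℤ.* coeff g (suc i) ℤ.+ z) (*-∷ʳ-suc f b g i) ⟩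
    a ℤ.* coeff g (suc i) ℤ.+ (b ℤ.* coeff f (suc i) ℤ.+ coeff (f *ᴾ g) i)
      ≡⟨ eq (a ℤ.* coeff g (suc i)) (b ℤ.* coeff f (suc i)) (coeff (f *ᴾ g) i) ⟩
    b ℤ.* coeff f (suc i) ℤ.+ (a ℤ.* coeff g (suc i) ℤ.+ coeff (f *ᴾ g) i)
      ≡⟨ ≡.cong (λ z → b ℤ.* coeff f (suc i) ℤ.+ z) (coeff-*-suc a f g i) ⟨
    b ℤ.* coeff f (suc i) ℤ.+ coeff ((a ∷ f) *ᴾ g) (suc i) ∎
    where
    eq : ∀ x y z → x ℤ.+ (y ℤ.+ z) ≡ y ℤ.+ (x ℤ.+ z)
    eq = solve-∀

  *-comm : ∀ f g → f *ᴾ g ≈ᴾ g *ᴾ f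
  *-comm []      g i       = ≡.sym (*-zeroʳ g i)
  *-comm (a ∷ f) g zero    = ≡.trans (coeff-*-zero a f g) (≡.sym (*-∷ʳ-zero g a f))
  *-comm (a ∷ f) g (suc i) = ≡.trans (coeff-*-suc a f g i)
    (≡.trans (≡.cong (λ z → a ℤ.* coeff g (suc i) ℤ.+ z) (*-comm f g i)) (≡.sym (*-∷ʳ-suc g a f i)))

  *-congˡ : ∀ f {g h} → g ≈ h → f *ᴾ g ≈ f *ᴾ h
  *-congˡ []      g≈h = lift λ _ → ≡.refl
  *-congˡ (a ∷ f) {g} {h} g≈h = coefficientwise λ
    { zero    → C.trans (C.reflexive (coeff-*-zero a f g)) (C.trans
                  (C.*-cong (C.reflexive {a} ≡.refl) (at g≈h 0)) (C.reflexive (≡.sym (coeff-*-zero a f h))))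
    ; (suc i) → C.trans (C.reflexive (coeff-*-suc a f g i)) (C.trans
                  (C.+-cong (C.*-cong (C.reflexive {a} ≡.refl) (at g≈h (suc i))) (at (*-congˡ f g≈h) i))
                  (C.reflexive (≡.sym (coeff-*-suc a f h i))))
    }

  *-distribʳ : ∀ h f g → (f +ᴾ g) *ᴾ h ≈ᴾ f *ᴾ h +ᴾ g *ᴾ h
  *-distribʳ h []      g       i = ≡.refl
  *-distribʳ h (a ∷ f) []      i = ≡.sym (≡.trans (coeff-+ ((a ∷ f) *ᴾ h) [] i) (ℤ.+-identityʳ _))
  *-distribʳ h (a ∷ f) (b ∷ g) zero = begin
    coeff ((a ℤ.+ b ∷ f +ᴾ g) *ᴾ h) 0                      ≡⟨ coeff-*-zero (a ℤ.+ b) (f +ᴾ g) h ⟩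
    (a ℤ.+ b) ℤ.* coeff h 0                                ≡⟨ ℤ.*-distribʳ-+ (coeff h 0) a b ⟩
    a ℤ.* coeff h 0 ℤ.+ b ℤ.* coeff h 0                    ≡⟨ ≡.cong₂ ℤ._+_ (coeff-*-zero a f h) (coeff-*-zero b g h) ⟨
    coeff ((a ∷ f) *ᴾ h) 0 ℤ.+ coeff ((b ∷ g) *ᴾ h) 0      ≡⟨ coeff-+ ((a ∷ f) *ᴾ h) _ 0 ⟨
    coeff ((a ∷ f) *ᴾ h +ᴾ (b ∷ g) *ᴾ h) 0                 ∎
  *-distribʳ h (a ∷ f) (b ∷ g) (suc i) = begin
    coeff ((a ℤ.+ b ∷ f +ᴾ g) *ᴾ h) (suc i)
      ≡⟨ coeff-*-suc (a ℤ.+ b) (f +ᴾ g) h i ⟩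
    (a ℤ.+ b) ℤ.* coeff h (suc i) ℤ.+ coeff ((f +ᴾ g) *ᴾ h) i
      ≡⟨ ≡.cong (λ z → (a ℤ.+ b) ℤ.* coeff h (suc i) ℤ.+ z) (≡.trans (*-distribʳ h f g i) (coeff-+ (f *ᴾ h) _ i)) ⟩
    (a ℤ.+ b) ℤ.* coeff h (suc i) ℤ.+ (coeff (f *ᴾ h) i ℤ.+ coeff (g *ᴾ h) i)
      ≡⟨ eq a b (coeff h (suc i)) (coeff (f *ᴾ h) i) (coeff (g *ᴾ h) i) ⟩
    (a ℤ.* coeff h (suc i) ℤ.+ coeff (f *ᴾ h) i) ℤ.+ (b ℤ.* coeff h (suc i) ℤ.+ coeff (g *ᴾ h) i)
      ≡⟨ ≡.cong₂ ℤ._+_ (coeff-*-suc a f h i) (coeff-*-suc b g h i) ⟨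
    coeff ((a ∷ f) *ᴾ h) (suc i) ℤ.+ coeff ((b ∷ g) *ᴾ h) (suc i)
      ≡⟨ coeff-+ ((a ∷ f) *ᴾ h) _ (suc i) ⟨
    coeff ((a ∷ f) *ᴾ h +ᴾ (b ∷ g) *ᴾ h) (suc i) ∎
    where
    eq : ∀ a b c x y → (a ℤ.+ b) ℤ.* c ℤ.+ (x ℤ.+ y) ≡ (a ℤ.* c ℤ.+ x) ℤ.+ (b ℤ.* c ℤ.+ y)
    eq = solve-∀

  scale-* : ∀ a f g → scale a f *ᴾ g ≈ᴾ scale a (f *ᴾ g)
  scale-* a []      g i       = ≡.refl
  scale-* a (b ∷ f) g zero    = begin
    coeff ((a ℤ.* b ∷ scale a f) *ᴾ g) 0     ≡⟨ coeff-*-zero (a ℤ.* b) (scale a f) g ⟩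
    a ℤ.* b ℤ.* coeff g 0                    ≡⟨ ℤ.*-assoc a b (coeff g 0) ⟩
    a ℤ.* (b ℤ.* coeff g 0)                  ≡⟨ ≡.cong (a ℤ.*_) (coeff-*-zero b f g) ⟨
    a ℤ.* coeff ((b ∷ f) *ᴾ g) 0             ≡⟨ coeff-scale a ((b ∷ f) *ᴾ g) 0 ⟨
    coeff (scale a ((b ∷ f) *ᴾ g)) 0         ∎
  scale-* a (b ∷ f) g (suc i) = begin
    coeff ((a ℤ.* b ∷ scale a f) *ᴾ g) (suc i)
      ≡⟨ coeff-*-suc (a ℤ.* b) (scale a f) g i ⟩
    a ℤ.* b ℤ.* coeff g (suc i) ℤ.+ coeff (scale a f *ᴾ g) i
      ≡⟨ ≡.cong (λ z → a ℤ.* b ℤ.* coeff g (suc i) ℤ.+ z) (≡.trans (scale-* a f g i) (coeff-scale a (f *ᴾ g) i)) ⟩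
    a ℤ.* b ℤ.* coeff g (suc i) ℤ.+ a ℤ.* coeff (f *ᴾ g) i
      ≡⟨ eq a b (coeff g (suc i)) (coeff (f *ᴾ g) i) ⟩
    a ℤ.* (b ℤ.* coeff g (suc i) ℤ.+ coeff (f *ᴾ g) i)
      ≡⟨ ≡.cong (a ℤ.*_) (coeff-*-suc b f g i) ⟨
    a ℤ.* coeff ((b ∷ f) *ᴾ g) (suc i)
      ≡⟨ coeff-scale a ((b ∷ f) *ᴾ g) (suc i) ⟨
    coeff (scale a ((b ∷ f) *ᴾ g)) (suc i) ∎
    where
    eq : ∀ a b x y → a ℤ.* b ℤ.* x ℤ.+ a ℤ.* y ≡ a ℤ.* (b ℤ.* x ℤ.+ y)
    eq = solve-∀

  shift-* : ∀ f g → (0ℤ ∷ f) *ᴾ g ≈ᴾ 0ℤ ∷ f *ᴾ g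
  shift-* f g zero    = coeff-*-zero 0ℤ f g
  shift-* f g (suc i) = ≡.trans (coeff-*-suc 0ℤ f g i) (ℤ.+-identityˡ _)

  *-assoc : ∀ f g h → (f *ᴾ g) *ᴾ h ≈ᴾ f *ᴾ (g *ᴾ h)
  *-assoc []      g h i = ≡.refl
  *-assoc (a ∷ f) g h i = begin
    coeff ((scale a g +ᴾ (0ℤ ∷ f *ᴾ g)) *ᴾ h) i
      ≡⟨ *-distribʳ h (scale a g) (0ℤ ∷ f *ᴾ g) i ⟩
    coeff (scale a g *ᴾ h +ᴾ (0ℤ ∷ f *ᴾ g) *ᴾ h) i
      ≡⟨ coeff-+ (scale a g *ᴾ h) _ i ⟩
    coeff (scale a g *ᴾ h) i ℤ.+ coeff ((0ℤ ∷ f *ᴾ g) *ᴾ h) i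
      ≡⟨ ≡.cong₂ ℤ._+_ (scale-* a g h i) (≡.trans (shift-* (f *ᴾ g) h i) (∷-assoc i)) ⟩
    coeff (scale a (g *ᴾ h)) i ℤ.+ coeff (0ℤ ∷ f *ᴾ (g *ᴾ h)) i
      ≡⟨ coeff-+ (scale a (g *ᴾ h)) _ i ⟨
    coeff ((a ∷ f) *ᴾ (g *ᴾ h)) i ∎
    where
    ∷-assoc : ∀ i → coeff (0ℤ ∷ (f *ᴾ g) *ᴾ h) i ≡ coeff (0ℤ ∷ f *ᴾ (g *ᴾ h)) i
    ∷-assoc zero    = ≡.refl
    ∷-assoc (suc i) = *-assoc f g h i

  *-identityˡ : ∀ f → (1ℤ ∷ []) *ᴾ f ≈ᴾ f
  *-identityˡ f zero    = ≡.trans (coeff-*-zero 1ℤ [] f) (ℤ.*-identityˡ _)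
  *-identityˡ f (suc i) = ≡.trans (coeff-*-suc 1ℤ [] f i) (≡.trans (ℤ.+-identityʳ _) (ℤ.*-identityˡ _))

  ≈-refl : ∀ {f} → f ≈ f
  ≈-refl = lift λ _ → ≡.refl

  ≈-sym : ∀ {f g} → f ≈ g → g ≈ f
  ≈-sym f≈g = coefficientwise λ i → C.sym (at f≈g i)

  ≈-trans : ∀ {f g h} → f ≈ g → g ≈ h → f ≈ h
  ≈-trans f≈g g≈h = coefficientwise λ i → C.trans (at f≈g i) (at g≈h i)

  ≈-+-cong : ∀ {f f′ g g′} → f ≈ f′ → g ≈ g′ → f +ᴾ g ≈ f′ +ᴾ g′
  ≈-+-cong {f} {f′} {g} {g′} f≈ g≈ = coefficientwise λ i → C.trans (C.reflexive (coeff-+ f g i))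
    (C.trans (C.+-cong (at f≈ i) (at g≈ i)) (C.reflexive (≡.sym (coeff-+ f′ g′ i))))

  -ᴾ_ : ℤ[t] → ℤ[t]
  -ᴾ f = map (λ a → ℤ.- a) f

  ≈-neg-cong : ∀ {f g} → f ≈ g → -ᴾ f ≈ -ᴾ g
  ≈-neg-cong {f} {g} f≈g = coefficientwise λ i → C.trans (C.reflexive (coeff-neg f i))
    (C.trans (C.neg-cong (at f≈g i)) (C.reflexive (≡.sym (coeff-neg g i))))

  +-assoc : ∀ f g h → (f +ᴾ g) +ᴾ h ≈ᴾ f +ᴾ (g +ᴾ h)
  +-assoc f g h i = begin
    coeff (f +ᴾ g +ᴾ h) i                          ≡⟨ coeff-+ (f +ᴾ g) h i ⟩
    coeff (f +ᴾ g) i ℤ.+ coeff h i                 ≡⟨ ≡.cong (ℤ._+ coeff h i) (coeff-+ f g i) ⟩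
    coeff f i ℤ.+ coeff g i ℤ.+ coeff h i          ≡⟨ ℤ.+-assoc (coeff f i) (coeff g i) (coeff h i) ⟩
    coeff f i ℤ.+ (coeff g i ℤ.+ coeff h i)        ≡⟨ ≡.cong (λ z → coeff f i ℤ.+ z) (coeff-+ g h i) ⟨
    coeff f i ℤ.+ coeff (g +ᴾ h) i                 ≡⟨ coeff-+ f (g +ᴾ h) i ⟨
    coeff (f +ᴾ (g +ᴾ h)) i                        ∎

  +-comm : ∀ f g → f +ᴾ g ≈ᴾ g +ᴾ f
  +-comm f g i = ≡.trans (coeff-+ f g i) (≡.trans (ℤ.+-comm (coeff f i) (coeff g i)) (≡.sym (coeff-+ g f i)))

  +-identityʳ : ∀ f → f +ᴾ [] ≈ᴾ f
  +-identityʳ f i = ≡.trans (coeff-+ f [] i) (ℤ.+-identityʳ _)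

  +-inverseˡ : ∀ f → -ᴾ f +ᴾ f ≈ᴾ []
  +-inverseˡ f i = ≡.trans (coeff-+ (-ᴾ f) f i)
    (≡.trans (≡.cong (ℤ._+ coeff f i) (coeff-neg f i)) (ℤ.+-inverseˡ (coeff f i)))

  ≈-*-comm : ∀ f g → f *ᴾ g ≈ g *ᴾ f
  ≈-*-comm f g = lift (*-comm f g)

  ≈-*-identityˡ : ∀ f → (1ℤ ∷ []) *ᴾ f ≈ f
  ≈-*-identityˡ f = lift (*-identityˡ f)

  ≈-*-distribʳ : ∀ h f g → (f +ᴾ g) *ᴾ h ≈ f *ᴾ h +ᴾ g *ᴾ h
  ≈-*-distribʳ h f g = lift (*-distribʳ h f g)

  ≈-+-comm : ∀ f g → f +ᴾ g ≈ g +ᴾ f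
  ≈-+-comm f g = lift (+-comm f g)

  ≈-+-inverseˡ : ∀ f → -ᴾ f +ᴾ f ≈ []
  ≈-+-inverseˡ f = lift (+-inverseˡ f)

  -- No quotient is formed: carrier and operations are those of integer polynomials and only the
  -- equality is coarser, so the reduction map is the identity function.
  ℤ[t]/p : CommutativeRing 0ℓ 0ℓ
  ℤ[t]/p = record
    { Carrier = ℤ[t]
    ; _≈_     = _≈_
    ; _+_     = _+ᴾ_
    ; _*_     = _*ᴾ_
    ; -_      = -ᴾ_
    ; 0#      = []
    ; 1#      = 1ℤ ∷ []
    ; isCommutativeRing = record
      { isRing = record
        { +-isAbelianGroup = record
          { isGroup = record
            { isMonoid = record
              { isSemigroup = record
                { isMagma = record
                  { isEquivalence = record { refl = ≈-refl ; sym = ≈-sym ; trans = ≈-trans }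
                  ; ∙-cong        = ≈-+-cong
                  }
                ; assoc = λ f g h → lift (+-assoc f g h)
                }
              ; identity = (λ f → ≈-refl) , (λ f → lift (+-identityʳ f))
              }
            ; inverse = (λ f → (≈-+-inverseˡ f)) ,
                        (λ f → ≈-trans ((≈-+-comm f (-ᴾ f))) ((≈-+-inverseˡ f)))
            ; ⁻¹-cong = ≈-neg-cong
            }
          ; comm = λ f g → (≈-+-comm f g)
          }
        ; *-cong = λ {f} {f′} {g} {g′} f≈ g≈ → ≈-trans (*-congˡ f g≈)
            (≈-trans ((≈-*-comm f g′)) (≈-trans (*-congˡ g′ f≈) ((≈-*-comm g′ f′))))
        ; *-assoc = λ f g h → lift (*-assoc f g h)
        ; *-identity = (λ f → (≈-*-identityˡ f)) ,
                       (λ f → ≈-trans ((≈-*-comm f (1ℤ ∷ []))) ((≈-*-identityˡ f)))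
        ; distrib = (λ f g h → ≈-trans ((≈-*-comm f (g +ᴾ h))) (≈-trans ((≈-*-distribʳ f g h))
                      (≈-+-cong ((≈-*-comm g f)) ((≈-*-comm h f))))) ,
                    (λ h f g → (≈-*-distribʳ h f g))
        }
      ; *-comm = λ f g → (≈-*-comm f g)
      }
    }

  open MorphismStructures.RingMorphisms ℤ[t]-rawRing (CommutativeRing.rawRing ℤ[t]/p) using (IsRingHomomorphism)

  reduction-isHomomorphism : IsRingHomomorphism (λ f → f)
  reduction-isHomomorphism = record
    { isSemiringHomomorphism = record
      { isNearSemiringHomomorphism = record
        { +-isMonoidHomomorphism = record
          { isMagmaHomomorphism = record
            { isRelHomomorphism = record { cong = lift }
            ; homo              = λ f g → ≈-refl
            }
          ; ε-homo = ≈-refl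
          }
        ; *-homo = λ f g → ≈-refl
        }
      ; 1#-homo = ≈-refl
      }
    ; -‿homo = λ f → ≈-refl
    }

  open Multiplication (CommutativeRing.semiring ℤ[t]/p) using (_×_)

  constant-× : ∀ n → (+ n ∷ []) ≈ n × (1ℤ ∷ [])
  constant-× zero    = lift λ { zero → ≡.refl ; (suc i) → ≡.refl }
  constant-× (suc n) = ≈-+-cong {1ℤ ∷ []} ≈-refl (constant-× n)

  p×1≈0 : p × (1ℤ ∷ []) ≈ []
  p×1≈0 = ≈-trans (≈-sym (constant-× p)) (coefficientwise λ { zero → C.p≈0 ; (suc i) → C.reflexive ≡.refl })

  -- A polynomial with constant coefficient ± 1 is invertible as a power series.
  *-unit-0 : ∀ {u} f → u ℤ.* u ≡ 1ℤ → ∀ h → h *ᴾ (u ∷ f) ≈ [] → h ≈ []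
  *-unit-0 {u} f u²≡1 []      _   = ≈-refl
  *-unit-0 {u} f u²≡1 (c ∷ h) h≈0 = coefficientwise λ { zero → c≈0 ; (suc i) → at (*-unit-0 f u²≡1 h tail≈0) i }
    where
    -- c = (c u) u, and c u is the constant coefficient of the product.
    c≈0 : c C.≈ 0ℤ
    c≈0 = C.trans (C.reflexive (≡.trans (≡.sym (ℤ.*-identityʳ c))
        (≡.trans (≡.cong (c ℤ.*_) (≡.sym u²≡1)) (≡.sym (ℤ.*-assoc c u u)))))
      (C.*-cong {d = u} (C.trans (C.reflexive (≡.sym (coeff-*-zero c h (u ∷ f)))) (at h≈0 0)) (C.reflexive ≡.refl))
    tail≈0 : h *ᴾ (u ∷ f) ≈ []
    tail≈0 = coefficientwise λ i → C.trans (C.sym (C.trans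
      (C.+-cong (C.*-cong {d = coeff f i} c≈0 (C.reflexive ≡.refl)) (C.reflexive ≡.refl))
      (C.reflexive (ℤ.+-identityˡ _))))
      (C.trans (C.reflexive (≡.sym (coeff-*-suc c h (u ∷ f) i))) (at h≈0 (suc i)))

-- Powers with exponents of either sign.

module Exponents {r ℓ} (R : CommutativeRing r ℓ) where
  open CommutativeRing R hiding (zero)
  open RingProperties ring using (x[y-z]≈xy-xz; x≈y⇒x∙y⁻¹≈ε; x∙y⁻¹≈ε⇒x≈y)
  open CommutativeExponentiation commutativeSemiring
  open CoreFactor R
  open IntegerSolver R using (solve; _:+_; _:*_; _:-_; :-_; _:=_; con)
  open SetoidReasoning setoid

  NonZeroDivisor : Carrier → Set _
  NonZeroDivisor f = ∀ {x} → f * x ≈ 0# → x ≈ 0#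

  cancel-^ : ∀ {f} → NonZeroDivisor f → ∀ n {x y} → f ^ n * x ≈ f ^ n * y → x ≈ y
  cancel-^ {f} f≉0 n {x} {y} eq = x∙y⁻¹≈ε⇒x≈y x y (power n (trans (x[y-z]≈xy-xz (f ^ n) x y) (x≈y⇒x∙y⁻¹≈ε eq)))
    where
    power : ∀ n {x} → f ^ n * x ≈ 0# → x ≈ 0#
    power zero    eq = trans (sym (*-identityˡ _)) eq
    power (suc n) eq = power n (f≉0 (trans (sym (*-assoc _ _ _)) eq))

  ^-⊓ : ∀ x m n → x ^ n ≈ x ^ (m ℕ.⊓ n) * x ^ (n ∸ m)
  ^-⊓ x m n = trans (^-congʳ x (≡.sym (ℕ.m⊓n+n∸m≡n m n))) (^-homo-* x (m ℕ.⊓ n) (n ∸ m))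

  -- f^(a-k) is the fraction f^(a ∸ k) / f^(k ∸ a), and likewise for g. Multiplied by f^min(a, k)
  -- and g^min(b, k), the claim becomes z y ≈ x (f g)^k, and these powers can be cancelled.
  balance : ∀ {f g} → NonZeroDivisor f → NonZeroDivisor g → ∀ a b k {x y z} →
    z ≈ f ^ a * g ^ b → z * y ≈ x * (f * g) ^ k →
    x * (f ^ (k ∸ a) * g ^ (k ∸ b)) ≈ f ^ (a ∸ k) * g ^ (b ∸ k) * y
  balance {f} {g} f≉0 g≉0 a b k {x} {y} {z} z≈ zy≈ = cancel-^ f≉0 (a ℕ.⊓ k) (cancel-^ g≉0 (b ℕ.⊓ k) (begin
    g ^ (b ℕ.⊓ k) * (f ^ (a ℕ.⊓ k) * (x * (f ^ (k ∸ a) * g ^ (k ∸ b))))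
      ≈⟨ solve 5 (λ G F x F′ G′ → G :* (F :* (x :* (F′ :* G′))) := x :* (F :* F′ :* (G :* G′))) refl
           (g ^ (b ℕ.⊓ k)) (f ^ (a ℕ.⊓ k)) x (f ^ (k ∸ a)) (g ^ (k ∸ b)) ⟩
    x * (f ^ (a ℕ.⊓ k) * f ^ (k ∸ a) * (g ^ (b ℕ.⊓ k) * g ^ (k ∸ b)))
      ≈⟨ *-congˡ (*-cong (^-⊓ f a k) (^-⊓ g b k)) ⟨
    x * (f ^ k * g ^ k)
      ≈⟨ *-congˡ (^-distrib-* f g k) ⟨
    x * (f * g) ^ k
      ≈⟨ zy≈ ⟨
    z * y
      ≈⟨ *-congʳ (trans z≈ (*-cong (^-⊓′ f a) (^-⊓′ g b))) ⟩
    f ^ (a ℕ.⊓ k) * f ^ (a ∸ k) * (g ^ (b ℕ.⊓ k) * g ^ (b ∸ k)) * y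
      ≈⟨ solve 5 (λ G F y F′ G′ → F :* F′ :* (G :* G′) :* y := G :* (F :* (F′ :* G′ :* y))) refl
           (g ^ (b ℕ.⊓ k)) (f ^ (a ℕ.⊓ k)) y (f ^ (a ∸ k)) (g ^ (b ∸ k)) ⟩
    g ^ (b ℕ.⊓ k) * (f ^ (a ℕ.⊓ k) * (f ^ (a ∸ k) * g ^ (b ∸ k) * y)) ∎))
    where
    ^-⊓′ : ∀ x a → x ^ a ≈ x ^ (a ℕ.⊓ k) * x ^ (a ∸ k)
    ^-⊓′ x a = trans (^-⊓ x k a) (*-congʳ (^-congʳ x (ℕ.⊓-comm k a)))

  factors : ∀ t → t * t * t - 1# ≈ (t ^ 2 + t + 1#) * (t - 1#)
  factors = solve 1 (λ t → t :* t :* t :- con (+ 1) := (t :* (t :* con (+ 1)) :+ t :+ con (+ 1)) :* (t :- con (+ 1))) refl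

  module _ (t : Carrier) where
    private
      f = t ^ 2 + t + 1#
      g = t - 1#

    -- Every step of 3 contributes one factor t³ - 1 = f g. The recurrence of `core` computes for
    -- each of r = 0, 1, 2 but not for a variable r, hence the hypothesis on s.
    core-powers : ∀ {r a b} → core t r ≈ f ^ a * g ^ b →
      (∀ s → core t (r ℕ.+ suc s ℕ.* 3) ≡ (t * t * t - 1#) * core t (r ℕ.+ s ℕ.* 3)) →
      ∀ s → core t (r ℕ.+ s ℕ.* 3) ≈ f ^ (s ℕ.+ a) * g ^ (s ℕ.+ b)
    core-powers {r} core-r step zero    = trans (reflexive (≡.cong (core t) (ℕ.+-identityʳ r))) core-r
    core-powers {r} {a} {b} core-r step (suc s) = begin
      core t (r ℕ.+ suc s ℕ.* 3)
        ≡⟨ step s ⟩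
      (t * t * t - 1#) * core t (r ℕ.+ s ℕ.* 3)
        ≈⟨ *-cong (factors t) (core-powers {r} {a} {b} core-r step s) ⟩
      f * g * (f ^ (s ℕ.+ a) * g ^ (s ℕ.+ b))
        ≈⟨ solve 4 (λ f g x y → f :* g :* (x :* y) := f :* x :* (g :* y)) refl f g _ _ ⟩
      f * f ^ (s ℕ.+ a) * (g * g ^ (s ℕ.+ b)) ∎

    core₀ : core t 0 ≈ f ^ 0 * g ^ 1
    core₀ = solve 1 (λ g → g := con (+ 1) :* (g :* con (+ 1))) refl g

    core₁ : core t 1 ≈ f ^ 1 * g ^ 0
    core₁ = solve 1 (λ t → t :* t :+ t :+ con (+ 1) :=
      (t :* (t :* con (+ 1)) :+ t :+ con (+ 1)) :* con (+ 1) :* con (+ 1)) refl t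

    core₂ : core t 2 ≈ f ^ 1 * g ^ 1
    core₂ = trans (factors t) (solve 2 (λ f g → f :* g := f :* con (+ 1) :* (g :* con (+ 1))) refl f g)


-- The exponents by the residue of q modulo 3.

open import Defs

-- The exponents of t² + t + 1 and of t - 1 in `core t r` for r = 0, 1, 2. For q = r + 1 + 3 s both
-- grow by s.
exponent₁ exponent₂ : Fin 3 → ℕ
exponent₁ 0F = 0
exponent₁ 1F = 1
exponent₁ 2F = 1
exponent₂ 0F = 1
exponent₂ 1F = 0
exponent₂ 2F = 1

ε-0 : ∀ q → q ℕ.% 3 ≡ 0 → ε q ≡ 0ℤ
ε-0 q eq with q ℕ.% 3 | eq
... | 0 | ≡.refl = ≡.refl

ε-1 : ∀ q → q ℕ.% 3 ≡ 1 → ε q ≡ 1ℤ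
ε-1 q eq with q ℕ.% 3 | eq
... | 1 | ≡.refl = ≡.refl

ε-2 : ∀ q → q ℕ.% 3 ≡ 2 → ε q ≡ -1ℤ
ε-2 q eq with q ℕ.% 3 | eq
... | 2 | ≡.refl = ≡.refl

/3-exact : ∀ {i} s → i ≡ + (s ℕ.* 3) → i ℤ./ + 3 ≡ + s
/3-exact s ≡.refl = ≡.trans (ℤ.*-identityˡ _) (≡.cong +_ (m*n/n≡m s 3))

-- The residue of q is that of r + 1, so ε(q) is 1, -1, 0 for r = 0, 1, 2, and q - ε(q) is 3 s, 3 s
-- + 3, 3 s + 3.
quotient₁ : ∀ r s → let q = suc (toℕ r ℕ.+ s ℕ.* 3) in (+ q ℤ.- ε q) ℤ./ + 3 ≡ + (s ℕ.+ exponent₁ r)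
quotient₁ 0F s = ≡.trans
  (/3-exact s (≡.cong (λ e → + suc (s ℕ.* 3) ℤ.- e) (ε-1 (1 ℕ.+ s ℕ.* 3) ([m+kn]%n≡m%n 1 s 3))))
  (≡.cong +_ (≡.sym (ℕ.+-identityʳ s)))
quotient₁ 1F s = ≡.trans
  (/3-exact (suc s) (≡.trans (≡.cong (λ e → + suc (suc (s ℕ.* 3)) ℤ.- e) (ε-2 (2 ℕ.+ s ℕ.* 3) ([m+kn]%n≡m%n 2 s 3)))
    (≡.cong +_ (ℕ.+-comm (suc (suc (s ℕ.* 3))) 1))))
  (≡.cong +_ (ℕ.+-comm 1 s))
quotient₁ 2F s = ≡.trans
  (/3-exact (suc s) (≡.trans (≡.cong (λ e → + suc (suc (suc (s ℕ.* 3))) ℤ.- e) (ε-0 (3 ℕ.+ s ℕ.* 3) ([m+kn]%n≡m%n 3 s 3)))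
    (≡.cong +_ (ℕ.+-identityʳ _))))
  (≡.cong +_ (ℕ.+-comm 1 s))

quotient₂ : ∀ r s → let q = suc (toℕ r ℕ.+ s ℕ.* 3) in (+ q ℤ.+ + 2 ℤ.* ε q) ℤ./ + 3 ≡ + (s ℕ.+ exponent₂ r)
quotient₂ 0F s = ≡.trans
  (/3-exact (suc s) (≡.trans (≡.cong (λ e → + suc (s ℕ.* 3) ℤ.+ + 2 ℤ.* e) (ε-1 (1 ℕ.+ s ℕ.* 3) ([m+kn]%n≡m%n 1 s 3)))
    (≡.cong +_ (ℕ.+-comm (suc (s ℕ.* 3)) 2))))
  (≡.cong +_ (ℕ.+-comm 1 s))
quotient₂ 1F s = ≡.trans
  (/3-exact s (≡.cong (λ e → + suc (suc (s ℕ.* 3)) ℤ.+ + 2 ℤ.* e) (ε-2 (2 ℕ.+ s ℕ.* 3) ([m+kn]%n≡m%n 2 s 3))))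
  (≡.cong +_ (≡.sym (ℕ.+-identityʳ s)))
quotient₂ 2F s = ≡.trans
  (/3-exact (suc s) (≡.trans (≡.cong (λ e → + suc (suc (suc (s ℕ.* 3))) ℤ.+ + 2 ℤ.* e) (ε-0 (3 ℕ.+ s ℕ.* 3) ([m+kn]%n≡m%n 3 s 3)))
    (≡.cong +_ (ℕ.+-identityʳ _))))
  (≡.cong +_ (ℕ.+-comm 1 s))

-- Truncated subtraction is the positive part of the difference; this links integer exponents to the
-- form in which `balance` is stated.
^⁺-⊖ : ∀ f m n → f ^⁺ (m ℤ.⊖ n) ≡ f ^ (m ∸ n)
^⁺-⊖ f zero    zero    = ≡.refl
^⁺-⊖ f zero    (suc n) = ≡.refl
^⁺-⊖ f (suc m) zero    = ≡.refl
^⁺-⊖ f (suc m) (suc n) = ≡.trans (≡.cong (f ^⁺_) (ℤ.[1+m]⊖[1+n]≡m⊖n m n)) (^⁺-⊖ f m n)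

^⁻-⊖ : ∀ f m n → f ^⁻ (m ℤ.⊖ n) ≡ f ^ (n ∸ m)
^⁻-⊖ f zero    zero    = ≡.refl
^⁻-⊖ f zero    (suc n) = ≡.refl
^⁻-⊖ f (suc m) zero    = ≡.refl
^⁻-⊖ f (suc m) (suc n) = ≡.trans (≡.cong (f ^⁻_) (ℤ.[1+m]⊖[1+n]≡m⊖n m n)) (^⁻-⊖ f m n)

-- The congruence in the ring of polynomials modulo p.

module ModuloPrime {p} (p-prime : Prime p) where
  open import Data.List.Base using ([]; _∷_; drop)
  open PolynomialsModulo p using (ℤ[t]/p; reduction-isHomomorphism; constant-×; p×1≈0; *-unit-0)
  private
    module R where
      open CommutativeRing ℤ[t]/p public
      open CommutativeExponentiation commutativeSemiring public using (_^_; ^-congˡ)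
      open Determinant ℤ[t]/p public
      open PascalMatrices ℤ[t]/p public
      open CoreFactor ℤ[t]/p public
  open RingHomomorphism ℤ[t]-rawRing ℤ[t]/p reduction-isHomomorphism
  open Exponents ℤ[t]/p

  χ-characteristic : ∀ n → χ n R.≈ R.det (t R.⊙ R.I n R.⊖ R.pascal n)
  χ-characteristic n = R.trans (det-homo (t ⊙ I n ⊖ P n)) (R.det-cong λ i j →
    R.+-cong {t * I n i j} (R.*-congˡ {t} (I-homo i j)) (R.-‿cong (constant-× ((toℕ i ℕ.+ toℕ j) C toℕ i))))

  det-t²+P : ∀ k → det (t ^ 2 ⊙ I k ⊕ P k) R.≈ R.det (t R.^ 2 R.⊙ R.I k R.⊕ R.pascal k)
  det-t²+P k = R.trans (det-homo (t ^ 2 ⊙ I k ⊕ P k)) (R.det-cong λ i j →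
    R.+-cong {t ^ 2 * I k i j} (R.*-congˡ {t ^ 2} (I-homo i j)) (constant-× ((toℕ i ℕ.+ toℕ j) C toℕ i)))

  nonZeroDivisor : ∀ u f → u ℤ.* u ≡ 1ℤ → NonZeroDivisor (u ∷ f)
  nonZeroDivisor u f u²≡1 {h} eq = *-unit-0 f u²≡1 h (R.trans (R.*-comm h (u ∷ f)) eq)

  core-factor : ∀ (r : Fin 3) s → R.core t (toℕ r ℕ.+ s ℕ.* 3) R.≈
    (t R.^ 2 R.+ t R.+ R.1#) R.^ (s ℕ.+ exponent₁ r) R.* (t R.- R.1#) R.^ (s ℕ.+ exponent₂ r)
  core-factor 0F = core-powers t {0} {0} {1} (core₀ t) (λ s → ≡.refl)
  core-factor 1F = core-powers t {1} {1} {0} (core₁ t) (λ s → ≡.refl)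
  core-factor 2F = core-powers t {2} {1} {1} (core₂ t) (λ s → ≡.refl)

  private
    f g : ℤ[t]
    f = t ^ 2 + t + 1#
    g = t + (- 1#)

  -- f evaluates to a list with head 1 and g to one with head -1, so `drop 1` yields the remaining
  -- coefficients.
  f-nonZeroDivisor : NonZeroDivisor f
  f-nonZeroDivisor = nonZeroDivisor 1ℤ (drop 1 f) ≡.refl

  g-nonZeroDivisor : NonZeroDivisor g
  g-nonZeroDivisor = nonZeroDivisor -1ℤ (drop 1 g) ≡.refl

  power-⁺ : ∀ h {e} a k → e ≡ + a → h ^⁺ (e ℤ.- + k) R.≈ h R.^ (a ∸ k)
  power-⁺ h a k ≡.refl = R.trans
    (R.reflexive (≡.trans (≡.cong (h ^⁺_) (ℤ.m-n≡m⊖n a k)) (^⁺-⊖ h a k))) (^-homo h (a ∸ k))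

  power-⁻ : ∀ h {e} a k → e ≡ + a → h ^⁻ (e ℤ.- + k) R.≈ h R.^ (k ∸ a)
  power-⁻ h a k ≡.refl = R.trans
    (R.reflexive (≡.trans (≡.cong (h ^⁻_) (ℤ.m-n≡m⊖n a k)) (^⁻-⊖ h a k))) (^-homo h (k ∸ a))

  congruence : ∀ {m} l k → suc m ≡ p ℕ.^ l → 2 ℕ.* k ≤ suc m → let q = suc m in
    χ (q ∸ k) * (f ^⁻ e₁ q k * g ^⁻ e₂ q k) R.≈ f ^⁺ e₁ q k * g ^⁺ e₂ q k * det (t ^ 2 ⊙ I k ⊕ P k)
  congruence {m} l k q≡pˡ 2k≤q with m divMod 3
  -- It is m, the degree of the forms, that is divided by 3, so r is the residue of q - 1.
  ... | result s r ≡.refl = begin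
    χ (q ∸ k) * (f ^⁻ e₁ q k * g ^⁻ e₂ q k)
      ≈⟨ R.*-cong (χ-characteristic (q ∸ k))
           (R.*-cong (power-⁻ f a k (quotient₁ r s)) (power-⁻ g b k (quotient₂ r s))) ⟩
    x R.* (f R.^ (k ∸ a) R.* g R.^ (k ∸ b))
      ≈⟨ balance {f} {g} f-nonZeroDivisor g-nonZeroDivisor a b k {x} {y} {R.core t (toℕ r ℕ.+ s ℕ.* 3)}
           (core-factor r s) core-y ⟩
    f R.^ (a ∸ k) R.* g R.^ (b ∸ k) R.* y
      ≈⟨ R.*-cong (R.*-cong (power-⁺ f a k (quotient₁ r s)) (power-⁺ g b k (quotient₂ r s))) (det-t²+P k) ⟨
    f ^⁺ e₁ q k * g ^⁺ e₂ q k * det (t ^ 2 ⊙ I k ⊕ P k) ∎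
    where
    open SetoidReasoning R.setoid
    q a b : ℕ
    q = suc (toℕ r ℕ.+ s ℕ.* 3)
    a = s ℕ.+ exponent₁ r
    b = s ℕ.+ exponent₂ r
    x y : ℤ[t]
    x = R.det (t R.⊙ R.I (q ∸ k) R.⊖ R.pascal (q ∸ k))
    y = R.det (t R.^ 2 R.⊙ R.I k R.⊕ R.pascal k)
    k+k≤q : k ℕ.+ k ≤ q
    k+k≤q = ≡.subst (_≤ q) (≡.cong (k ℕ.+_) (ℕ.+-identityʳ k)) 2k≤q
    -- The product for m is the characteristic polynomial of P(q), and Jacobi's identity trades it
    -- for that of P(q - k).
    core-y : R.core t (toℕ r ℕ.+ s ℕ.* 3) R.* y R.≈ x R.* (f R.* g) R.^ k
    core-y = begin
      R.core t (toℕ r ℕ.+ s ℕ.* 3) R.* y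
        ≈⟨ R.*-congʳ (CharacteristicPolynomial.det-characteristic ℤ[t]/p p-prime p×1≈0 l q≡pˡ t) ⟨
      R.det (t R.⊙ R.I q R.⊖ R.pascal q) R.* y
        ≈⟨ ComplementaryMinors.Complement.complement ℤ[t]/p t p-prime p×1≈0 l q≡pˡ (q ∸ k) k
             (ℕ.m∸n+n≡m (ℕ.≤-trans (ℕ.m≤m+n k k) k+k≤q)) (ℕ.m+n≤o⇒m≤o∸n k k+k≤q) ⟩
      x R.* (t R.* t R.* t R.- R.1#) R.^ k
        ≈⟨ R.*-congˡ {x} (R.^-congˡ k (factors t)) ⟩
      x R.* (f R.* g) R.^ k ∎

theorem1p3 : (p l k : ℕ) → Prime p → 2 ℕ.* k ≤ p ℕ.^ l →
    let q = p ℕ.^ l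
        f = t ^ 2 + t + 1#
        g = t + (- 1#)
    in χ (q ∸ k) * (f ^⁻ e₁ q k * g ^⁻ e₂ q k)
         ≡ f ^⁺ e₁ q k * g ^⁺ e₂ q k * det (t ^ 2 ⊙ I k ⊕ P k)
         [mod p ]
-- `congruence` takes q in the form m + 1; p^l has this form because a prime is nonzero.
theorem1p3 p l k p-prime 2k≤q = ≡.subst Congruence (ℕ.suc-pred (p ℕ.^ l)) λ i →
  ∣⇒∣ᵤ (p∣a-b (at (congruence l k (ℕ.suc-pred (p ℕ.^ l)) (≡.subst (2 ℕ.* k ≤_) (≡.sym (ℕ.suc-pred (p ℕ.^ l))) 2k≤q)) i))
  where
  open ModuloPrime p-prime
  open IntegersModulo p using (p∣a-b)
  open PolynomialsModulo p using (at)
  instance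
    p^l≢0 : ℕ.NonZero (p ℕ.^ l)
    p^l≢0 = ℕ.m^n≢0 p l {{prime⇒nonZero p-prime}}
  Congruence : ℕ → Set
  Congruence q = χ (q ∸ k) * ((t ^ 2 + t + 1#) ^⁻ e₁ q k * (t + (- 1#)) ^⁻ e₂ q k)
    ≡ (t ^ 2 + t + 1#) ^⁺ e₁ q k * (t + (- 1#)) ^⁺ e₂ q k * det (t ^ 2 ⊙ I k ⊕ P k) [mod p ]
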